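{- Let $\mathcal{C}$ be a class of graphs closed under taking induced subgraphs. Then the following statements are equivalent: 1. First-order logic (FO) and guarded second-order logic (GSO) have the same expressive power on $\mathcal{C}$. 2. $\mathcal{C}$ has bounded tree depth.
   Context: Graphs are undirected and simple, viewed as logical structures over the vocabulary $\{E\}$ with $E$ binary (the symmetric, irreflexive edge relation), whose universe is the vertex set. An induced subgraph is obtained by deleting vertices together with exactly the edges incident with them. **Tree depth.** Let $G=(V,E)$ be a graph with connected components $(G_i)_{i\in I}$; $G[U]$ denotes the subgraph induced on $U\subseteq V$. The tree depth $\mathrm{td}(G)$ is defined recursively by $$\mathrm{td}(G)=\begin{cases}1 & \text{if } |V|=1,\\ 1+\min_{x\in V}\mathrm{td}(G[V\setminus\{x\}]) & \text{if } |V|>1 \text{ and } |I|=1,\\ \max_{i\in I}\mathrm{td}(G_i) & \text{otherwise.}\end{cases}$$ A class $\mathcal{C}$ of graphs has bounded tree depth if there is $d\in\mathbb{N}$ such that $\mathrm{td}(G)\le d$ for every $G\in\mathcal{C}$. **Logics.** FO is first-order logic with equality. GSO has the same syntax as full second-order logic (relation variables of arbitrary arity), but its semantics allows only guarded relations as values of second-order variables: the Gaifman graph of a relation $R\subseteq S^r$ on a set $S$ is the undirected graph with vertex set $S$ in which two distinct $u,v$ are adjacent iff both occur in a common tuple of $R$; the Gaifman graph of a structure is the union of the Gaifman graphs of its relations; and $R$ is guarded in a structure with universe $S$ if the Gaifman graph of $R$ is a subgraph of the Gaifman graph of the structure. **Expressive power.** For logics $L_1,L_2$ and a class $\mathcal{C}$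 of structures, $L_1\leqq_{\mathcal{C}}L_2$ means that for every $L_1$-sentence $\varphi_1$ there is an $L_2$-sentence $\varphi_2$ such that exactly the same members of $\mathcal{C}$ satisfy $\varphi_1$ and $\varphi_2$. $L_1$ and $L_2$ have the same expressive power on $\mathcal{C}$ if $L_1\leqq_{\mathcal{C}}L_2$ and $L_2\leqq_{\mathcal{C}}L_1$. -}

module Defs where

open import Level using (Level; 0ℓ) renaming (suc to lsuc)
open import Data.Bool.Base using (Bool; true; T)
open import Data.Bool.Properties using (T?)
open import Data.Fin.Base using (Fin; zero; suc)
import Data.Fin.Properties as Fin
open import Data.Fin.Subset using (Subset; inside; outside; Nonempty; ⊤; _-_; ∣_∣)
open import Data.Fin.Subset.Properties using (∣p∣≤n; ∣⊤∣≡n; ∣p∣≡n⇒p≡⊤; ∈⊤; x∈p⇒∣p-x∣<∣p∣)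
open import Data.List.Base using (List; []; _∷_; allFin)
open import Data.List.Membership.Propositional using (_∈_)
open import Data.List.Membership.Propositional.Properties using (∈-allFin)
open import Data.List.Relation.Unary.All as All using (All; []; _∷_)
open import Data.List.Relation.Unary.Any using (here; there)
open import Data.Nat.Base using (ℕ; zero; suc; _≤_; _<_; _⊓_; _⊔_)
open import Data.Nat.Induction using (Acc; acc; <-wellFounded)
import Data.Nat.Properties as ℕ
open import Data.Product.Base using (Σ; ∃; _×_; _,_)
open import Data.Sum.Base using (_⊎_; inj₁; inj₂)
open import Data.Vec.Base as Vec using (Vec; []; _∷_; lookup; tabulate)
open import Data.Vec.Functional using (head; tail; foldr)
import Data.Vec.Membership.Propositional as Vec
open import Data.Vec.Properties using ([]=⇒lookup; lookup∘tabulate)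
open import Function.Bundles using (_⇔_)
open import Relation.Binary.Core using (Rel; _⇒_)
open import Relation.Binary.Definitions using (Symmetric; Irreflexive; Decidable)
open import Relation.Binary.Construct.Closure.ReflexiveTransitive as Star using (Star; ε; _◅_; _◅◅_)
open import Relation.Binary.PropositionalEquality using (_≡_; _≢_; refl; sym; trans; cong; subst)
open import Relation.Nullary using (¬_; Dec; yes; no; does)
open import Relation.Nullary.Decidable using (map′; _×-dec_; _⊎-dec_)
open import Relation.Unary using (Pred)

-- A finite simple graph with vertex set Fin n.  The edge relation is
-- Boolean-valued, so that it is a set of pairs in the classical sense.

record Graph (n : ℕ) : Set where
  field
    adjacent : Fin n → Fin n → Bool

  E : Rel (Fin n) 0ℓ
  E u v = T (adjacent u v)

  field
    E-sym    : Symmetric E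
    E-irrefl : Irreflexive _≡_ E

  E? : Decidable E
  E? u v = T? (adjacent u v)

open Graph public

GraphClass : (ℓ : Level) → Set (lsuc ℓ)
GraphClass ℓ = ∀ n → Pred (Graph n) ℓ

-- The order-preserving enumeration of the elements of a subset.

element : ∀ {n} (U : Subset n) → Fin ∣ U ∣ → Fin n
element (inside  ∷ U) zero    = zero
element (inside  ∷ U) (suc i) = suc (element U i)
element (outside ∷ U) i       = suc (element U i)

element-injective : ∀ {n} (U : Subset n) {i j} → element U i ≡ element U j → i ≡ j
element-injective (inside  ∷ U) {zero}  {zero}  _  = refl
element-injective (inside  ∷ U) {suc i} {suc j} eq =
  cong suc (element-injective U (Fin.suc-injective eq))
element-injective (outside ∷ U)         eq = element-injective U (Fin.suc-injective eq)

-- G [ U ] has vertex set Fin ∣ U ∣; its i-th vertex is the i-th element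
-- of U.

infix 8 _[_]

_[_] : ∀ {n} → Graph n → (U : Subset n) → Graph ∣ U ∣
G [ U ] = record
  { adjacent = λ i j → adjacent G (element U i) (element U j)
  ; E-sym    = E-sym G
  ; E-irrefl = λ i≡j → E-irrefl G (cong (element U) i≡j)
  }

-- Universes of logical structures are usually required to be nonempty.
-- Here the graph without vertices is allowed in a class, but a class
-- need not contain it in order to be closed under induced subgraphs.

ClosedUnderInducedSubgraphs : ∀ {ℓ} → GraphClass ℓ → Set ℓ
ClosedUnderInducedSubgraphs C =
  ∀ {n} (G : Graph n) (U : Subset n) → Nonempty U → C n G → C ∣ U ∣ (G [ U ])

module _ {n} (G : Graph n) where

  Reachable : Rel (Fin n) 0ℓ
  Reachable = Star (E G)

  -- Only used for graphs with at least two vertices.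
  Connected : Set
  Connected = ∀ u v → Reachable u v

  Reachable-sym : Symmetric Reachable
  Reachable-sym = Star.reverse (E-sym G)

  -- Reachability is decided by the Floyd-Warshall recursion: Via xs u v
  -- says that there is a walk from u to v with inner vertices in xs.

  private
    Via : List (Fin n) → Rel (Fin n) 0ℓ
    Via []       u v = u ≡ v ⊎ E G u v
    Via (x ∷ xs) u v = Via xs u v ⊎ (Via xs u x × Via xs x v)

    via? : ∀ xs → Decidable (Via xs)
    via? []       u v = (u Fin.≟ v) ⊎-dec E? G u v
    via? (x ∷ xs) u v = via? xs u v ⊎-dec (via? xs u x ×-dec via? xs x v)

    via-sound : ∀ xs → Via xs ⇒ Reachable
    via-sound []       (inj₁ refl)    = ε
    via-sound []       (inj₂ e)       = e ◅ ε
    via-sound (x ∷ xs) (inj₁ p)       = via-sound xs p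
    via-sound (x ∷ xs) (inj₂ (p , q)) = via-sound xs p ◅◅ via-sound xs q

    via-base : ∀ xs → Via [] ⇒ Via xs
    via-base []       p = p
    via-base (x ∷ xs) p = inj₁ (via-base xs p)

    via-trans : ∀ xs {u x v} → x ∈ xs → Via xs u x → Via xs x v → Via xs u v
    via-trans (y ∷ xs) (here refl) p q = inj₂ (to p , from q)
      where
      to : ∀ {u} → Via (y ∷ xs) u y → Via xs u y
      to (inj₁ p)       = p
      to (inj₂ (p , _)) = p
      from : ∀ {v} → Via (y ∷ xs) y v → Via xs y v
      from (inj₁ q)       = q
      from (inj₂ (_ , q)) = q
    via-trans (y ∷ xs) (there x∈) (inj₁ p) (inj₁ q) = inj₁ (via-trans xs x∈ p q)
    via-trans (y ∷ xs) (there x∈) (inj₁ p) (inj₂ (q , r)) = inj₂ (via-trans xs x∈ p q , r)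
    via-trans (y ∷ xs) (there x∈) (inj₂ (p , q)) (inj₁ r) = inj₂ (p , via-trans xs x∈ q r)
    via-trans (y ∷ xs) (there x∈) (inj₂ (p , _)) (inj₂ (_ , s)) = inj₂ (p , s)

    via-complete : Reachable ⇒ Via (allFin n)
    via-complete ε       = via-base (allFin n) (inj₁ refl)
    via-complete (e ◅ p) =
      via-trans (allFin n) (∈-allFin _) (via-base (allFin n) (inj₂ e)) (via-complete p)

  reachable? : Decidable Reachable
  reachable? u v = map′ (via-sound _) via-complete (via? (allFin n) u v)

  connected? : Dec Connected
  connected? = Fin.all? λ u → Fin.all? λ v → reachable? u v

  component : Fin n → Subset n
  component v = tabulate λ u → does (reachable? v u)

  component≡⊤⇒connected : ∀ {v} → component v ≡ ⊤ → Connected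
  component≡⊤⇒connected {v} eq u w = Reachable-sym (reach u) ◅◅ reach w
    where
    reach : ∀ u → Reachable v u
    reach u = invert (reachable? v u) (trans (sym (lookup∘tabulate _ u))
      (trans (cong (λ U → lookup U u) eq) ([]=⇒lookup (∈⊤ {x = u}))))
      where
      invert : ∀ {P : Set} (P? : Dec P) → does P? ≡ true → P
      invert (yes p) _ = p

  component-< : ¬ Connected → ∀ v → ∣ component v ∣ < n
  component-< ¬conn v = ℕ.≤∧≢⇒< (∣p∣≤n (component v)) λ eq →
    ¬conn (component≡⊤⇒connected (∣p∣≡n⇒p≡⊤ eq))

minimum : ∀ {m} → (Fin (suc m) → ℕ) → ℕ
minimum f = foldr _⊓_ (head f) (tail f)

maximum : ∀ {m} → (Fin m → ℕ) → ℕ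
maximum = foldr _⊔_ 0

deletion-< : ∀ {n} (x : Fin n) → ∣ ⊤ - x ∣ < n
deletion-< {n} x = subst (∣ ⊤ - x ∣ <_) (∣⊤∣≡n n) (x∈p⇒∣p-x∣<∣p∣ (∈⊤ {x = x}))

-- The components of a graph are indexed by their vertices, hence with
-- repetitions, which does not affect the maximum.  The graph without
-- vertices has no components; its tree depth is the empty maximum.

treeDepth : ∀ {n} → Graph n → Acc _<_ n → ℕ
treeDepth {zero}        G _         = 0
treeDepth {suc zero}    G _         = 1
treeDepth {suc (suc _)} G (acc rec) with connected? G
... | yes _    = suc (minimum λ x → treeDepth (G [ ⊤ - x ]) (rec (deletion-< x)))
... | no ¬conn =
  maximum λ v → treeDepth (G [ component G v ]) (rec (component-< G ¬conn v))

td : ∀ {n} → Graph n → ℕ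
td {n} G = treeDepth G (<-wellFounded n)

BoundedTreeDepth : ∀ {ℓ} → GraphClass ℓ → Set ℓ
BoundedTreeDepth C = ∃ λ d → ∀ {n} (G : Graph n) → C n G → td G ≤ d

Relation : ℕ → ℕ → Set
Relation n r = Vec (Fin n) r → Bool

Gaifman : ∀ {n r} → Relation n r → Rel (Fin n) 0ℓ
Gaifman R u v = u ≢ v × ∃ λ t → T (R t) × u Vec.∈ t × v Vec.∈ t

edgeRelation : ∀ {n} → Graph n → Relation n 2
edgeRelation G (u ∷ v ∷ []) = adjacent G u v

-- E is the only relation of a graph, so its Gaifman graph is that of the
-- structure.

Guarded : ∀ {n r} → Graph n → Relation n r → Set
Guarded G R = Gaifman R ⇒ Gaifman (edgeRelation G)

infix  9 _≐_
infix  8 ¬′_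
infixr 7 _∧′_
infixr 6 _∨′_
infix  5 ∀′_ ∃′_ ∀²_∙_ ∃²_∙_

-- First-order formulas whose free variables are de Bruijn indices
-- below k.

data FOFormula (k : ℕ) : Set where
  edge      : (x y : Fin k) → FOFormula k
  _≐_       : (x y : Fin k) → FOFormula k
  ¬′_       : FOFormula k → FOFormula k
  _∧′_ _∨′_ : (φ ψ : FOFormula k) → FOFormula k
  ∀′_ ∃′_   : FOFormula (suc k) → FOFormula k

-- Second-order formulas.  Γ lists the arities of the relation variables
-- in scope.

data SOFormula (Γ : List ℕ) (k : ℕ) : Set where
  edge        : (x y : Fin k) → SOFormula Γ k
  _≐_         : (x y : Fin k) → SOFormula Γ k
  rel         : ∀ {r} (X : r ∈ Γ) (xs : Vec (Fin k) r) → SOFormula Γ k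
  ¬′_         : SOFormula Γ k → SOFormula Γ k
  _∧′_ _∨′_   : (φ ψ : SOFormula Γ k) → SOFormula Γ k
  ∀′_ ∃′_     : SOFormula Γ (suc k) → SOFormula Γ k
  ∀²_∙_ ∃²_∙_ : (r : ℕ) → SOFormula (r ∷ Γ) k → SOFormula Γ k

module _ {n} (G : Graph n) where

  FOSat : ∀ {k} → Vec (Fin n) k → FOFormula k → Set
  FOSat ρ (edge x y) = E G (lookup ρ x) (lookup ρ y)
  FOSat ρ (x ≐ y)    = lookup ρ x ≡ lookup ρ y
  FOSat ρ (¬′ φ)     = ¬ FOSat ρ φ
  FOSat ρ (φ ∧′ ψ)   = FOSat ρ φ × FOSat ρ ψ
  FOSat ρ (φ ∨′ ψ)   = FOSat ρ φ ⊎ FOSat ρ ψ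
  FOSat ρ (∀′ φ)     = ∀ a → FOSat (a ∷ ρ) φ
  FOSat ρ (∃′ φ)     = ∃ λ a → FOSat (a ∷ ρ) φ

  GSOSat : ∀ {Γ k} → All (Relation n) Γ → Vec (Fin n) k → SOFormula Γ k → Set
  GSOSat σ ρ (edge x y) = E G (lookup ρ x) (lookup ρ y)
  GSOSat σ ρ (x ≐ y)    = lookup ρ x ≡ lookup ρ y
  GSOSat σ ρ (rel X xs) = T (All.lookup σ X (Vec.map (lookup ρ) xs))
  GSOSat σ ρ (¬′ φ)     = ¬ GSOSat σ ρ φ
  GSOSat σ ρ (φ ∧′ ψ)   = GSOSat σ ρ φ × GSOSat σ ρ ψ
  GSOSat σ ρ (φ ∨′ ψ)   = GSOSat σ ρ φ ⊎ GSOSat σ ρ ψ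
  GSOSat σ ρ (∀′ φ)     = ∀ a → GSOSat σ (a ∷ ρ) φ
  GSOSat σ ρ (∃′ φ)     = ∃ λ a → GSOSat σ (a ∷ ρ) φ
  GSOSat σ ρ (∀² r ∙ φ) = ∀ (R : Relation n r) → Guarded G R → GSOSat (R ∷ σ) ρ φ
  GSOSat σ ρ (∃² r ∙ φ) = Σ (Relation n r) λ R → Guarded G R × GSOSat (R ∷ σ) ρ φ

record Logic : Set₁ where
  field
    Sentence : Set
    _⊨_      : ∀ {n} → Graph n → Sentence → Set

FO : Logic
FO = record { Sentence = FOFormula 0 ; _⊨_ = λ G φ → FOSat G [] φ }

GSO : Logic
GSO = record { Sentence = SOFormula [] 0 ; _⊨_ = λ G φ → GSOSat G [] [] φ }

infix 4 _≦[_]_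

_≦[_]_ : ∀ {ℓ} → Logic → GraphClass ℓ → Logic → Set ℓ
L₁ ≦[ C ] L₂ =
  ∀ (φ₁ : L₁.Sentence) → Σ L₂.Sentence λ φ₂ →
  ∀ {n} (G : Graph n) → C n G → (G L₁.⊨ φ₁) ⇔ (G L₂.⊨ φ₂)
  where
  module L₁ = Logic L₁
  module L₂ = Logic L₂

SameExpressivePower : ∀ {ℓ} → Logic → Logic → GraphClass ℓ → Set ℓ
SameExpressivePower L₁ L₂ C = L₁ ≦[ C ] L₂ × L₂ ≦[ C ] L₁

{-# OPTIONS --safe #-}
module Submission where

-- A sentence with q quantifiers cannot count isomorphic components beyond
-- a threshold: any two components can be exchanged by an automorphism, a
-- guarded relation lives on single components together with the vertices
-- joined to them, and by pigeonhole many components carry the same part of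
-- the relation.  On graphs of tree depth at most d, induction on d (delete
-- a root of every component and remember adjacency to it as a colour)
-- therefore yields finitely many models up to equivalence for a given
-- guarded second-order sentence φ.  Which of them a graph is equivalent to
-- is first-order expressible: components have bounded diameter, and the
-- number of components of each type is only counted up to a threshold.
-- The disjunction over the models that satisfy φ defines φ.
--
-- Conversely, graphs of large tree depth contain long paths, hence by
-- Ramsey's theorem large cliques, induced complete bipartite graphs or
-- long induced paths.  A perfect matching exists in P_2h, K_2h and K_h,h,
-- but for reasons of parity not in P_2h+1, K_2h+1 and K_h,h+1, although
-- for large h these pairs agree on first-order sentences of given
-- quantifier rank.  So if the guarded second-order sentence that asserts a
-- perfect matching has a first-order equivalent on the class, the tree
-- depth is bounded in terms of the rank of that equivalent.

open import Defs
open import Data.Bool.Base using (Bool; T; _∧_; false; if_then_else_; true)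
open import Data.Bool.Properties as Bool using (T?)
open import Data.Empty using (⊥; ⊥-elim)
open import Data.Fin.Base as Fin using (Fin; suc; zero)
import Data.Fin.Properties as Fin
open import Data.Fin.Subset as Subset using (Subset; _-_; inside; outside; ∣_∣)
import Data.Fin.Subset.Properties as Subset
open import Data.List.Base as List using
  (List; []; _++_; _∷_; allFin; cartesianProduct; cartesianProductWith;
   concatMap; drop; filter; length; replicate; reverseAcc; take; upTo)
import Data.List.Membership.DecPropositional as DecMembership
open import Data.List.Membership.Propositional using (_∈_; _─_; find; lose)
open import Data.List.Membership.Propositional.Properties using
  (∈-++⁺ʳ; ∈-++⁺ˡ; ∈-++⁻; ∈-allFin; ∈-cartesianProductWith⁺;
   ∈-cartesianProduct⁺; ∈-filter⁺; ∈-filter⁻; ∈-lookup; ∈-map⁺; ∈-map⁻; ∈-upTo⁺)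
import Data.List.Properties as List
open import Data.List.Relation.Binary.Sublist.Propositional using
  ([]; _∷_; _∷ʳ_; _⊆_; ⊆-refl; ⊆-trans) renaming (minimum to []-⊆)
import Data.List.Relation.Binary.Sublist.Propositional.Properties as Sublist
open import Data.List.Relation.Unary.All as All using (All; []; _∷_)
import Data.List.Relation.Unary.All.Properties as All
open import Data.List.Relation.Unary.AllPairs as AllPairs using (AllPairs; []; _∷_)
import Data.List.Relation.Unary.AllPairs.Properties as AllPairs
open import Data.List.Relation.Unary.Any as Any using (here; there)
open import Data.List.Relation.Unary.Linked as Linked using (Linked; [-]; []; _∷_)
import Data.List.Relation.Unary.Linked.Properties as Linked
open import Data.List.Relation.Unary.Unique.Propositional using (Unique)
import Data.List.Relation.Unary.Unique.Propositional.Properties as Unique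
open import Data.Maybe.Base using (Maybe; fromMaybe; just; nothing)
open import Data.Maybe.Properties using (just-injective)
open import Data.Nat.Base using (_*_; _+_; _<_; _^_; _∸_; _≤_; _⊓_; _⊔_; suc; s≤s; zero; z≤n; ℕ)
open import Data.Nat.Induction using (<-wellFounded; Acc; acc)
import Data.Nat.Properties as ℕ
open import Data.Product.Base using (_,_; _×_; map₁; map₂; proj₁; proj₂; Σ; ∃)
open import Data.Product.Function.NonDependent.Propositional using (_×-⇔_)
import Data.Product.Properties as Product
open import Data.Sum.Base as Sum using ([_,_]; _⊎_; assocʳ; inj₁; inj₂; swap)
open import Data.Sum.Function.Propositional using (_⊎-⇔_)
open import Data.Sum.Properties as Sum using (inj₁-injective; inj₂-injective)
open import Data.Unit.Base using (tt; ⊤)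
import Data.Unit.Properties as Unit
open import Data.Vec.Base as Vec using (Vec; []; _∷_; lookup)
open import Data.Vec.Functional using (foldr)
import Data.Vec.Membership.Propositional as Vec
import Data.Vec.Membership.Propositional.Properties as Vec
import Data.Vec.Properties as Vec
import Data.Vec.Relation.Unary.All as VecAll
import Data.Vec.Relation.Unary.All.Properties as VecAll
import Data.Vec.Relation.Unary.Any as VecAny
open import Function.Base using (_∘_; case_of_; id)
open import Function.Bundles using (_⇔_; mk⇔; module Equivalence)
open import Function.Construct.Composition using (_⇔-∘_)
open import Function.Construct.Identity using (⇔-id)
open import Function.Construct.Symmetry using (⇔-sym)
open import Level using (Level)
open import Relation.Binary.Construct.Closure.ReflexiveTransitive as Star using (Star; _◅_; _◅◅_; ε)
open import Relation.Binary.Definitions using (DecidableEquality)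
open import Relation.Binary.PropositionalEquality hiding ([_])
open import Relation.Nullary using (Dec; contradiction; does; no; yes; ¬_)
open import Relation.Nullary.Decidable as Dec using
  (_×-dec_; _→-dec_; _⊎-dec_; dec-false; dec-true; decidable-stable;
   fromWitness; isYes; map′; toWitness; ¬?)
open import Relation.Unary using (Decidable)

open Equivalence using (to; from)

-- The pigeonhole argument needs components of bounded size, but components of bounded tree depth
-- can be arbitrarily large. So a component is replaced by one of finitely many finite models before
-- anything is counted, and the counting threshold comes from the size of that model. The
-- replacement must be harmless inside every larger graph and for all roots deleted so far. Instead
-- of a composition theorem for types, equivalence means agreement on the one sentence φ in every
-- context. No procedure is at hand to decide this equivalence; therefore each model is accompanied
-- by a first-order formula that implies it. These formulas may overlap: it matters only that they
-- are sound and that one of them holds in every graph of the given depth. Since the models are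
-- finite, truth of φ in them is decidable, which selects the disjuncts. In the converse direction
-- nothing has to be searched for. A pair of twins, one with and one without a perfect matching,
-- would refute the first-order equivalent; the absence of twins bounds cliques, bicliques and
-- induced paths, these bound all paths, and paths bound the tree depth.

¬-⇔ : ∀ {a b} {A : Set a} {B : Set b} → A ⇔ B → (¬ A) ⇔ (¬ B)
¬-⇔ e = mk⇔ (_∘ from e) (_∘ to e)

-- Relativised semantics and coloured structures

Rels : Set → List ℕ → Set
Rels V = All (λ r → Vec V r → Bool)

module Semantics {V : Set} (D : V → Set) (adj : V → V → Set) where

  -- Ranges over all tuples of `V`, also those that leave `D`. Hence it does not depend on `D` and
  -- passes unchanged between a structure and its induced substructures.
  Guard : ∀ {r} → (Vec V r → Bool) → Set
  Guard R = ∀ t → T (R t) → ∀ {u v} → u Vec.∈ t → v Vec.∈ t → u ≢ v → adj u v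

  Sat : ∀ {Γ k} → Rels V Γ → Vec V k → SOFormula Γ k → Set
  Sat σ ρ (edge x y) = adj (lookup ρ x) (lookup ρ y)
  Sat σ ρ (x ≐ y)    = lookup ρ x ≡ lookup ρ y
  Sat σ ρ (rel X xs) = T (All.lookup σ X (Vec.map (lookup ρ) xs))
  Sat σ ρ (¬′ φ)     = ¬ Sat σ ρ φ
  Sat σ ρ (φ ∧′ ψ)   = Sat σ ρ φ × Sat σ ρ ψ
  Sat σ ρ (φ ∨′ ψ)   = Sat σ ρ φ ⊎ Sat σ ρ ψ
  Sat σ ρ (∀′ φ)     = ∀ a → D a → Sat σ (a ∷ ρ) φ
  Sat σ ρ (∃′ φ)     = ∃ λ a → D a × Sat σ (a ∷ ρ) φ
  Sat σ ρ (∀² r ∙ φ) = ∀ R → Guard R → Sat (R ∷ σ) ρ φ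
  Sat σ ρ (∃² r ∙ φ) = Σ (Vec V r → Bool) λ R → Guard R × Sat (R ∷ σ) ρ φ

-- Quantifiers over vertices are relativised to D, so that the induced
-- subgraphs of a graph share its vertex type.

record Str (c : ℕ) : Set₁ where
  field
    V   : Set
    D   : V → Set
    D?  : ∀ v → Dec (D v)
    adj : V → V → Set
    col : Fin c → V → Set

infix 4 _⊨_ _≅_

_⊨_ : ∀ {c} → Str c → SOFormula [] 0 → Set
M ⊨ φ = Semantics.Sat (Str.D M) (Str.adj M) [] [] φ

record _≅_ {c} (M N : Str c) : Set where
  private
    module M = Str M
    module N = Str N
  field
    f     : M.V → N.V
    f-D   : ∀ {v} → M.D v → N.D (f v)
    f-inj : ∀ {u v} → M.D u → M.D v → f u ≡ f v → u ≡ v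
    f-sur : ∀ w → N.D w → ∃ λ v → M.D v × f v ≡ w
    f-adj : ∀ {u v} → M.D u → M.D v → M.adj u v ⇔ N.adj (f u) (f v)
    f-col : ∀ {i v} → M.D v → M.col i v ⇔ N.col i (f v)

-- Invariance of satisfaction under isomorphism

map-lookup-All : ∀ {V : Set} {P : V → Set} {k r} {ρ : Vec V k} → VecAll.All P ρ →
                 (xs : Vec (Fin k) r) → VecAll.All P (Vec.map (lookup ρ) xs)
map-lookup-All ps xs = VecAll.map⁺ (VecAll.universal (VecAll.lookup⁺ ps) xs)

-- An isomorphism says nothing about vertices outside `D`. Dropping the tuples that leave `D` keeps
-- a pulled back relation guarded, and formulas never look at these tuples.
restrict : ∀ {V W : Set} {D : V → Set} → (∀ v → Dec (D v)) → (V → W) →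
           ∀ {r} → (Vec W r → Bool) → Vec V r → Bool
restrict D? f R t = does (VecAll.all? D? t) ∧ R (Vec.map f t)

restrict-≡ : ∀ {V W : Set} {D : V → Set} (D? : ∀ v → Dec (D v)) (f : V → W) {r} (R : Vec W r → Bool)
             {t} → VecAll.All D t → restrict D? f R t ≡ R (Vec.map f t)
restrict-≡ D? f R {t} ps rewrite dec-true (VecAll.all? D? t) ps = refl

restrict-T : ∀ {V W : Set} {D : V → Set} (D? : ∀ v → Dec (D v)) (f : V → W) {r} (R : Vec W r → Bool)
             {t} → T (restrict D? f R t) → VecAll.All D t × T (R (Vec.map f t))
restrict-T D? f R {t} p with VecAll.all? D? t
... | yes ps = ps , p

∈-mapᵛ⁻ : ∀ {V W : Set} {f : V → W} {r} (s : Vec V r) {w} → w Vec.∈ Vec.map f s →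
  ∃ λ v → v Vec.∈ s × w ≡ f v
∈-mapᵛ⁻ (v ∷ s) (VecAny.here eq) = v , VecAny.here refl , eq
∈-mapᵛ⁻ (_ ∷ s) (VecAny.there p) = let v , v∈ , eq = ∈-mapᵛ⁻ s p in v , VecAny.there v∈ , eq

module _ {c} {M N : Str c} (i : M ≅ N) where
  private
    module M = Str M
    module N = Str N
    module MS = Semantics M.D M.adj
    module NS = Semantics N.D N.adj
  open _≅_ i

  -- Agreement is required over `D` only. Together with `≅-refl` this makes satisfaction independent
  -- of the values of a relation outside `D` and of the choice among pointwise equal relations.
  Corresponding : ∀ {Γ} → Rels M.V Γ → Rels N.V Γ → Set
  Corresponding σ τ = ∀ {r} (X : r ∈ _) {t} → VecAll.All M.D t →
                      All.lookup σ X t ≡ All.lookup τ X (Vec.map f t)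

  private
    map-All : ∀ {r} {t : Vec M.V r} → VecAll.All M.D t → VecAll.All N.D (Vec.map f t)
    map-All = VecAll.map⁺ ∘ VecAll.map f-D

    preimage : ∀ {r} {t : Vec N.V r} → VecAll.All N.D t →
      Σ (Vec M.V r) λ s → VecAll.All M.D s × Vec.map f s ≡ t
    preimage VecAll.[] = [] , VecAll.[] , refl
    preimage {t = w ∷ _} (d VecAll.∷ ds) with f-sur w d | preimage ds
    ... | v , dv , refl | s , dss , refl = v ∷ s , dv VecAll.∷ dss , refl

    map-injective : ∀ {r} {s t : Vec M.V r} → VecAll.All M.D s → VecAll.All M.D t →
      Vec.map f s ≡ Vec.map f t → s ≡ t
    map-injective VecAll.[] VecAll.[] _ = refl
    map-injective (d VecAll.∷ ds) (e VecAll.∷ es) eq =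
      cong₂ _∷_ (f-inj d e (Vec.∷-injectiveˡ eq)) (map-injective ds es (Vec.∷-injectiveʳ eq))

    push : ∀ {r} → (Vec M.V r → Bool) → Vec N.V r → Bool
    push R t with VecAll.all? N.D? t
    ... | yes ds = R (proj₁ (preimage ds))
    ... | no _   = false

    push-≡ : ∀ {r} (R : Vec M.V r → Bool) {t} → VecAll.All M.D t → R t ≡ push R (Vec.map f t)
    push-≡ R {t} ds with VecAll.all? N.D? (Vec.map f t)
    ... | no ¬ds = contradiction (map-All ds) ¬ds
    ... | yes es with preimage es
    ...   | _ , ds′ , eq = cong R (sym (map-injective ds′ ds eq))

    push-guard : ∀ {r} {R : Vec M.V r → Bool} → MS.Guard R → NS.Guard (push R)
    push-guard {R = R} gd t p u∈ v∈ u≢v with VecAll.all? N.D? t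
    ... | yes ds with preimage ds
    ...   | s , ds′ , refl with locate u∈ | locate v∈
      where
      locate : ∀ {w} → w Vec.∈ Vec.map f s → ∃ λ v → v Vec.∈ s × w ≡ f v
      locate = ∈-mapᵛ⁻ s
    ...     | u , u∈s , refl | v , v∈s , refl =
      to (f-adj (VecAll.lookup ds′ u∈s) (VecAll.lookup ds′ v∈s)) (gd _ p u∈s v∈s (u≢v ∘ cong f))

    pull : ∀ {r} → (Vec N.V r → Bool) → Vec M.V r → Bool
    pull = restrict M.D? f

    pull-guard : ∀ {r} {R : Vec N.V r → Bool} → NS.Guard R → MS.Guard (pull R)
    pull-guard {R = R} gd t p u∈ v∈ u≢v with restrict-T M.D? f R {t} p
    ... | ds , q = from (f-adj du dv)
      (gd _ q (Vec.∈-map⁺ f u∈) (Vec.∈-map⁺ f v∈) (u≢v ∘ f-inj du dv))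
      where
      du = VecAll.lookup ds u∈
      dv = VecAll.lookup ds v∈

  corresponding-∷ : ∀ {Γ} {σ : Rels M.V Γ} {τ : Rels N.V Γ} {r} {R : Vec M.V r → Bool} {S : Vec N.V r → Bool} →
           (∀ {t} → VecAll.All M.D t → R t ≡ S (Vec.map f t)) →
           Corresponding σ τ → Corresponding (R ∷ σ) (S ∷ τ)
  corresponding-∷ eq cor (here refl) = eq
  corresponding-∷ eq cor (there X)   = cor X

  ≅-sat : ∀ {Γ k} {σ : Rels M.V Γ} {τ : Rels N.V Γ} → Corresponding σ τ →
          (ρ : Vec M.V k) → VecAll.All M.D ρ → ∀ φ → MS.Sat σ ρ φ ⇔ NS.Sat τ (Vec.map f ρ) φ
  ≅-sat cor ρ ds (edge x y)
    rewrite Vec.lookup-map x f ρ | Vec.lookup-map y f ρ =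
      f-adj (VecAll.lookup⁺ ds x) (VecAll.lookup⁺ ds y)
  ≅-sat cor ρ ds (x ≐ y)
    rewrite Vec.lookup-map x f ρ | Vec.lookup-map y f ρ =
    mk⇔ (cong f) (f-inj (VecAll.lookup⁺ ds x) (VecAll.lookup⁺ ds y))
  ≅-sat {τ = τ} cor ρ ds (rel X xs) = mk⇔ (subst T eq) (subst T (sym eq))
    where
    eq = trans (cor X (map-lookup-All ds xs)) (cong (All.lookup τ X)
      (trans (sym (Vec.map-∘ f (lookup ρ) xs)) (Vec.map-cong (λ x → sym (Vec.lookup-map x f ρ)) xs)))
  ≅-sat cor ρ ds (¬′ φ)   = ¬-⇔ (≅-sat cor ρ ds φ)
  ≅-sat cor ρ ds (φ ∧′ ψ) = ≅-sat cor ρ ds φ ×-⇔ ≅-sat cor ρ ds ψ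
  ≅-sat cor ρ ds (φ ∨′ ψ) = ≅-sat cor ρ ds φ ⊎-⇔ ≅-sat cor ρ ds ψ
  ≅-sat {τ = τ} cor ρ ds (∀′ φ) = mk⇔
    (λ h b db → let a , da , fa≡b = f-sur b db in
      subst (λ x → NS.Sat τ (x ∷ Vec.map f ρ) φ) fa≡b
        (to (≅-sat cor (a ∷ ρ) (da VecAll.∷ ds) φ) (h a da)))
    (λ h a da → from (≅-sat cor (a ∷ ρ) (da VecAll.∷ ds) φ) (h (f a) (f-D da)))
  ≅-sat {τ = τ} cor ρ ds (∃′ φ) = mk⇔
    (λ (a , da , s) → f a , f-D da , to (≅-sat cor (a ∷ ρ) (da VecAll.∷ ds) φ) s)
    (λ (b , db , s) → let a , da , fa≡b = f-sur b db in
      a , da , from (≅-sat cor (a ∷ ρ) (da VecAll.∷ ds) φ)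
        (subst (λ x → NS.Sat τ (x ∷ Vec.map f ρ) φ) (sym fa≡b) s))
  ≅-sat cor ρ ds (∀² r ∙ φ) = mk⇔
    (λ h S gd → to (≅-sat (corresponding-∷ (restrict-≡ M.D? f S) cor) ρ ds φ) (h (pull S) (pull-guard gd)))
    (λ h R gd → from (≅-sat (corresponding-∷ (push-≡ R) cor) ρ ds φ) (h (push R) (push-guard gd)))
  ≅-sat cor ρ ds (∃² r ∙ φ) = mk⇔
    (λ (R , gd , s) → push R , push-guard gd , to (≅-sat (corresponding-∷ (push-≡ R) cor) ρ ds φ) s)
    (λ (S , gd , s) → pull S , pull-guard gd , from (≅-sat (corresponding-∷ (restrict-≡ M.D? f S) cor) ρ ds φ) s)

  ≅-⊨ : ∀ φ → M ⊨ φ ⇔ N ⊨ φ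
  ≅-⊨ = ≅-sat (λ ()) [] VecAll.[]

≅-refl : ∀ {c} {M : Str c} → M ≅ M
≅-refl = record
  { f = id ; f-D = id ; f-inj = λ _ _ → id ; f-sur = λ w d → w , d , refl
  ; f-adj = λ _ _ → ⇔-id _ ; f-col = λ _ → ⇔-id _ }

-- Operations on structures

sum-dec : ∀ {A B : Set} {P : A → Set} {Q : B → Set} → (∀ a → Dec (P a)) → (∀ b → Dec (Q b)) →
          ∀ x → Dec ([ P , Q ] x)
sum-dec p q (inj₁ a) = p a
sum-dec p q (inj₂ b) = q b

module _ {c : ℕ} where

  Attached : {V W : Set} → (Fin c → V) → (Fin c → W → Set) → V → W → Set
  Attached a col v w = ∃ λ j → a j ≡ v × col j w

-- Colours stand for adjacency to vertices that have been deleted: in the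
-- context E the vertices of colour j are joined to the vertex a j.

plug : ∀ {c} (E : Str 0) → (Fin c → Str.V E) → Str c → Str 0
plug E a G = record
  { V   = E.V ⊎ G.V
  ; D   = [ E.D , G.D ]
  ; D?  = sum-dec E.D? G.D?
  ; adj = λ where
      (inj₁ u) (inj₁ v) → E.adj u v
      (inj₁ u) (inj₂ v) → Attached a G.col u v
      (inj₂ u) (inj₁ v) → Attached a G.col v u
      (inj₂ u) (inj₂ v) → G.adj u v
  ; col = λ ()
  }
  where
  module E = Str E
  module G = Str G

infixr 6 _⊔ˢ_

_⊔ˢ_ : ∀ {c} → Str c → Str c → Str c
K ⊔ˢ L = record
  { V   = K.V ⊎ L.V
  ; D   = [ K.D , L.D ]
  ; D?  = sum-dec K.D? L.D?
  ; adj = λ where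
      (inj₁ u) (inj₁ v) → K.adj u v
      (inj₁ u) (inj₂ v) → ⊥
      (inj₂ u) (inj₁ v) → ⊥
      (inj₂ u) (inj₂ v) → L.adj u v
  ; col = λ j → [ K.col j , L.col j ]
  }
  where
  module K = Str K
  module L = Str L

emptyˢ : ∀ {c} → Str c
emptyˢ = record { V = ⊥ ; D = λ () ; D? = λ () ; adj = λ () ; col = λ _ () }

point : ∀ {c} → Vec Bool c → Str c
point b = record
  { V = ⊤ ; D = λ _ → ⊤ ; D? = λ _ → yes tt ; adj = λ _ _ → ⊥ ; col = λ j _ → T (lookup b j) }

-- Colour 0 of A becomes adjacency to the new vertex.

addRoot : ∀ {c} → Vec Bool c → Str (suc c) → Str c
addRoot b A = record
  { V   = ⊤ ⊎ A.V
  ; D   = [ (λ _ → ⊤) , A.D ]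
  ; D?  = sum-dec (λ _ → yes tt) A.D?
  ; adj = λ where
      (inj₁ _) (inj₁ _) → ⊥
      (inj₁ _) (inj₂ v) → A.col zero v
      (inj₂ u) (inj₁ _) → A.col zero u
      (inj₂ u) (inj₂ v) → A.adj u v
  ; col = λ j → [ (λ _ → T (lookup b j)) , A.col (suc j) ]
  }
  where
  module A = Str A

copies : ∀ {c} → ℕ → Str c → Str c
copies t H = record
  { V   = Fin t × H.V
  ; D   = H.D ∘ proj₂
  ; D?  = H.D? ∘ proj₂
  ; adj = λ (i , u) (j , v) → i ≡ j × H.adj u v
  ; col = λ j → H.col j ∘ proj₂
  }
  where
  module H = Str H

-- Isomorphisms between composed structures

plug-cong : ∀ {c} {E a} {G H : Str c} → G ≅ H → plug E a G ≅ plug E a H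
plug-cong {G = G} {H} i = record
  { f = λ where (inj₁ e) → inj₁ e ; (inj₂ v) → inj₂ (f v)
  ; f-D = λ { {inj₁ _} d → d ; {inj₂ _} d → f-D d }
  ; f-inj = λ
      { {inj₁ _} {inj₁ _} _ _ refl → refl
      ; {inj₂ _} {inj₂ _} c d eq   → cong inj₂ (f-inj c d (inj₂-injective eq)) }
  ; f-sur = λ where
      (inj₁ e) d → inj₁ e , d , refl
      (inj₂ w) d → let v , dv , eq = f-sur w d in inj₂ v , dv , cong inj₂ eq
  ; f-adj = λ
      { {inj₁ _} {inj₁ _} _ _ → ⇔-id _
      ; {inj₁ _} {inj₂ _} _ d → attached d
      ; {inj₂ _} {inj₁ _} d _ → attached d
      ; {inj₂ _} {inj₂ _} c d → f-adj c d }
  ; f-col = λ { {()} }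
  }
  where
  open _≅_ i
  attached : ∀ {W : Set} {a : _ → W} {e v} → Str.D G v →
             Attached a (Str.col G) e v ⇔ Attached a (Str.col H) e (f v)
  attached d =
    mk⇔ (λ (j , eq , p) → j , eq , to (f-col d) p) (λ (j , eq , p) → j , eq , from (f-col d) p)

-- `L` moves into the context. All roots `a j` lie in `E`, so no colour attaches a vertex of `K` to
-- `L`.
plug-⊔ : ∀ {c} {E} {a : Fin c → Str.V E} (K L : Str c) →
         plug E a (K ⊔ˢ L) ≅ plug (plug E a L) (inj₁ ∘ a) K
plug-⊔ {E = E} {a} K L = record
  { f = λ where (inj₁ e) → inj₁ (inj₁ e) ; (inj₂ (inj₁ k)) → inj₂ k ; (inj₂ (inj₂ l)) → inj₁ (inj₂ l)
  ; f-D = λ { {inj₁ _} d → d ; {inj₂ (inj₁ _)} d → d ; {inj₂ (inj₂ _)} d → d }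
  ; f-inj = λ
      { {inj₁ _} {inj₁ _} _ _ refl → refl
      ; {inj₁ _} {inj₂ (inj₁ _)} _ _ ()
      ; {inj₁ _} {inj₂ (inj₂ _)} _ _ ()
      ; {inj₂ (inj₁ _)} {inj₂ (inj₁ _)} _ _ refl → refl
      ; {inj₂ (inj₂ _)} {inj₂ (inj₂ _)} _ _ refl → refl }
  ; f-sur = λ where
      (inj₁ (inj₁ e)) d → inj₁ e , d , refl
      (inj₁ (inj₂ l)) d → inj₂ (inj₂ l) , d , refl
      (inj₂ k)        d → inj₂ (inj₁ k) , d , refl
  ; f-adj = λ
      { {inj₁ _} {inj₁ _} _ _ → ⇔-id _
      ; {inj₁ _} {inj₂ (inj₁ _)} _ _ → old
      ; {inj₁ _} {inj₂ (inj₂ _)} _ _ → ⇔-id _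
      ; {inj₂ (inj₁ _)} {inj₁ _} _ _ → old
      ; {inj₂ (inj₁ _)} {inj₂ (inj₁ _)} _ _ → ⇔-id _
      ; {inj₂ (inj₁ _)} {inj₂ (inj₂ _)} _ _ → none
      ; {inj₂ (inj₂ _)} {inj₁ _} _ _ → ⇔-id _
      ; {inj₂ (inj₂ _)} {inj₂ (inj₁ _)} _ _ → none
      ; {inj₂ (inj₂ _)} {inj₂ (inj₂ _)} _ _ → ⇔-id _ }
  ; f-col = λ { {()} }
  }
  where
  old : ∀ {e k} → Attached a (Str.col K) e k ⇔
        Attached {V = Str.V E ⊎ Str.V L} (inj₁ ∘ a) (Str.col K) (inj₁ e) k
  old = mk⇔ (λ where (j , refl , p) → j , refl , p) (λ where (j , refl , p) → j , refl , p)
  none : ∀ {l k} → ⊥ ⇔ Attached {V = Str.V E ⊎ Str.V L} (inj₁ ∘ a) (Str.col K) (inj₂ l) k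
  none = mk⇔ (λ ()) (λ where (_ , () , _))

cons : ∀ {c ℓ} {V : Set ℓ} → V → (Fin c → V) → Fin (suc c) → V
cons v a zero    = v
cons v a (suc j) = a j

-- The new root moves into the context and serves the additional colour 0 there; its bits `b` turn
-- from colours into edges to the older roots.
plug-addRoot : ∀ {c} {E} {a : Fin c → Str.V E} b (A : Str (suc c)) →
               plug E a (addRoot b A) ≅ plug (plug E a (point b)) (cons (inj₂ tt) (inj₁ ∘ a)) A
plug-addRoot {E = E} {a} b A = record
  { f = λ where (inj₁ e) → inj₁ (inj₁ e) ; (inj₂ (inj₁ x)) → inj₁ (inj₂ x) ; (inj₂ (inj₂ v)) → inj₂ v
  ; f-D = λ { {inj₁ _} d → d ; {inj₂ (inj₁ _)} d → d ; {inj₂ (inj₂ _)} d → d }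
  ; f-inj = λ
      { {inj₁ _} {inj₁ _} _ _ refl → refl
      ; {inj₁ _} {inj₂ (inj₁ _)} _ _ ()
      ; {inj₁ _} {inj₂ (inj₂ _)} _ _ ()
      ; {inj₂ (inj₁ _)} {inj₂ (inj₁ _)} _ _ refl → refl
      ; {inj₂ (inj₂ _)} {inj₂ (inj₂ _)} _ _ refl → refl }
  ; f-sur = λ where
      (inj₁ (inj₁ e)) d → inj₁ e , d , refl
      (inj₁ (inj₂ x)) d → inj₂ (inj₁ x) , d , refl
      (inj₂ v)        d → inj₂ (inj₂ v) , d , refl
  ; f-adj = λ
      { {inj₁ _} {inj₁ _} _ _ → ⇔-id _
      ; {inj₁ _} {inj₂ (inj₁ _)} _ _ → ⇔-id _
      ; {inj₁ _} {inj₂ (inj₂ _)} _ _ → old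
      ; {inj₂ (inj₁ _)} {inj₁ _} _ _ → ⇔-id _
      ; {inj₂ (inj₁ _)} {inj₂ (inj₁ _)} _ _ → ⇔-id _
      ; {inj₂ (inj₁ _)} {inj₂ (inj₂ _)} _ _ → new
      ; {inj₂ (inj₂ _)} {inj₁ _} _ _ → old
      ; {inj₂ (inj₂ _)} {inj₂ (inj₁ _)} _ _ → new
      ; {inj₂ (inj₂ _)} {inj₂ (inj₂ _)} _ _ → ⇔-id _ }
  ; f-col = λ { {()} }
  }
  where
  a⁺ : Fin _ → Str.V E ⊎ ⊤
  a⁺ = cons (inj₂ tt) (inj₁ ∘ a)
  old : ∀ {e v} → Attached a (Str.col A ∘ suc) e v ⇔ Attached a⁺ (Str.col A) (inj₁ e) v
  old = mk⇔ (λ where (j , refl , p) → suc j , refl , p) (λ where (suc j , refl , p) → j , refl , p)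
  new : ∀ {v} → Str.col A zero v ⇔ Attached a⁺ (Str.col A) (inj₂ tt) v
  new = mk⇔ (λ p → zero , refl , p) (λ where (zero , _ , p) → p ; (suc _ , () , _))

plug-empty : {a : Fin 0 → ⊥} (G : Str 0) → G ≅ plug emptyˢ a G
plug-empty G = record
  { f = inj₂
  ; f-D = id
  ; f-inj = λ _ _ → inj₂-injective
  ; f-sur = λ where (inj₂ v) d → v , d , refl
  ; f-adj = λ _ _ → ⇔-id _
  ; f-col = λ { {()} }
  }

⊔-comm : ∀ {c} (K L : Str c) → K ⊔ˢ L ≅ L ⊔ˢ K
⊔-comm K L = record
  { f = swap
  ; f-D = λ { {inj₁ _} d → d ; {inj₂ _} d → d }
  ; f-inj = λ { {inj₁ _} {inj₁ _} _ _ refl → refl ; {inj₂ _} {inj₂ _} _ _ refl → refl }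
  ; f-sur = λ where (inj₁ l) d → inj₂ l , d , refl ; (inj₂ k) d → inj₁ k , d , refl
  ; f-adj = λ
      { {inj₁ _} {inj₁ _} _ _ → ⇔-id _
      ; {inj₁ _} {inj₂ _} _ _ → ⇔-id _
      ; {inj₂ _} {inj₁ _} _ _ → ⇔-id _
      ; {inj₂ _} {inj₂ _} _ _ → ⇔-id _ }
  ; f-col = λ { {_} {inj₁ _} _ → ⇔-id _ ; {_} {inj₂ _} _ → ⇔-id _ }
  }

⊔-assoc : ∀ {c} (K L M : Str c) → (K ⊔ˢ L) ⊔ˢ M ≅ K ⊔ˢ (L ⊔ˢ M)
⊔-assoc K L M = record
  { f = assocʳ
  ; f-D = λ { {inj₁ (inj₁ _)} d → d ; {inj₁ (inj₂ _)} d → d ; {inj₂ _} d → d }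
  ; f-inj = λ
      { {inj₁ (inj₁ _)} {inj₁ (inj₁ _)} _ _ refl → refl
      ; {inj₁ (inj₂ _)} {inj₁ (inj₂ _)} _ _ refl → refl
      ; {inj₂ _} {inj₁ (inj₁ _)} _ _ ()
      ; {inj₂ _} {inj₁ (inj₂ _)} _ _ ()
      ; {inj₂ _} {inj₂ _} _ _ refl → refl }
  ; f-sur = λ where
      (inj₁ k) d → inj₁ (inj₁ k) , d , refl
      (inj₂ (inj₁ l)) d → inj₁ (inj₂ l) , d , refl
      (inj₂ (inj₂ m)) d → inj₂ m , d , refl
  ; f-adj = λ
      { {inj₁ (inj₁ _)} {inj₁ (inj₁ _)} _ _ → ⇔-id _
      ; {inj₁ (inj₁ _)} {inj₁ (inj₂ _)} _ _ → ⇔-id _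
      ; {inj₁ (inj₁ _)} {inj₂ _} _ _ → ⇔-id _
      ; {inj₁ (inj₂ _)} {inj₁ (inj₁ _)} _ _ → ⇔-id _
      ; {inj₁ (inj₂ _)} {inj₁ (inj₂ _)} _ _ → ⇔-id _
      ; {inj₁ (inj₂ _)} {inj₂ _} _ _ → ⇔-id _
      ; {inj₂ _} {inj₁ (inj₁ _)} _ _ → ⇔-id _
      ; {inj₂ _} {inj₁ (inj₂ _)} _ _ → ⇔-id _
      ; {inj₂ _} {inj₂ _} _ _ → ⇔-id _ }
  ; f-col = λ
      { {_} {inj₁ (inj₁ _)} _ → ⇔-id _
      ; {_} {inj₁ (inj₂ _)} _ → ⇔-id _
      ; {_} {inj₂ _} _ → ⇔-id _ }
  }

⊔-identityʳ : ∀ {c} (K L : Str c) → (∀ v → ¬ Str.D L v) → K ≅ K ⊔ˢ L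
⊔-identityʳ K L ∅ = record
  { f = inj₁
  ; f-D = id
  ; f-inj = λ _ _ → inj₁-injective
  ; f-sur = λ where (inj₁ k) d → k , d , refl ; (inj₂ l) d → ⊥-elim (∅ l d)
  ; f-adj = λ _ _ → ⇔-id _
  ; f-col = λ _ → ⇔-id _
  }

copies-suc : ∀ {c} t (H : Str c) → copies (suc t) H ≅ H ⊔ˢ copies t H
copies-suc t H = record
  { f = λ where (zero , v) → inj₁ v ; (suc i , v) → inj₂ (i , v)
  ; f-D = λ { {zero , _} d → d ; {suc _ , _} d → d }
  ; f-inj = λ { {zero , _} {zero , _} _ _ refl → refl ; {suc _ , _} {suc _ , _} _ _ refl → refl }
  ; f-sur = λ where (inj₁ v) d → (zero , v) , d , refl ; (inj₂ (i , v)) d → (suc i , v) , d , refl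
  ; f-adj = λ
      { {zero , _} {zero , _} _ _ → mk⇔ proj₂ (refl ,_)
      ; {zero , _} {suc _ , _} _ _ → mk⇔ (λ ()) (λ ())
      ; {suc _ , _} {zero , _} _ _ → mk⇔ (λ ()) (λ ())
      ; {suc _ , _} {suc _ , _} _ _ → mk⇔ (map₁ Fin.suc-injective) (map₁ (cong suc)) }
  ; f-col = λ { {_} {zero , _} _ → ⇔-id _ ; {_} {suc _ , _} _ → ⇔-id _ }
  }

-- The quantification over all contexts makes _≈_ a congruence for _⊔ˢ_
-- and addRoot, because both can be absorbed by the context.

module Context (φ : SOFormula [] 0) where

  infix 4 _≈_

  _≈_ : ∀ {c} → Str c → Str c → Set₁
  G ≈ H = ∀ E a → plug E a G ⊨ φ ⇔ plug E a H ⊨ φ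

  module _ {c : ℕ} where

    ≈-sym : {G H : Str c} → G ≈ H → H ≈ G
    ≈-sym p E a = ⇔-sym (p E a)

    ≈-trans : {G H K : Str c} → G ≈ H → H ≈ K → G ≈ K
    ≈-trans p q E a = q E a ⇔-∘ p E a

    ≅⇒≈ : {G H : Str c} → G ≅ H → G ≈ H
    ≅⇒≈ i E a = ≅-⊨ (plug-cong i) φ

    ⊔-congʳ : {K K′ : Str c} (L : Str c) → K ≈ K′ → (K ⊔ˢ L) ≈ (K′ ⊔ˢ L)
    ⊔-congʳ {K} {K′} L p E a =
      ⇔-sym (≅-⊨ (plug-⊔ K′ L) φ) ⇔-∘ (p (plug E a L) (inj₁ ∘ a) ⇔-∘ ≅-⊨ (plug-⊔ K L) φ)

    ⊔-congˡ : (K : Str c) {L L′ : Str c} → L ≈ L′ → (K ⊔ˢ L) ≈ (K ⊔ˢ L′)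
    ⊔-congˡ K {L} {L′} p =
      ≈-trans (≅⇒≈ (⊔-comm K L)) (≈-trans (⊔-congʳ K p) (≅⇒≈ (⊔-comm L′ K)))

    addRoot-cong : ∀ b {A B : Str (suc c)} → A ≈ B → addRoot b A ≈ addRoot b B
    addRoot-cong b {A} {B} p E a =
      ⇔-sym (≅-⊨ (plug-addRoot b B) φ) ⇔-∘ (p _ _ ⇔-∘ ≅-⊨ (plug-addRoot b A) φ)

  ≈⇒⇔ : {G H : Str 0} → G ≈ H → G ⊨ φ ⇔ H ⊨ φ
  ≈⇒⇔ {G} {H} p =
    ⇔-sym (≅-⊨ (plug-empty H) φ) ⇔-∘ (p emptyˢ (λ ()) ⇔-∘ ≅-⊨ (plug-empty G) φ)

-- Enumeration of tuples and iterated pigeonholing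

allVecs : ∀ {A : Set} → List A → ∀ r → List (Vec A r)
allVecs xs zero    = [] ∷ []
allVecs xs (suc r) = cartesianProductWith _∷_ xs (allVecs xs r)

∈-allVecs : ∀ {A : Set} {xs : List A} {r} {v : Vec A r} → VecAll.All (_∈ xs) v → v ∈ allVecs xs r
∈-allVecs VecAll.[]       = here refl
∈-allVecs (p VecAll.∷ ps) = ∈-cartesianProductWith⁺ _∷_ p (∈-allVecs ps)

length-cartesianProductWith : ∀ {A B C : Set} (f : A → B → C) xs ys →
                              length (cartesianProductWith f xs ys) ≡ length xs * length ys
length-cartesianProductWith f []       ys = refl
length-cartesianProductWith f (x ∷ xs) ys = trans (List.length-++ (List.map (f x) ys))
  (cong₂ _+_ (List.length-map (f x) ys) (length-cartesianProductWith f xs ys))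

length-allVecs : ∀ {A : Set} (xs : List A) r → length (allVecs xs r) ≡ length xs ^ r
length-allVecs xs zero    = refl
length-allVecs xs (suc r) = trans (length-cartesianProductWith _∷_ xs (allVecs xs r))
  (cong (length xs *_) (length-allVecs xs r))

length-filter+ : ∀ {A : Set} {P : A → Set} (P? : Decidable P) xs →
                 length xs ≡ length (filter P? xs) + length (filter (¬? ∘ P?) xs)
length-filter+ P? [] = refl
length-filter+ P? (x ∷ xs) with P? x
... | yes _ = cong suc (length-filter+ P? xs)
... | no  _ = trans (cong suc (length-filter+ P? xs)) (sym (ℕ.+-suc _ _))

halves : ∀ {n m} x → 2 * x ≤ n + m → x ≤ n ⊎ x ≤ m
halves {n} {m} x le with x ℕ.≤? n
... | yes x≤n = inj₁ x≤n
... | no  x≰n =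
  inj₂ (ℕ.+-cancelˡ-≤ x _ _ (ℕ.≤-trans (ℕ.≤-reflexive (cong (x +_) (sym (ℕ.+-identityʳ x))))
  (ℕ.≤-trans le (ℕ.+-monoˡ-≤ m (ℕ.<⇒≤ (ℕ.≰⇒> x≰n))))))

Homogeneous : ∀ {A : Set} → List A → (A → Bool) → Set
Homogeneous J f = ∀ {i j} → i ∈ J → j ∈ J → f i ≡ f j

T⇒true : ∀ {b} → T b → b ≡ true
T⇒true {true} _ = refl

¬T⇒false : ∀ {b} → ¬ T b → b ≡ false
¬T⇒false {false} _ = refl
¬T⇒false {true} p = ⊥-elim (p tt)

HomogeneousPart : ∀ {A : Set} → List (A → Bool) → List A → ℕ → Set
HomogeneousPart tests J N =
  ∃ λ J′ → (∀ {i} → i ∈ J′ → i ∈ J) × Unique J′ × N ≤ length J′ × All (Homogeneous J′) tests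

-- A test splits the list into two parts, one of which retains at least half of it. Hence one factor
-- 2 per test.
homogenize : ∀ {A : Set} (tests : List (A → Bool)) {J : List A} {N} → Unique J →
             2 ^ length tests * N ≤ length J → HomogeneousPart tests J N
homogenize [] {J} {N} u le = J , id , u , subst (_≤ length J) (ℕ.+-identityʳ N) le , []
homogenize (f ∷ fs) {J} {N} u le =
  [ half (T? ∘ f) (λ p q → trans (T⇒true p) (sym (T⇒true q)))
  , half (¬? ∘ T? ∘ f) (λ p q → trans (¬T⇒false p) (sym (¬T⇒false q)))
  ] (halves (2 ^ length fs * N) (subst₂ _≤_ (ℕ.*-assoc 2 (2 ^ length fs) N) (length-filter+ (T? ∘ f) J) le))
  where
  half : ∀ {P : _ → Set} (P? : Decidable P) → (∀ {i j} → P i → P j → f i ≡ f j) →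
         2 ^ length fs * N ≤ length (filter P? J) → HomogeneousPart (f ∷ fs) J N
  half P? hom le′ with homogenize fs (Unique.filter⁺ P? u) le′
  ... | J′ , sub , u′ , le″ , homs = J′ , (λ p → proj₁ (∈-filter⁻ P? {xs = J} (sub p))) , u′ , le″ ,
    (λ {i} {j} p q → hom (proj₂ (∈-filter⁻ P? {xs = J} (sub p))) (proj₂ (∈-filter⁻ P? {xs = J} (sub q)))) ∷ homs

-- Deletion and transposition of indices of copies

module _ {t : ℕ} where

  abstract

    remove : Fin t → List (Fin t) → List (Fin t)
    remove i = filter (λ j → ¬? (j Fin.≟ i))

    length-remove : ∀ i {J} → Unique J → length J ≤ suc (length (remove i J))
    length-remove i {[]} u = z≤n
    length-remove i {j ∷ J} (j∉J ∷ u) with j Fin.≟ i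
    ... | no _ = s≤s (length-remove i u)
    ... | yes refl = s≤s (ℕ.≤-reflexive (sym (cong length
      (List.filter-all (λ k → ¬? (k Fin.≟ i)) (All.map (λ neq eq → neq (sym eq)) j∉J)))))

    remove-sub : ∀ {l J i} → i ∈ remove l J → i ∈ J
    remove-sub {l} {J} = proj₁ ∘ ∈-filter⁻ (λ j → ¬? (j Fin.≟ l)) {xs = J}

    remove-≢ : ∀ {l J i} → i ∈ remove l J → i ≢ l
    remove-≢ {l} {J} = proj₂ ∘ ∈-filter⁻ (λ j → ¬? (j Fin.≟ l)) {xs = J}

    remove-∈ : ∀ {l J i} → i ∈ J → i ≢ l → i ∈ remove l J
    remove-∈ {l} {J} = ∈-filter⁺ (λ j → ¬? (j Fin.≟ l)) {xs = J}

    remove-unique : ∀ {l J} → Unique J → Unique (remove l J)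
    remove-unique = Unique.filter⁺ _

  remove-length : ∀ {l J x} → Unique J → suc x ≤ length J → x ≤ length (remove l J)
  remove-length {l} u le = ℕ.≤-pred (ℕ.≤-trans le (length-remove l u))

  tr : Fin t → Fin t → Fin t → Fin t
  tr i j k with k Fin.≟ i | k Fin.≟ j
  ... | yes _ | _     = j
  ... | no _  | yes _ = i
  ... | no _  | no _  = k

  tr-i : ∀ i j → tr i j i ≡ j
  tr-i i j with i Fin.≟ i | i Fin.≟ j
  ... | yes _ | _ = refl
  ... | no n  | _ = ⊥-elim (n refl)

  tr-j : ∀ i j → tr i j j ≡ i
  tr-j i j with j Fin.≟ i | j Fin.≟ j
  ... | yes j≡i | _ = j≡i
  ... | no _  | yes _ = refl
  ... | no _  | no n = ⊥-elim (n refl)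

  tr-other : ∀ {i j k} → k ≢ i → k ≢ j → tr i j k ≡ k
  tr-other {i} {j} {k} ni nj with k Fin.≟ i | k Fin.≟ j
  ... | yes p | _     = ⊥-elim (ni p)
  ... | no _  | yes p = ⊥-elim (nj p)
  ... | no _  | no _  = refl

  tr-involutive : ∀ i j k → tr i j (tr i j k) ≡ k
  tr-involutive i j k with k Fin.≟ i | k Fin.≟ j
  ... | yes refl | _ = tr-j i j
  ... | no _  | yes refl = tr-i i j
  ... | no p  | no q = tr-other p q

  tr-injective : ∀ i j {k l} → tr i j k ≡ tr i j l → k ≡ l
  tr-injective i j {k} {l} eq =
    trans (sym (tr-involutive i j k)) (trans (cong (tr i j) eq) (tr-involutive i j l))

-- The number of copies of a graph that φ cannot count, where a copy and
-- the vertices joined to it have at most m elements.  A quantified vertex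
-- spoils at most one copy, and a guarded relation of arity r has at most
-- 2 ^ (m ^ r) different traces on the copies.

need : ∀ {Γ k} → ℕ → SOFormula Γ k → ℕ
need m (edge x y) = 1
need m (x ≐ y)    = 1
need m (rel X xs) = 1
need m (¬′ φ)     = need m φ
need m (φ ∧′ ψ)   = need m φ + need m ψ
need m (φ ∨′ ψ)   = need m φ + need m ψ
need m (∀′ φ)     = suc (need m φ)
need m (∃′ φ)     = suc (need m φ)
need m (∀² r ∙ φ) = suc (2 ^ (m ^ r) * need m φ)
need m (∃² r ∙ φ) = suc (2 ^ (m ^ r) * need m φ)

need-positive : ∀ {Γ k} m (φ : SOFormula Γ k) → 1 ≤ need m φ
need-positive m (edge x y) = s≤s z≤n
need-positive m (x ≐ y)    = s≤s z≤n
need-positive m (rel X xs) = s≤s z≤n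
need-positive m (¬′ φ)     = need-positive m φ
need-positive m (φ ∧′ ψ)   = ℕ.≤-trans (need-positive m φ) (ℕ.m≤m+n _ _)
need-positive m (φ ∨′ ψ)   = ℕ.≤-trans (need-positive m φ) (ℕ.m≤m+n _ _)
need-positive m (∀′ φ)     = s≤s z≤n
need-positive m (∃′ φ)     = s≤s z≤n
need-positive m (∀² r ∙ φ) = s≤s z≤n
need-positive m (∃² r ∙ φ) = s≤s z≤n

nonempty : ∀ {A : Set} {xs : List A} → 1 ≤ length xs → ∃ (_∈ xs)
nonempty {xs = x ∷ _} _ = x , here refl

-- Redundancy of one among many copies

module Prune {c} (H : Str c) (vertices : List (Str.V H)) (complete : ∀ v → v ∈ vertices)
             (E : Str 0) (a : Fin c → Str.V E) (t : ℕ) where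

  private
    module H = Str H
    module E = Str E

  M : Str 0
  M = plug E a (copies t H)

  open Str M using (V; D; D?; adj)

  -- Deleting copy `i` shrinks only the domain, so the same relations and assignments can be
  -- evaluated before and after the deletion.
  But : Fin t → V → Set
  But i = [ E.D , (λ (j , s) → j ≢ i × H.D s) ]

  But? : ∀ i v → Dec (But i v)
  But? i = sum-dec E.D? (λ (j , s) → ¬? (j Fin.≟ i) ×-dec H.D? s)

  without : Fin t → Str 0
  without i = record M { D = But i ; D? = But? i }

  But⇒D : ∀ i v → But i v → D v
  But⇒D _ (inj₁ _) d       = d
  But⇒D _ (inj₂ _) (_ , d) = d

  Owned : Fin t → V → Set
  Owned i = [ (λ _ → ⊥) , (λ (j , _) → j ≡ i) ]

  Owned? : ∀ i v → Dec (Owned i v)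
  Owned? i = sum-dec (λ _ → no λ ()) (λ (j , _) → j Fin.≟ i)

  ¬Owned⇒But : ∀ i v → D v → ¬ Owned i v → But i v
  ¬Owned⇒But i (inj₁ _) d _ = d
  ¬Owned⇒But i (inj₂ _) d n = n , d

  But⇒¬Owned : ∀ i v → But i v → ¬ Owned i v
  But⇒¬Owned _ (inj₂ _) (n , _) = n

  swapV : Fin t → Fin t → V → V
  swapV i j (inj₁ e)       = inj₁ e
  swapV i j (inj₂ (k , s)) = inj₂ (tr i j k , s)

  swapV-involutive : ∀ i j v → swapV i j (swapV i j v) ≡ v
  swapV-involutive i j (inj₁ e)       = refl
  swapV-involutive i j (inj₂ (k , s)) = cong (λ l → inj₂ (l , s)) (tr-involutive i j k)

  swapV-injective : ∀ i j {u v} → swapV i j u ≡ swapV i j v → u ≡ v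
  swapV-injective i j {u} {v} eq =
    trans (sym (swapV-involutive i j u)) (trans (cong (swapV i j) eq) (swapV-involutive i j v))

  swapV-other : ∀ {i j} v → ¬ Owned i v → ¬ Owned j v → swapV i j v ≡ v
  swapV-other (inj₁ _) _ _        = refl
  swapV-other (inj₂ (k , s)) p q = cong (λ l → inj₂ (l , s)) (tr-other p q)

  swapV-adj : ∀ i j u v → adj u v ⇔ adj (swapV i j u) (swapV i j v)
  swapV-adj i j (inj₁ _) (inj₁ _) = ⇔-id _
  swapV-adj i j (inj₁ _) (inj₂ _) = ⇔-id _
  swapV-adj i j (inj₂ _) (inj₁ _) = ⇔-id _
  swapV-adj i j (inj₂ _) (inj₂ _) = mk⇔ (map₁ (cong (tr i j))) (map₁ (tr-injective i j))

  swap-iso : ∀ i j → without j ≅ without i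
  swap-iso i j = record
    { f = swapV i j
    ; f-D = λ {v} → fD v
    ; f-inj = λ _ _ → swapV-injective i j
    ; f-sur = λ w d → swapV i j w , gD w d , swapV-involutive i j w
    ; f-adj = λ {u} {v} _ _ → swapV-adj i j u v
    ; f-col = λ { {()} }
    }
    where
    fD : ∀ v → But j v → But i (swapV i j v)
    fD (inj₁ _) d = d
    fD (inj₂ _) (n , d) = (λ eq → n (tr-injective i j (trans eq (sym (tr-j i j))))) , d
    gD : ∀ v → But i v → But j (swapV i j v)
    gD (inj₁ _) d = d
    gD (inj₂ _) (n , d) = (λ eq → n (tr-injective i j (trans eq (sym (tr-i i j))))) , d

  open Semantics {V}

  Inv : ∀ {r} → List (Fin t) → (Vec V r → Bool) → Set
  Inv J R = ∀ {i j} → i ∈ J → j ∈ J → ∀ t → R t ≡ R (Vec.map (swapV i j) t)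

  InvAll : ∀ {Γ} → List (Fin t) → Rels V Γ → Set
  InvAll J σ = ∀ {r} (X : r ∈ _) → Inv J (All.lookup σ X)

  Fresh : List (Fin t) → V → Set
  Fresh J v = ∀ {j} → j ∈ J → ¬ Owned j v

  Placed : List (Fin t) → V → Set
  Placed J v = D v × Fresh J v

  map-fix : ∀ {f : V → V} {k} {ρ : Vec V k} → VecAll.All (λ v → f v ≡ v) ρ → Vec.map f ρ ≡ ρ
  map-fix VecAll.[]       = refl
  map-fix (p VecAll.∷ ps) = cong₂ _∷_ p (map-fix ps)

  swap-map-fix : ∀ {J i j k} {ρ : Vec V k} → i ∈ J → j ∈ J → VecAll.All (Placed J) ρ →
    Vec.map (swapV i j) ρ ≡ ρ
  swap-map-fix i∈ j∈ = map-fix ∘ VecAll.map λ (_ , fr) → swapV-other _ (fr i∈) (fr j∈)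

  Cell : Set
  Cell = E.V ⊎ H.V

  emb : Fin t → Cell → V
  emb k (inj₁ e) = inj₁ e
  emb k (inj₂ s) = inj₂ (k , s)

  -- A guarded tuple that meets a copy consists of vertices of this copy and of the `c` roots,
  -- however large the context is. This makes `size`, and with it the threshold, independent of `E`.
  cells : List Cell
  cells = List.map inj₁ (List.map a (allFin c)) ++ List.map inj₂ vertices

  size : ℕ
  size = c + length vertices

  length-cells : length cells ≡ size
  length-cells = trans (List.length-++ (List.map inj₁ (List.map a (allFin c))))
    (cong₂ _+_ (trans (List.length-map inj₁ (List.map a (allFin c))) (trans (List.length-map a (allFin c)) (List.length-tabulate id)))
               (List.length-map inj₂ vertices))

  root-cell : ∀ j → inj₁ (a j) ∈ cells
  root-cell j = ∈-++⁺ˡ (∈-map⁺ inj₁ (∈-map⁺ a (∈-allFin j)))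

  vertex-cell : ∀ s → inj₂ s ∈ cells
  vertex-cell s = ∈-++⁺ʳ _ (∈-map⁺ inj₂ (complete s))

  -- One test per tuple of cells, read as a function of the copy. Copies on which all tests agree
  -- carry the same part of `R`. The `size ^ r` tests are the origin of `2 ^ (m ^ r)` in `need`.
  traces : ∀ {r} → (Vec V r → Bool) → List (Fin t → Bool)
  traces {r} R = List.map (λ x k → R (Vec.map (emb k) x)) (allVecs cells r)

  length-traces : ∀ {r} (R : Vec V r → Bool) → length (traces R) ≡ size ^ r
  length-traces {r} R = trans (List.length-map _ (allVecs cells r))
    (trans (length-allVecs cells r) (cong (_^ r) length-cells))

  swap-emb-i : ∀ i j x → swapV i j (emb i x) ≡ emb j x
  swap-emb-i i j (inj₁ _) = refl
  swap-emb-i i j (inj₂ s) = cong (λ l → inj₂ (l , s)) (tr-i i j)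

  swap-emb-j : ∀ i j x → swapV i j (emb j x) ≡ emb i x
  swap-emb-j i j (inj₁ _) = refl
  swap-emb-j i j (inj₂ s) = cong (λ l → inj₂ (l , s)) (tr-j i j)

  Touches : ∀ {r} → Fin t → Vec V r → Set
  Touches i = VecAny.Any (Owned i)

  touches? : ∀ {r} i (v : Vec V r) → Dec (Touches i v)
  touches? i = VecAny.any? (Owned? i)

  cell : ∀ {i u} → Owned i u → ∀ v → (u ≢ v → adj u v) → ∃ λ x → x ∈ cells × emb i x ≡ v
  cell {u = inj₂ _} refl (inj₁ e) h with h (λ ())
  ... | j , refl , _ = inj₁ (a j) , root-cell j , refl
  cell {i} {u = inj₂ _} refl (inj₂ (k , s)) h with k Fin.≟ i
  ... | yes refl = inj₂ s , vertex-cell s , refl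
  ... | no  k≢i  = ⊥-elim (k≢i (sym (proj₁ (h λ where refl → k≢i refl))))

  -- By guardedness a tuple that touches a copy lies within it and the roots.
  decode : ∀ {r} {R : Vec V r → Bool} → Guard D adj R → ∀ {i v} → T (R v) → Touches i v →
           ∃ λ x → VecAll.All (_∈ cells) x × Vec.map (emb i) x ≡ v
  decode {R = R} gd {i} {v} p touch = go v id
    where
    owner : ∀ {r} {v : Vec V r} → Touches i v → ∃ λ u → u Vec.∈ v × Owned i u
    owner (VecAny.here o)  = _ , VecAny.here refl , o
    owner (VecAny.there q) = let u , u∈ , o = owner q in u , VecAny.there u∈ , o
    u,u∈,o = owner touch
    go : ∀ {s} (w : Vec V s) → (∀ {x} → x Vec.∈ w → x Vec.∈ v) →
         ∃ λ x → VecAll.All (_∈ cells) x × Vec.map (emb i) x ≡ w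
    go []      _   = [] , VecAll.[] , refl
    go (y ∷ w) sub with cell (proj₂ (proj₂ u,u∈,o)) y (gd v p (proj₁ (proj₂ u,u∈,o)) (sub (VecAny.here refl)))
                      | go w (sub ∘ VecAny.there)
    ... | x , x∈ , refl | xs , xs∈ , refl = x ∷ xs , x∈ VecAll.∷ xs∈ , refl

  SameTrace : ∀ {r} → (Vec V r → Bool) → Fin t → Fin t → Set
  SameTrace R i j = ∀ {x} → VecAll.All (_∈ cells) x → R (Vec.map (emb i) x) ≡ R (Vec.map (emb j) x)

  map-swap-emb : ∀ {f : V → V} {i j} → (∀ x → f (emb i x) ≡ emb j x) → ∀ {r} (x : Vec Cell r) →
                 Vec.map f (Vec.map (emb i) x) ≡ Vec.map (emb j) x
  map-swap-emb eq x = trans (sym (Vec.map-∘ _ _ x)) (Vec.map-cong eq x)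

  untouched : ∀ {i r} (v : Vec V r) → ¬ Touches i v → VecAll.All (λ x → ¬ Owned i x) v
  untouched []      _ = VecAll.[]
  untouched (x ∷ v) n = n ∘ VecAny.here VecAll.∷ untouched v (n ∘ VecAny.there)

  T-≡ : ∀ {x y} → (T x → T y) → (T y → T x) → x ≡ y
  T-≡ {true}  {true}  _ _ = refl
  T-≡ {false} {false} _ _ = refl
  T-≡ {true}  {false} p _ = ⊥-elim (p tt)
  T-≡ {false} {true}  _ q = ⊥-elim (q tt)

  -- The swap moves only tuples that touch copy `i` or `j`. If such a tuple is in `R`, it is an
  -- embedded tuple of cells by `decode`, and the swap exchanges the two embeddings. The converse
  -- implication follows because the swap is an involution.
  sameTrace⇒inv : ∀ {r} {R : Vec V r → Bool} → Guard D adj R → ∀ {i j} → SameTrace R i j →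
                  ∀ v → R v ≡ R (Vec.map (swapV i j) v)
  sameTrace⇒inv {R = R} gd {i} {j} same v = T-≡ (fwd v) λ p →
    subst (T ∘ R) (trans (sym (Vec.map-∘ _ _ v)) (trans (Vec.map-cong (swapV-involutive i j) v) (Vec.map-id v))) (fwd _ p)
    where
    fwd : ∀ v → T (R v) → T (R (Vec.map (swapV i j) v))
    fwd v p with touches? i v | touches? j v
    ... | yes ti | _ = let x , x∈ , eq = decode {R = R} gd p ti in
      subst (T ∘ R) (trans (sym (map-swap-emb (swap-emb-i i j) x)) (cong (Vec.map (swapV i j)) eq))
        (subst T (trans (cong R (sym eq)) (same x∈)) p)
    ... | no _ | yes tj = let x , x∈ , eq = decode {R = R} gd p tj in
      subst (T ∘ R) (trans (sym (map-swap-emb (swap-emb-j i j) x)) (cong (Vec.map (swapV i j)) eq))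
        (subst T (trans (cong R (sym eq)) (sym (same x∈))) p)
    ... | no ni | no nj = subst (T ∘ R) (sym (map-fix
      (VecAll.map (λ {x} (p , q) → swapV-other x p q) (VecAll.zip (untouched v ni , untouched v nj))))) p

  -- Extends R from the complement of copy i by the trace of copy j.
  duplicate : ∀ {r} → Fin t → Fin t → (Vec V r → Bool) → Vec V r → Bool
  duplicate i j R v with touches? i v | touches? j v
  ... | yes _ | yes _ = false
  ... | yes _ | no _  = R (Vec.map (swapV i j) v)
  ... | no _  | _     = R v

  duplicate-guard : ∀ {r} i j {R : Vec V r → Bool} → Guard D adj R → Guard D adj (duplicate i j R)
  duplicate-guard i j gd v p {x} {y} x∈ y∈ x≢y with touches? i v | touches? j v
  ... | yes _ | no _  =
    from (swapV-adj i j x y) (gd _ p (Vec.∈-map⁺ _ x∈) (Vec.∈-map⁺ _ y∈) (x≢y ∘ swapV-injective i j))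
  ... | no _  | yes _ = gd v p x∈ y∈ x≢y
  ... | no _  | no _  = gd v p x∈ y∈ x≢y

  duplicate-old : ∀ {r i j} (R : Vec V r → Bool) {v} → ¬ Touches i v → duplicate i j R v ≡ R v
  duplicate-old {i = i} {j} R {v} n with touches? i v | touches? j v
  ... | yes p | _ = ⊥-elim (n p)
  ... | no _  | _ = refl

  emb-touches : ∀ {i k r} (x : Vec Cell r) → Touches i (Vec.map (emb k) x) → k ≡ i
  emb-touches (inj₂ s ∷ x) (VecAny.here eq) = eq
  emb-touches (_ ∷ x) (VecAny.there p) = emb-touches x p

  emb-untouched : ∀ {i j r} (x : Vec Cell r) → ¬ Touches i (Vec.map (emb i) x) →
    Vec.map (emb i) x ≡ Vec.map (emb j) x
  emb-untouched []           n = refl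
  emb-untouched (inj₁ e ∷ x) n = cong (inj₁ e ∷_) (emb-untouched x (n ∘ VecAny.there))
  emb-untouched (inj₂ s ∷ x) n = ⊥-elim (n (VecAny.here refl))

  duplicate-new : ∀ {r i j} → i ≢ j → (R : Vec V r → Bool) (x : Vec Cell r) →
                  duplicate i j R (Vec.map (emb i) x) ≡ R (Vec.map (emb j) x)
  duplicate-new {i = i} {j} i≢j R x with touches? i (Vec.map (emb i) x) | touches? j (Vec.map (emb i) x)
  ... | yes _ | yes p = ⊥-elim (i≢j (emb-touches x p))
  ... | yes _ | no _  = cong R (map-swap-emb (swap-emb-i i j) x)
  ... | no n  | _     = cong R (emb-untouched x n)

  placed-sub : ∀ {J J′ k} {ρ : Vec V k} → (∀ {i} → i ∈ J′ → i ∈ J) → VecAll.All (Placed J) ρ →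
    VecAll.All (Placed J′) ρ
  placed-sub sub = VecAll.map λ (d , fr) → d , fr ∘ sub

  -- `J` lists copies that are still interchangeable: they contain no element of `ρ`, and no
  -- relation in `σ` tells them apart. Quantifiers shrink `J`, and `need` says how long it must be
  -- for the rest of the formula.
  Claim : ∀ {Γ k} → SOFormula Γ k → Set
  Claim φ = ∀ {σ} (ρ : Vec V _) J → Unique J → need size φ ≤ length J → InvAll J σ →
            VecAll.All (Placed J) ρ → ∀ {i} → i ∈ J → Sat D adj σ ρ φ ⇔ Sat (But i) adj σ ρ φ

  -- Used when copy `i` cannot be deleted directly: an interchangeable copy `j` is deleted instead,
  -- and the swap carries the result over to the deletion of `i`.
  swap-sat : ∀ {Γ k J σ} {ρ : Vec V k} {τ : Rels V Γ} {i j} →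
             (∀ {r} (X : r ∈ _) v → All.lookup σ X v ≡ All.lookup τ X (Vec.map (swapV i j) v)) →
             i ∈ J → j ∈ J → ∀ {ρ₁ : Vec V k} → VecAll.All (But j) ρ₁ → ρ ≡ Vec.map (swapV i j) ρ₁ →
             ∀ φ → Sat (But j) adj σ ρ₁ φ ⇔ Sat (But i) adj τ ρ φ
  swap-sat {i = i} {j} inv i∈ j∈ ds refl φ = ≅-sat (swap-iso i j) (λ X {v} _ → inv X v) _ ds φ

  placed-But : ∀ {J j k} {ρ : Vec V k} → j ∈ J → VecAll.All (Placed J) ρ → VecAll.All (But j) ρ
  placed-But j∈ = VecAll.map λ {v} (d , fr) → ¬Owned⇒But _ v d (fr j∈)

  -- A vertex blocks at most the copy in which it lies. If this is copy `i` itself, the induction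
  -- hypothesis deletes another copy `j` from `J`, and the swap provides the answer: the twin of the
  -- vertex in copy `j`.
  module Element {Γ k} (ψ : SOFormula Γ (suc k)) (IH : Claim ψ) {σ : Rels V Γ} (ρ : Vec V k) J (u : Unique J)
                 (le : suc (need size ψ) ≤ length J) (inv : InvAll J σ)
                 (pl : VecAll.All (Placed J) ρ) {i} (i∈ : i ∈ J) where

    private
      same : ∀ {x} → D x → ∀ l → (∀ {j} → j ∈ remove l J → ¬ Owned j x) → i ≢ l →
             Sat D adj σ (x ∷ ρ) ψ ⇔ Sat (But i) adj σ (x ∷ ρ) ψ
      same {x} d l fr i≢l = IH {σ} (x ∷ ρ) (remove l J) (remove-unique u) (remove-length u le)
        (λ X p q → inv X (remove-sub p) (remove-sub q)) ((d , fr) VecAll.∷ placed-sub remove-sub pl) (remove-∈ i∈ i≢l)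

    from-but : ∀ x → But i x → Sat D adj σ (x ∷ ρ) ψ ⇔ Sat (But i) adj σ (x ∷ ρ) ψ
    from-but (inj₁ e) d = IH {σ} _ J u (ℕ.<⇒≤ le) inv ((d , λ _ ()) VecAll.∷ pl) i∈
    from-but (inj₂ (l , s)) (n , d) = same d l (λ p eq → remove-≢ p (sym eq)) (n ∘ sym)

    to-but : ∀ x → D x → ∃ λ y → But i y × (Sat D adj σ (x ∷ ρ) ψ ⇔ Sat (But i) adj σ (y ∷ ρ) ψ)
    to-but x d with Owned? i x
    ... | no n = x , ¬Owned⇒But i x d n , from-but x (¬Owned⇒But i x d n)
    to-but (inj₂ (_ , s)) d | yes refl =
      inj₂ (j , s) , (remove-≢ j∈′ , d) ,
      (swap-sat {J = J} (λ X → inv X i∈ j∈) i∈ j∈ {inj₂ (i , s) ∷ ρ}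
         (((λ eq → remove-≢ j∈′ (sym eq)) , d) VecAll.∷ placed-But j∈ pl)
         (cong₂ _∷_ (sym (swap-emb-i i j (inj₂ s))) (sym (swap-map-fix i∈ j∈ pl))) ψ
       ⇔-∘ IH {σ} (inj₂ (i , s) ∷ ρ) (remove i J) (remove-unique u) (remove-length u le)
         (λ X p q → inv X (remove-sub p) (remove-sub q))
         ((d , λ p eq → remove-≢ p (sym eq)) VecAll.∷ placed-sub remove-sub pl) j∈′)
      where
      j,j∈ = nonempty (ℕ.≤-trans (need-positive size ψ) (remove-length {l = i} u le))
      j = proj₁ j,j∈
      j∈′ : j ∈ remove i J
      j∈′ = proj₂ j,j∈
      j∈ : j ∈ J
      j∈ = remove-sub j∈′

  module Relation {Γ k} r (ψ : SOFormula (r ∷ Γ) k) (IH : Claim ψ) {σ : Rels V Γ} (ρ : Vec V k) J (u : Unique J)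
                  (le : suc (2 ^ (size ^ r) * need size ψ) ≤ length J) (inv : InvAll J σ)
                  (pl : VecAll.All (Placed J) ρ) {i} (i∈ : i ∈ J) where

    private
      part : (R : Vec V r → Bool) → ∀ {K} → Unique K → 2 ^ (size ^ r) * need size ψ ≤ length K →
             HomogeneousPart (traces R) K (need size ψ)
      part R {K} uK leK = homogenize (traces R) uK
        (subst (λ n → 2 ^ n * need size ψ ≤ length K) (sym (length-traces R)) leK)

      sameTrace : ∀ {R : Vec V r → Bool} {K} → All (Homogeneous K) (traces R) →
                  ∀ {j l} → j ∈ K → l ∈ K → SameTrace R j l
      sameTrace homs j∈ l∈ x∈ = All.lookup homs (∈-map⁺ _ (∈-allVecs x∈)) j∈ l∈

      invAll : ∀ {K} {R : Vec V r → Bool} → (∀ {i} → i ∈ K → i ∈ J) → Inv K R → InvAll K (R ∷ σ)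
      invAll sub invR (here refl) = invR
      invAll sub invR (there X)   = λ p q → inv X (sub p) (sub q)

      swap-swap : ∀ i j (v : Vec V r) → Vec.map (swapV i j) (Vec.map (swapV i j) v) ≡ v
      swap-swap i j v =
        trans (sym (Vec.map-∘ _ _ v)) (trans (Vec.map-cong (swapV-involutive i j) v) (Vec.map-id v))

    -- Copy `i` may get lost in the pigeonholing, so a survivor `j` is deleted. The swap back to `i`
    -- changes `R` alone, because the relations in `σ` are invariant under it.
    to-but : ∀ R → Guard D adj R → ∃ λ S → Guard (But i) adj S ×
             (Sat D adj (R ∷ σ) ρ ψ ⇔ Sat (But i) adj (S ∷ σ) ρ ψ)
    to-but R gd = S , gdS ,
      (swap-sat {J = J} corr i∈ (sub j∈) {ρ} (placed-But (sub j∈) pl) (sym (swap-map-fix i∈ (sub j∈) pl)) ψ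
       ⇔-∘ IH {R ∷ σ} ρ J′ u′ le′ (invAll sub invR) (placed-sub sub pl) j∈)
      where
      prt = part R u (ℕ.<⇒≤ le)
      J′ = proj₁ prt
      sub : ∀ {i} → i ∈ J′ → i ∈ J
      sub = proj₁ (proj₂ prt)
      u′ = proj₁ (proj₂ (proj₂ prt))
      le′ = proj₁ (proj₂ (proj₂ (proj₂ prt)))
      homs = proj₂ (proj₂ (proj₂ (proj₂ prt)))
      invR : Inv J′ R
      invR p q = sameTrace⇒inv gd (sameTrace {R} homs p q)
      j,j∈ = nonempty (ℕ.≤-trans (need-positive size ψ) le′)
      j = proj₁ j,j∈
      j∈ : j ∈ J′
      j∈ = proj₂ j,j∈
      S : Vec V r → Bool
      S v = R (Vec.map (swapV i j) v)
      gdS : Guard (But i) adj S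
      gdS v p {x} {y} x∈ y∈ x≢y = from (swapV-adj i j x y)
        (gd _ p (Vec.∈-map⁺ _ x∈) (Vec.∈-map⁺ _ y∈) (x≢y ∘ swapV-injective i j))
      corr : ∀ {s} (X : s ∈ r ∷ Γ) v →
        All.lookup (R ∷ σ) X v ≡ All.lookup (S ∷ σ) X (Vec.map (swapV i j) v)
      corr (here refl) v = cong R (sym (swap-swap i j v))
      corr (there X)   v = inv X i∈ (sub j∈) v

    -- On the absent copy `i` the relation can be chosen freely; it receives the trace of a typical
    -- copy `j`, so that `i` joins the homogeneous part. To this end `i` is set aside before the
    -- pigeonholing, which accounts for the `suc` in `need`.
    from-but : ∀ S → Guard (But i) adj S → ∃ λ R → Guard D adj R ×
               (Sat D adj (R ∷ σ) ρ ψ ⇔ Sat (But i) adj (S ∷ σ) ρ ψ)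
    from-but S gd = R , gdR ,
      (subst (λ ρ′ → Sat (But i) adj (R ∷ σ) ρ ψ ⇔ Sat (But i) adj (S ∷ σ) ρ′ ψ) (Vec.map-id ρ)
         (≅-sat (≅-refl {M = without i}) corr ρ (placed-But i∈ pl) ψ)
       ⇔-∘ IH {R ∷ σ} ρ (i ∷ J′) (All.tabulate (λ p eq → remove-≢ (sub p) (sym eq)) ∷ u′) (ℕ.m≤n⇒m≤1+n le′)
         (invAll sub⁺ invR) (placed-sub sub⁺ pl) (here refl))
      where
      prt = part S (remove-unique {l = i} u) (remove-length u le)
      J′ = proj₁ prt
      sub : ∀ {l} → l ∈ J′ → l ∈ remove i J
      sub = proj₁ (proj₂ prt)
      u′ = proj₁ (proj₂ (proj₂ prt))
      le′ = proj₁ (proj₂ (proj₂ (proj₂ prt)))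
      homs = proj₂ (proj₂ (proj₂ (proj₂ prt)))
      sub⁺ : ∀ {l} → l ∈ i ∷ J′ → l ∈ J
      sub⁺ (here refl) = i∈
      sub⁺ (there p)   = remove-sub (sub p)
      j,j∈ = nonempty (ℕ.≤-trans (need-positive size ψ) le′)
      j = proj₁ j,j∈
      j∈ : j ∈ J′
      j∈ = proj₂ j,j∈
      i≢j : i ≢ j
      i≢j eq = remove-≢ (sub j∈) (sym eq)
      R : Vec V r → Bool
      R = duplicate i j S
      gdR : Guard D adj R
      gdR = duplicate-guard i j {S} gd
      trace : ∀ {l} → l ∈ i ∷ J′ → ∀ {x} → VecAll.All (_∈ cells) x →
        R (Vec.map (emb l) x) ≡ S (Vec.map (emb j) x)
      trace (here refl) {x} _ = duplicate-new i≢j S x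
      trace (there l∈) {x} x∈ =
        trans (duplicate-old S (remove-≢ (sub l∈) ∘ emb-touches x)) (sameTrace {S} homs l∈ j∈ x∈)
      invR : Inv (i ∷ J′) R
      invR p q = sameTrace⇒inv gdR (λ x∈ → trans (trace p x∈) (sym (trace q x∈)))
      avoid : ∀ {s} {v : Vec V s} → VecAll.All (But i) v → ¬ Touches i v
      avoid {v = v ∷ _} (d VecAll.∷ _) (VecAny.here o) = But⇒¬Owned i v d o
      avoid (_ VecAll.∷ ds) (VecAny.there p) = avoid ds p
      corr : Corresponding (≅-refl {M = without i}) (R ∷ σ) (S ∷ σ)
      corr (here refl) {v} ds = trans (duplicate-old S (avoid ds)) (cong S (sym (Vec.map-id v)))
      corr (there X)   {v} ds = cong (All.lookup σ X) (sym (Vec.map-id v))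

  claim : ∀ {Γ k} (φ : SOFormula Γ k) → Claim φ
  claim (edge x y) _ _ _ _ _ _ _ = ⇔-id _
  claim (x ≐ y) _ _ _ _ _ _ _ = ⇔-id _
  claim (rel X xs) _ _ _ _ _ _ _ = ⇔-id _
  claim (¬′ φ)     {σ} ρ J u le inv pl i∈ = ¬-⇔ (claim φ {σ} ρ J u le inv pl i∈)
  claim (φ ∧′ ψ)   {σ} ρ J u le inv pl i∈ =
    claim φ {σ} ρ J u (ℕ.m+n≤o⇒m≤o _ le) inv pl i∈ ×-⇔ claim ψ {σ} ρ J u (ℕ.m+n≤o⇒n≤o (need size φ) le) inv pl i∈
  claim (φ ∨′ ψ)   {σ} ρ J u le inv pl i∈ =
    claim φ {σ} ρ J u (ℕ.m+n≤o⇒m≤o _ le) inv pl i∈ ⊎-⇔ claim ψ {σ} ρ J u (ℕ.m+n≤o⇒n≤o (need size φ) le) inv pl i∈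
  claim (∀′ φ) {σ} ρ J u le inv pl i∈ = mk⇔
    (λ h x d → to (from-but x d) (h x (But⇒D _ x d)))
    (λ h x d → let y , dy , e = to-but x d in from e (h y dy))
    where open Element φ (claim φ) {σ} ρ J u le inv pl i∈
  claim (∃′ φ) {σ} ρ J u le inv pl i∈ = mk⇔
    (λ (x , d , s) → let y , dy , e = to-but x d in y , dy , to e s)
    (λ (x , d , s) → x , But⇒D _ x d , from (from-but x d) s)
    where open Element φ (claim φ) {σ} ρ J u le inv pl i∈
  claim (∀² r ∙ φ) {σ} ρ J u le inv pl i∈ = mk⇔
    (λ h S gd → let R , gdR , e = from-but S gd in to e (h R gdR))
    (λ h R gd → let S , gdS , e = to-but R gd in from e (h S gdS))
    where open Relation r φ (claim φ) {σ} ρ J u le inv pl i∈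
  claim (∃² r ∙ φ) {σ} ρ J u le inv pl i∈ = mk⇔
    (λ (R , gd , s) → let S , gdS , e = to-but R gd in S , gdS , to e s)
    (λ (S , gd , s) → let R , gdR , e = from-but S gd in R , gdR , from e s)
    where open Relation r φ (claim φ) {σ} ρ J u le inv pl i∈

plug-without : ∀ {c} (H : Str c) vertices complete E a t →
               plug E a (copies t H) ≅ Prune.without H vertices complete E a (suc t) zero
plug-without H vertices complete E a t = record
  { f = λ where (inj₁ e) → inj₁ e ; (inj₂ (i , s)) → inj₂ (suc i , s)
  ; f-D = λ { {inj₁ _} d → d ; {inj₂ _} d → (λ ()) , d }
  ; f-inj = λ { {inj₁ _} {inj₁ _} _ _ refl → refl ; {inj₂ _} {inj₂ _} _ _ refl → refl }
  ; f-sur = λ where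
      (inj₁ e) d → inj₁ e , d , refl
      (inj₂ (zero , _)) (n , _) → ⊥-elim (n refl)
      (inj₂ (suc i , s)) (_ , d) → inj₂ (i , s) , d , refl
  ; f-adj = λ
      { {inj₁ _} {inj₁ _} _ _ → ⇔-id _
      ; {inj₁ _} {inj₂ _} _ _ → ⇔-id _
      ; {inj₂ _} {inj₁ _} _ _ → ⇔-id _
      ; {inj₂ _} {inj₂ _} _ _ → mk⇔ (map₁ (cong suc)) (map₁ Fin.suc-injective) }
  ; f-col = λ { {()} }
  }

copies-≈ : ∀ (φ : SOFormula [] 0) {c} (H : Str c) vertices → (∀ v → v ∈ vertices) →
           ∀ t → need (c + length vertices) φ ≤ suc t → Context._≈_ φ (copies (suc t) H) (copies t H)
copies-≈ φ H vertices complete t le E a =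
  ⇔-sym (≅-⊨ (plug-without H vertices complete E a t) φ) ⇔-∘
  claim φ {[]} [] (allFin (suc t)) (Unique.allFin⁺ (suc t))
    (subst (need size φ ≤_) (sym (List.length-tabulate id)) le) (λ ()) VecAll.[] (∈-allFin zero)
  where open Prune H vertices complete E a (suc t)

∃-⇔ : ∀ {A : Set} {P Q : A → Set} → (∀ a → P a ⇔ Q a) → ∃ P ⇔ ∃ Q
∃-⇔ e = mk⇔ (λ (a , p) → a , to (e a) p) (λ (a , q) → a , from (e a) q)

∀-⇔ : ∀ {A : Set} {P Q : A → Set} → (∀ a → P a ⇔ Q a) → (∀ a → P a) ⇔ (∀ a → Q a)
∀-⇔ e = mk⇔ (λ h a → to (e a) (h a)) (λ h a → from (e a) (h a))

≡⇒⇔ : ∀ {A B : Set} → A ≡ B → A ⇔ B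
≡⇒⇔ refl = ⇔-id _

-- Renaming and decidability of first-order formulas

lift : ∀ {k l} → (Fin k → Fin l) → Fin (suc k) → Fin (suc l)
lift f zero    = zero
lift f (suc x) = suc (f x)

ren : ∀ {k l} → (Fin k → Fin l) → FOFormula k → FOFormula l
ren f (edge x y) = edge (f x) (f y)
ren f (x ≐ y)    = f x ≐ f y
ren f (¬′ φ)     = ¬′ ren f φ
ren f (φ ∧′ ψ)   = ren f φ ∧′ ren f ψ
ren f (φ ∨′ ψ)   = ren f φ ∨′ ren f ψ
ren f (∀′ φ)     = ∀′ ren (lift f) φ
ren f (∃′ φ)     = ∃′ ren (lift f) φ

module _ {n} (G : Graph n) where

  ren-sat : ∀ {k l} {f : Fin k → Fin l} {ρ : Vec (Fin n) k} {ρ′ : Vec (Fin n) l} →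
            (∀ x → lookup ρ′ (f x) ≡ lookup ρ x) → ∀ φ → FOSat G ρ′ (ren f φ) ⇔ FOSat G ρ φ
  ren-sat eq (edge x y) = ≡⇒⇔ (cong₂ (E G) (eq x) (eq y))
  ren-sat eq (x ≐ y)    = ≡⇒⇔ (cong₂ _≡_ (eq x) (eq y))
  ren-sat eq (¬′ φ)     = ¬-⇔ (ren-sat eq φ)
  ren-sat eq (φ ∧′ ψ)   = ren-sat eq φ ×-⇔ ren-sat eq ψ
  ren-sat eq (φ ∨′ ψ)   = ren-sat eq φ ⊎-⇔ ren-sat eq ψ
  ren-sat eq (∀′ φ)     = ∀-⇔ λ a → ren-sat (λ { zero → refl ; (suc x) → eq x }) φ
  ren-sat eq (∃′ φ)     = ∃-⇔ λ a → ren-sat (λ { zero → refl ; (suc x) → eq x }) φ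

  FOSat? : ∀ {k} (ρ : Vec (Fin n) k) φ → Dec (FOSat G ρ φ)
  FOSat? ρ (edge x y) = E? G _ _
  FOSat? ρ (x ≐ y)    = lookup ρ x Fin.≟ lookup ρ y
  FOSat? ρ (¬′ φ)     = ¬? (FOSat? ρ φ)
  FOSat? ρ (φ ∧′ ψ)   = FOSat? ρ φ ×-dec FOSat? ρ ψ
  FOSat? ρ (φ ∨′ ψ)   = FOSat? ρ φ ⊎-dec FOSat? ρ ψ
  FOSat? ρ (∀′ φ)     = Fin.all? λ a → FOSat? (a ∷ ρ) φ
  FOSat? ρ (∃′ φ)     = Fin.any? λ a → FOSat? (a ∷ ρ) φ

-- The existential form is false in the graph without vertices, too.
⊥′ : ∀ {k} → FOFormula k
⊥′ = ∃′ ¬′ (zero ≐ zero)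

infixr 5 _⇒′_

_⇒′_ : ∀ {k} → FOFormula k → FOFormula k → FOFormula k
φ ⇒′ ψ = ¬′ φ ∨′ ψ

⋁ : ∀ {A : Set} {k} → List A → (A → FOFormula k) → FOFormula k
⋁ []       f = ⊥′
⋁ (x ∷ xs) f = f x ∨′ ⋁ xs f

⋀ : ∀ {c k} → (Fin c → FOFormula k) → FOFormula k
⋀ {zero}  f = ¬′ ⊥′
⋀ {suc c} f = f zero ∧′ ⋀ (f ∘ suc)

module _ {n} {G : Graph n} {k} {ρ : Vec (Fin n) k} where

  ⇒-elim : ∀ φ ψ → FOSat G ρ (φ ⇒′ ψ) → FOSat G ρ φ → FOSat G ρ ψ
  ⇒-elim φ ψ (inj₁ n) p = ⊥-elim (n p)
  ⇒-elim φ ψ (inj₂ q) p = q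

  ⇒-intro : ∀ φ ψ → (FOSat G ρ φ → FOSat G ρ ψ) → FOSat G ρ (φ ⇒′ ψ)
  ⇒-intro φ ψ h with FOSat? G ρ φ
  ... | yes p = inj₂ (h p)
  ... | no ¬p = inj₁ ¬p

  ⋁-elim : ∀ {A : Set} (xs : List A) (f : A → FOFormula k) → FOSat G ρ (⋁ xs f) →
    ∃ λ x → x ∈ xs × FOSat G ρ (f x)
  ⋁-elim []       f (_ , n) = ⊥-elim (n refl)
  ⋁-elim (x ∷ xs) f (inj₁ p) = x , here refl , p
  ⋁-elim (x ∷ xs) f (inj₂ p) = let y , y∈ , q = ⋁-elim xs f p in y , there y∈ , q

  ⋁-intro : ∀ {A : Set} {xs : List A} (f : A → FOFormula k) {x} → x ∈ xs → FOSat G ρ (f x) →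
    FOSat G ρ (⋁ xs f)
  ⋁-intro f (here refl) p = inj₁ p
  ⋁-intro f (there x∈)  p = inj₂ (⋁-intro f x∈ p)

  ⋀-elim : ∀ {c} (f : Fin c → FOFormula k) → FOSat G ρ (⋀ f) → ∀ j → FOSat G ρ (f j)
  ⋀-elim f (p , _) zero    = p
  ⋀-elim f (_ , q) (suc j) = ⋀-elim (f ∘ suc) q j

  ⋀-intro : ∀ {c} (f : Fin c → FOFormula k) → (∀ j → FOSat G ρ (f j)) → FOSat G ρ (⋀ f)
  ⋀-intro {zero}  f h = λ (_ , n) → n refl
  ⋀-intro {suc c} f h = h zero , ⋀-intro (f ∘ suc) (h ∘ suc)

-- Coloured induced subgraphs

sub : ∀ {n c} (G : Graph n) {D : Fin n → Set} → (∀ v → Dec (D v)) → (Fin c → Fin n → Set) → Str c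
sub {n} G {D} D? col = record { V = Fin n ; D = D ; D? = D? ; adj = E G ; col = col }

Closed : ∀ {n} → Graph n → (D S : Fin n → Set) → Set
Closed G D S = ∀ {u w} → S u → D w → E G u w → S w

module _ {n c : ℕ} (G : Graph n) where

  sub-cong : ∀ {D D′ : Fin n → Set} {D? : ∀ v → Dec (D v)} {D′? : ∀ v → Dec (D′ v)} {col col′ : Fin c → Fin n → Set} →
             (∀ v → D v ⇔ D′ v) → (∀ j v → col j v ⇔ col′ j v) → sub G D? col ≅ sub G D′? col′
  sub-cong d e = record
    { f = id ; f-D = to (d _) ; f-inj = λ _ _ → id ; f-sur = λ w dw → w , from (d w) dw , refl
    ; f-adj = λ _ _ → ⇔-id _ ; f-col = λ _ → e _ _ }

  module _ {D K : Fin n → Set} (D? : ∀ v → Dec (D v)) (K? : ∀ v → Dec (K v)) where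

    _∖_ : ∀ v → Dec (D v × ¬ K v)
    _∖_ v = D? v ×-dec ¬? (K? v)

    sub-split : (col : Fin c → Fin n → Set) → (∀ {v} → K v → D v) → Closed G D K →
                sub G D? col ≅ sub G K? col ⊔ˢ sub G _∖_ col
    sub-split col K⊆D closed = record
      { f = λ v → place (K? v)
      ; f-D = λ {v} d → place-D d (K? v)
      ; f-inj = λ {u} {v} _ _ → inj (K? u) (K? v)
      ; f-sur = sur
      ; f-adj = λ {u} {v} du dv → place-adj du dv (K? u) (K? v)
      ; f-col = λ {j} {v} _ → place-col (K? v)
      }
      where
      place : ∀ {v} → Dec (K v) → Fin n ⊎ Fin n
      place {v} (yes _) = inj₁ v
      place {v} (no _)  = inj₂ v
      place-D : ∀ {v} → D v → (k? : Dec (K v)) → [ K , (λ v → D v × ¬ K v) ] (place k?)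
      place-D d (yes k) = k
      place-D d (no ¬k) = d , ¬k
      inj : ∀ {u v} (a : Dec (K u)) (b : Dec (K v)) → place a ≡ place b → u ≡ v
      inj (yes _) (yes _) refl = refl
      inj (no _)  (no _)  refl = refl
      sur : ∀ w → Str.D (sub G K? col ⊔ˢ sub G _∖_ col) w → ∃ λ v → D v × place (K? v) ≡ w
      sur (inj₁ v) k = v , K⊆D k , eq
        where
        eq : place (K? v) ≡ inj₁ v
        eq with K? v
        ... | yes _ = refl
        ... | no ¬k = ⊥-elim (¬k k)
      sur (inj₂ v) (d , ¬k) = v , d , eq
        where
        eq : place (K? v) ≡ inj₂ v
        eq with K? v
        ... | yes k = ⊥-elim (¬k k)
        ... | no _  = refl
      place-adj : ∀ {u v} → D u → D v → (a : Dec (K u)) (b : Dec (K v)) →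
                  E G u v ⇔ Str.adj (sub G K? col ⊔ˢ sub G _∖_ col) (place a) (place b)
      place-adj du dv (yes _) (yes _) = ⇔-id _
      place-adj du dv (yes k) (no ¬k) = mk⇔ (λ e → ¬k (closed k dv e)) (λ ())
      place-adj du dv (no ¬k) (yes k) = mk⇔ (λ e → ¬k (closed k du (E-sym G e))) (λ ())
      place-adj du dv (no _)  (no _)  = ⇔-id _
      place-col : ∀ {j v} (k? : Dec (K v)) →
        col j v ⇔ Str.col (sub G K? col ⊔ˢ sub G _∖_ col) j (place k?)
      place-col (yes _) = ⇔-id _
      place-col (no _)  = ⇔-id _

  minus : ∀ {D : Fin n → Set} → (∀ v → Dec (D v)) → ∀ x v → Dec (D v × v ≢ x)
  minus D? x v = D? v ×-dec ¬? (v Fin.≟ x)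

  sub-addRoot : ∀ {D : Fin n → Set} (D? : ∀ v → Dec (D v)) (col : Fin c → Fin n → Set) {x} b → D x →
                (∀ j → col j x ⇔ T (lookup b j)) →
                sub G D? col ≅ addRoot b (sub G (minus D? x) (cons (E G x) col))
  sub-addRoot {D} D? col {x} b dx bits = record
    { f = λ v → place (v Fin.≟ x)
    ; f-D = λ {v} d → place-D d (v Fin.≟ x)
    ; f-inj = λ {u} {v} _ _ → inj (u Fin.≟ x) (v Fin.≟ x)
    ; f-sur = sur
    ; f-adj = λ {u} {v} _ _ → place-adj (u Fin.≟ x) (v Fin.≟ x)
    ; f-col = λ {j} {v} _ → place-col (v Fin.≟ x)
    }
    where
    A = addRoot b (sub G (minus D? x) (cons (E G x) col))
    place : ∀ {v} → Dec (v ≡ x) → ⊤ ⊎ Fin n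
    place (yes _)    = inj₁ tt
    place {v} (no _) = inj₂ v
    place-D : ∀ {v} → D v → (q : Dec (v ≡ x)) → Str.D A (place q)
    place-D d (yes _) = tt
    place-D d (no n)  = d , n
    inj : ∀ {u v} (a : Dec (u ≡ x)) (b : Dec (v ≡ x)) → place a ≡ place b → u ≡ v
    inj (yes refl) (yes refl) _ = refl
    inj (no _) (no _) refl = refl
    sur : ∀ w → Str.D A w → ∃ λ v → D v × place (v Fin.≟ x) ≡ w
    sur (inj₁ tt) _ = x , dx , eq
      where
      eq : place (x Fin.≟ x) ≡ inj₁ tt
      eq with x Fin.≟ x
      ... | yes _ = refl
      ... | no n  = ⊥-elim (n refl)
    sur (inj₂ v) (d , n) = v , d , eq
      where
      eq : place (v Fin.≟ x) ≡ inj₂ v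
      eq with v Fin.≟ x
      ... | yes p = ⊥-elim (n p)
      ... | no _  = refl
    place-adj : ∀ {u v} (p : Dec (u ≡ x)) (q : Dec (v ≡ x)) → E G u v ⇔ Str.adj A (place p) (place q)
    place-adj (yes p) (yes q) = mk⇔ (E-irrefl G (trans p (sym q))) (λ ())
    place-adj (yes refl) (no _) = ⇔-id _
    place-adj (no _) (yes refl) = mk⇔ (E-sym G) (E-sym G)
    place-adj (no _) (no _)     = ⇔-id _
    place-col : ∀ {j v} (q : Dec (v ≡ x)) → col j v ⇔ Str.col A j (place q)
    place-col (yes refl) = bits _
    place-col (no _)     = ⇔-id _

-- In closed form 2^(d+1) - 2. At depth `suc d` a vertex is joined to the root by at most `diam d`
-- steps and one more edge, and the same holds on the way from the root to another vertex.
diam : ℕ → ℕ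
diam zero    = 0
diam (suc d) = diam d + suc (suc (diam d))

-- Elimination of depth d within a set D of vertices

module _ {n} (G : Graph n) where

  Step : (Fin n → Set) → Fin n → Fin n → Set
  Step D u v = E G u v × D v

  Reach : (Fin n → Set) → Fin n → Fin n → Set
  Reach D = Star (Step D)

  -- Tree depth as an upper bound, without distinguishing connected from disconnected graphs: each
  -- component of `D`, given by any of its vertices `v`, gets a root. Subsets of a fixed vertex type
  -- replace induced subgraphs and avoid renumbering.
  TD : ℕ → (Fin n → Set) → Set
  TD zero    D = ∀ v → ¬ D v
  TD (suc d) D = ∀ v → D v → ∃ λ x → Reach D v x × TD d (λ u → Reach D v u × u ≢ x)

  Reach-mono : ∀ {D D′ : Fin n → Set} → (∀ {v} → D v → D′ v) → ∀ {u v} → Reach D u v → Reach D′ u v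
  Reach-mono h = Star.map λ (e , d) → e , h d

  Reach-D : ∀ {D : Fin n → Set} {u v} → D u → Reach D u v → D v
  Reach-D d ε             = d
  Reach-D _ ((_ , d) ◅ p) = Reach-D d p

  TD-cong : ∀ d {D D′ : Fin n → Set} → (∀ v → D v ⇔ D′ v) → TD d D → TD d D′
  TD-cong zero    e td v d = td v (from (e v) d)
  TD-cong (suc d) e td v dv with td v (from (e v) dv)
  ... | x , r , td′ = x , Reach-mono (to (e _)) r ,
    TD-cong d (λ u → mk⇔ (map₁ (Reach-mono (to (e _)))) (map₁ (Reach-mono (from (e _))))) td′

  Reach-closed : ∀ {D S : Fin n → Set} → Closed G D S → ∀ {u v} → S u → Reach D u v → Reach S u v
  Reach-closed cl s ε             = ε
  Reach-closed cl s ((e , d) ◅ p) = (e , cl s d e) ◅ Reach-closed cl (cl s d e) p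

  TD-closed : ∀ d {D S : Fin n → Set} → (∀ {v} → S v → D v) → Closed G D S → TD d D → TD d S
  TD-closed zero    S⊆D cl td v s = td v (S⊆D s)
  TD-closed (suc d) S⊆D cl td v s with td v (S⊆D s)
  ... | x , r , td′ = x , Reach-closed cl s r ,
    TD-cong d (λ u → mk⇔ (map₁ (Reach-closed cl s)) (map₁ (Reach-mono S⊆D))) td′

  Ball : (Fin n → Set) → ℕ → Fin n → Fin n → Set
  Ball D zero    v u = u ≡ v
  Ball D (suc j) v u = Ball D j v u ⊎ ∃ λ w → Ball D j v w × E G w u × D u

  Ball⇒Reach : ∀ {D : Fin n → Set} j {v u} → Ball D j v u → Reach D v u
  Ball⇒Reach zero    refl = ε
  Ball⇒Reach (suc j) (inj₁ b) = Ball⇒Reach j b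
  Ball⇒Reach (suc j) (inj₂ (w , b , e , d)) = Ball⇒Reach j b ◅◅ (e , d) ◅ ε

  Ball-mono : ∀ {D D′ : Fin n → Set} → (∀ {v} → D v → D′ v) → ∀ j {v u} → Ball D j v u → Ball D′ j v u
  Ball-mono h zero    b = b
  Ball-mono h (suc j) (inj₁ b) = inj₁ (Ball-mono h j b)
  Ball-mono h (suc j) (inj₂ (w , b , e , d)) = inj₂ (w , Ball-mono h j b , e , h d)

  Ball-trans : ∀ {D : Fin n → Set} i j {v w u} → Ball D i v w → Ball D j w u → Ball D (j + i) v u
  Ball-trans i zero    b refl = b
  Ball-trans i (suc j) b (inj₁ c) = inj₁ (Ball-trans i j b c)
  Ball-trans i (suc j) b (inj₂ (y , c , e , d)) = inj₂ (y , Ball-trans i j b c , e , d)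

  Ball-center : ∀ {D : Fin n → Set} j {v} → Ball D j v v
  Ball-center zero    = refl
  Ball-center (suc j) = inj₁ (Ball-center j)

  Ball-weaken : ∀ {D : Fin n → Set} i j {v u} → Ball D i v u → Ball D (i + j) v u
  Ball-weaken i j {v} b = Ball-trans j i (Ball-center j) b

  -- Makes reachability first-order, with a radius that depends on the depth only. The parts of the
  -- walk before its first and after its last visit of the root `x` stay in `D′`, where the
  -- induction hypothesis applies.
  TD⇒Ball : ∀ d {D : Fin n → Set} → TD d D → ∀ {v u} → D v → Reach D v u → Ball D (diam d) v u
  TD⇒Ball zero    td dv _ = ⊥-elim (td _ dv)
  TD⇒Ball (suc d) {D} td {v} {u} dv walk with td v dv
  ... | x , v⇝x , td′ = join (tail v ε walk) (head v ε v⇝x)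
    where
    D′ : Fin n → Set
    D′ u = Reach D v u × u ≢ x

    D′⊆D : ∀ {w} → D′ w → D w
    D′⊆D (r , _) = Reach-D dv r

    -- Either the walk avoids x, or it is cut at its last visit of x.
    tail : ∀ y → Reach D v y → Reach D y u →
           (y ≢ x × Reach D′ y u) ⊎ (u ≡ x ⊎ ∃ λ w → E G x w × D′ w × Reach D′ w u)
    tail y r ε with y Fin.≟ x
    ... | yes eq = inj₂ (inj₁ eq)
    ... | no neq = inj₁ (neq , ε)
    tail y r (_◅_ {j = z} (e , dz) p) with tail z (r ◅◅ (e , dz) ◅ ε) p
    ... | inj₂ t = inj₂ t
    ... | inj₁ (z≢x , q) with y Fin.≟ x
    ...   | yes refl = inj₂ (inj₂ (z , e , (r ◅◅ (e , dz) ◅ ε , z≢x) , q))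
    ...   | no y≢x   = inj₁ (y≢x , (e , r ◅◅ (e , dz) ◅ ε , z≢x) ◅ q)

    head : ∀ y → Reach D v y → Reach D y x →
           y ≡ x ⊎ (y ≢ x × ∃ λ w → Reach D′ y w × E G w x × D x)
    head y r ε = inj₁ refl
    head y r (_◅_ {j = z} (e , dz) p) with y Fin.≟ x
    ... | yes eq = inj₁ eq
    ... | no y≢x with head z (r ◅◅ (e , dz) ◅ ε) p
    ...   | inj₁ refl = inj₂ (y≢x , y , ε , e , dz)
    ...   | inj₂ (z≢x , w , q , e′ , dx) = inj₂ (y≢x , w , (e , r ◅◅ (e , dz) ◅ ε , z≢x) ◅ q , e′ , dx)

    ball′ : ∀ {y z} → D′ y → Reach D′ y z → Ball D (diam d) y z
    ball′ dy q = Ball-mono D′⊆D (diam d) (TD⇒Ball d td′ dy q)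

    v⇝ᴮx : v ≡ x ⊎ (v ≢ x × ∃ λ w → Reach D′ v w × E G w x × D x) → Ball D (suc (diam d)) v x
    v⇝ᴮx (inj₁ refl) = Ball-center (suc (diam d))
    v⇝ᴮx (inj₂ (v≢x , w , q , e , dx)) = inj₂ (w , ball′ (ε , v≢x) q , e , dx)

    join : (v ≢ x × Reach D′ v u) ⊎ (u ≡ x ⊎ ∃ λ w → E G x w × D′ w × Reach D′ w u) →
           v ≡ x ⊎ (v ≢ x × ∃ λ w → Reach D′ v w × E G w x × D x) → Ball D (diam (suc d)) v u
    join (inj₁ (v≢x , q)) _ = Ball-weaken (diam d) _ (ball′ (ε , v≢x) q)
    join (inj₂ (inj₁ refl)) h =
      Ball-trans (suc (suc (diam d))) (diam d) (inj₁ (v⇝ᴮx h)) (Ball-center (diam d))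
    join (inj₂ (inj₂ (w , e , dw , q))) h =
      Ball-trans (suc (suc (diam d))) (diam d) (inj₂ (x , v⇝ᴮx h , e , D′⊆D dw)) (ball′ dw q)

-- Finite structures

record Finite {c} (M : Str c) : Set where
  open Str M
  field
    vertices : List V
    complete : ∀ v → v ∈ vertices
    _≟_      : DecidableEquality V
    adj?     : ∀ u v → Dec (adj u v)
    col?     : ∀ j v → Dec (col j v)

finite-empty : ∀ {c} → Finite (emptyˢ {c})
finite-empty = record { vertices = [] ; complete = λ () ; _≟_ = λ () ; adj? = λ () ; col? = λ _ () }

finite-⊔ : ∀ {c} {K L : Str c} → Finite K → Finite L → Finite (K ⊔ˢ L)
finite-⊔ {K = K} {L} fK fL = record
  { vertices = List.map inj₁ K.vertices ++ List.map inj₂ L.vertices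
  ; complete = λ where
      (inj₁ u) → ∈-++⁺ˡ (∈-map⁺ inj₁ (K.complete u))
      (inj₂ v) → ∈-++⁺ʳ _ (∈-map⁺ inj₂ (L.complete v))
  ; _≟_ = Sum.≡-dec K._≟_ L._≟_
  ; adj? = λ where
      (inj₁ u) (inj₁ v) → K.adj? u v
      (inj₁ _) (inj₂ _) → no λ ()
      (inj₂ _) (inj₁ _) → no λ ()
      (inj₂ u) (inj₂ v) → L.adj? u v
  ; col? = λ j → sum-dec (K.col? j) (L.col? j)
  }
  where
  module K = Finite fK
  module L = Finite fL

finite-addRoot : ∀ {c} (b : Vec Bool c) {A : Str (suc c)} → Finite A → Finite (addRoot b A)
finite-addRoot b fA = record
  { vertices = inj₁ tt ∷ List.map inj₂ A.vertices
  ; complete = λ where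
      (inj₁ tt) → here refl
      (inj₂ v) → there (∈-map⁺ inj₂ (A.complete v))
  ; _≟_ = Sum.≡-dec Unit._≟_ A._≟_
  ; adj? = λ where
      (inj₁ _) (inj₁ _) → no λ ()
      (inj₁ _) (inj₂ v) → A.col? zero v
      (inj₂ u) (inj₁ _) → A.col? zero u
      (inj₂ u) (inj₂ v) → A.adj? u v
  ; col? = λ j → sum-dec (λ _ → T? _) (A.col? (suc j))
  }
  where
  module A = Finite fA

-- Multisets of connected types

module _ {I : Set} (_≟_ : DecidableEquality I) where

  count : I → List I → ℕ
  count i []       = 0
  count i (j ∷ js) with j ≟ i
  ... | yes _ = suc (count i js)
  ... | no _  = count i js

  count-self : ∀ i js → count i (i ∷ js) ≡ suc (count i js)
  count-self i js with i ≟ i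
  ... | yes _ = refl
  ... | no n  = ⊥-elim (n refl)

  count-other : ∀ {i j} js → j ≢ i → count i (j ∷ js) ≡ count i js
  count-other {i} {j} js n with j ≟ i
  ... | yes p = ⊥-elim (n p)
  ... | no _  = refl

  count-++ : ∀ i js ks → count i (js ++ ks) ≡ count i js + count i ks
  count-++ i []       ks = refl
  count-++ i (j ∷ js) ks with j ≟ i
  ... | yes _ = cong suc (count-++ i js ks)
  ... | no _  = count-++ i js ks

  count-∈ : ∀ {i} js → 1 ≤ count i js → i ∈ js
  count-∈ {i} (j ∷ js) le with j ≟ i
  ... | yes refl = here refl
  ... | no _     = there (count-∈ js le)

  count-─ : ∀ {j} js (p : j ∈ js) i → count i js ≡ count i (j ∷ (js ─ p))
  count-─ (j ∷ js) (here refl) i = refl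
  count-─ {k} (j ∷ js) (there p) i with j ≟ i | count-─ js p i
  ... | yes q | eq with k ≟ i
  ...   | yes _ = cong suc (trans eq (sym (lem q)))
    where
    lem : j ≡ i → count i (j ∷ (js ─ p)) ≡ suc (count i (js ─ p))
    lem refl = count-self i _
  ...   | no _  = trans (cong suc eq) (sym (lem q))
    where
    lem : j ≡ i → count i (j ∷ (js ─ p)) ≡ suc (count i (js ─ p))
    lem refl = count-self i _
  count-─ {k} (j ∷ js) (there p) i | no q | eq with k ≟ i
  ...   | yes _ = trans eq (cong suc (sym (count-other _ q)))
  ...   | no _  = trans eq (sym (count-other _ q))

  count-replicate : ∀ i n → n ≤ count i (replicate n i)
  count-replicate i zero    = z≤n
  count-replicate i (suc n) rewrite count-self i (replicate n i) = s≤s (count-replicate i n)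

  count-concatMap : ∀ (f : I → ℕ) {i} {js} → i ∈ js →
    f i ≤ count i (concatMap (λ j → replicate (f j) j) js)
  count-concatMap f {i} {j ∷ js} (here refl) =
    ℕ.≤-trans (count-replicate i (f i)) (ℕ.≤-trans (ℕ.m≤m+n _ _)
      (ℕ.≤-reflexive (sym (count-++ i (replicate (f i) i) (concatMap (λ j → replicate (f j) j) js)))))
  count-concatMap f {i} {j ∷ js} (there i∈) =
    ℕ.≤-trans (count-concatMap f i∈) (ℕ.≤-trans (ℕ.m≤n+m _ _)
      (ℕ.≤-reflexive (sym (count-++ i (replicate (f j) j) (concatMap (λ j → replicate (f j) j) js)))))

listsUpTo : ∀ {I : Set} → ℕ → List I → List (List I)
listsUpTo zero    is = [] ∷ []
listsUpTo (suc n) is = [] ∷ cartesianProductWith _∷_ is (listsUpTo n is)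

[]∈listsUpTo : ∀ {I : Set} n {is : List I} → [] ∈ listsUpTo n is
[]∈listsUpTo zero    = here refl
[]∈listsUpTo (suc n) = here refl

∷∈listsUpTo : ∀ {I : Set} n {is : List I} {i js} → i ∈ is → js ∈ listsUpTo n is →
  (i ∷ js) ∈ listsUpTo (suc n) is
∷∈listsUpTo n i∈ js∈ = there (∈-cartesianProductWith⁺ _∷_ i∈ js∈)

module Types (φ : SOFormula [] 0) {c} {I : Set} (_≟_ : DecidableEquality I) (H : I → Str c)
             (fin : ∀ i → Finite (H i)) where
  open Context φ

  U : List I → Str c
  U []       = emptyˢ
  U (i ∷ is) = H i ⊔ˢ U is

  finite-U : ∀ is → Finite (U is)
  finite-U []       = finite-empty
  finite-U (i ∷ is) = finite-⊔ (fin i) (finite-U is)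

  threshold : I → ℕ
  threshold i = need (c + length (Finite.vertices (fin i))) φ

  rotate : (K L M : Str c) → K ⊔ˢ (L ⊔ˢ M) ≈ L ⊔ˢ (K ⊔ˢ M)
  rotate K L M = ≈-trans (≈-sym (≅⇒≈ (⊔-assoc K L M)))
    (≈-trans (⊔-congʳ M (≅⇒≈ (⊔-comm K L))) (≅⇒≈ (⊔-assoc L K M)))

  U-copies : ∀ i t is → t ≤ count _≟_ i is → ∃ λ R → U is ≈ copies t (H i) ⊔ˢ R
  U-copies i zero is _ = U is ,
    ≈-trans (≅⇒≈ (⊔-identityʳ (U is) (copies 0 (H i)) (λ where (() , _))))
      (≅⇒≈ (⊔-comm (U is) (copies 0 (H i))))
  U-copies i (suc t) (j ∷ js) le with j ≟ i
  ... | yes refl = let R , eq = U-copies i t js (ℕ.≤-pred le) in R ,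
    ≈-trans (⊔-congˡ (H i) eq) (≈-trans (≈-sym (≅⇒≈ (⊔-assoc (H i) (copies t (H i)) R)))
      (⊔-congʳ R (≈-sym (≅⇒≈ (copies-suc t (H i))))))
  ... | no _ = let R , eq = U-copies i (suc t) js le in (H j ⊔ˢ R) ,
    ≈-trans (⊔-congˡ (H j) eq) (rotate (H j) (copies (suc t) (H i)) R)

  Saturated : List I → I → Set
  Saturated is i = threshold i ≤ count _≟_ i is

  -- The union contains `threshold i` copies of `H i`; once these are collected in one block,
  -- `copies-≈` makes a further copy redundant.
  absorb : ∀ {is i} → Saturated is i → H i ⊔ˢ U is ≈ U is
  absorb {is} {i} sat = let R , eq = U-copies i (threshold i) is sat in
    ≈-trans (⊔-congˡ (H i) eq)
      (≈-trans (≈-sym (≅⇒≈ (⊔-assoc (H i) (copies (threshold i) (H i)) R)))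
        (≈-trans (⊔-congʳ R (≈-sym (≅⇒≈ (copies-suc (threshold i) (H i)))))
          (≈-trans (⊔-congʳ R (copies-≈ φ (H i) _ (Finite.complete (fin i)) (threshold i) (ℕ.n≤1+n _)))
            (≈-sym eq))))

  module _ {n} (G : Graph n) (col : Fin c → Fin n → Set) where

    -- `minimal` stands for connectedness: it keeps the component inside every closed part that
    -- contains its centre, in particular inside what is left after other components have been
    -- removed.
    record IsComponent (D K : Fin n → Set) (v : Fin n) : Set₁ where
      field
        K?      : ∀ u → Dec (K u)
        center  : K v
        closed  : Closed G D K
        minimal : ∀ {S : Fin n → Set} → Closed G D S → S v → ∀ {u} → K u → S u

    -- The components are swallowed one after the other, since each is equivalent to a model that is
    -- already saturated. Their number is unbounded, so the recursion runs over a list of vertices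
    -- that covers what remains.
    absorb-all : ∀ {D : Fin n → Set} (K : Fin n → Fin n → Set) is →
                 (∀ {v} → D v → Σ (IsComponent D (K v) v) λ comp → ∃ λ i → Saturated is i × sub G (IsComponent.K? comp) col ≈ H i) →
                 ∀ (vs : List (Fin n)) {S : Fin n → Set} (S? : ∀ v → Dec (S v)) → (∀ {v} → S v → D v) → Closed G D S →
                 (∀ {v} → S v → v ∈ vs) → U is ⊔ˢ sub G S? col ≈ U is
    absorb-all K is comp [] S? S⊆D cl S⊆vs =
      ≈-sym (≅⇒≈ (⊔-identityʳ (U is) (sub G S? col) λ v s → absurd (S⊆vs s)))
      where
      absurd : ∀ {v : Fin n} → ¬ v ∈ []
      absurd ()
    absorb-all {D} K is comp (x ∷ vs) {S} S? S⊆D cl S⊆vs with S? x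
    ... | no ¬s = absorb-all K is comp vs S? S⊆D cl λ s → case S⊆vs s of λ where
      (here refl) → ⊥-elim (¬s s)
      (there v∈)  → v∈
    ... | yes s with comp (S⊆D s)
    ...   | cx , i , sat , eq =
      ≈-trans (⊔-congˡ (U is) (≈-trans (≅⇒≈ (sub-split G S? K? col K⊆S (λ k sw e → closed k (S⊆D sw) e)))
                                          (⊔-congʳ G′ eq)))
      (≈-trans (rotate (U is) (H i) G′)
      (≈-trans (≈-sym (≅⇒≈ (⊔-assoc (H i) (U is) G′)))
      (≈-trans (⊔-congʳ G′ (absorb {is} sat))
        (absorb-all K is comp vs S′? (S⊆D ∘ proj₁)
          (λ (su , ¬ku) dw e → cl su dw e , λ kw → ¬ku (closed kw (S⊆D su) (E-sym G e)))
          λ (sv , ¬kv) → rest ¬kv (S⊆vs sv)))))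
      where
      open IsComponent cx
      K⊆S : ∀ {u} → K x u → S u
      K⊆S = minimal {S} cl s
      S′? = _∖_ {n} {c} G S? K?
      G′ = sub G S′? col
      rest : ∀ {v} → ¬ K x v → v ∈ x ∷ vs → v ∈ vs
      rest ¬k (here refl) = ⊥-elim (¬k center)
      rest ¬k (there v∈)  = v∈

-- First-order definable covers by finitely many models

struct : ∀ {n} (G : Graph n) {k c} → Vec (Fin n) k → FOFormula (suc k) → (Fin c → FOFormula (suc k)) →
  Str c
struct G ρ δ γ = sub G (λ v → FOSat? G (v ∷ ρ) δ) (λ j v → FOSat G (v ∷ ρ) (γ j))

module _ (φ : SOFormula [] 0) where
  open Context φ

  -- Finitely many models H i, such that every c-coloured graph of
  -- elimination depth d is equivalent to one of them.  That χ δ γ i holds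
  -- means that the graph with domain δ and colours γ is equivalent to H i.

  record Cover (d c : ℕ) : Set₁ where
    field
      I        : Set
      _≟_      : DecidableEquality I
      indices  : List I
      H        : I → Str c
      fin      : ∀ i → Finite (H i)
      χ        : ∀ {k} → FOFormula (suc k) → (Fin c → FOFormula (suc k)) → I → FOFormula k
      sound    : ∀ {n} (G : Graph n) {k} (ρ : Vec (Fin n) k) δ γ i → FOSat G ρ (χ δ γ i) → struct G ρ δ γ ≈ H i
      complete : ∀ {n} (G : Graph n) {k} (ρ : Vec (Fin n) k) δ γ → TD G d (λ v → FOSat G (v ∷ ρ) δ) →
                 ∃ λ i → i ∈ indices × FOSat G ρ (χ δ γ i)

  cover-zero : ∀ c → Cover 0 c
  cover-zero c = record
    { I = ⊤
    ; _≟_ = Unit._≟_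
    ; indices = tt ∷ []
    ; H = λ _ → emptyˢ
    ; fin = λ _ → finite-empty
    ; χ = λ δ _ _ → ∀′ ¬′ δ
    ; sound = λ G ρ δ γ _ ∅ → ≈-sym (≅⇒≈ record
        { f = λ () ; f-D = λ { {()} } ; f-inj = λ { {()} } ; f-sur = λ v d → ⊥-elim (∅ v d)
        ; f-adj = λ { {()} } ; f-col = λ { {_} {()} } })
    ; complete = λ G ρ δ γ ∅ → tt , here refl , ∅
    }

  -- The type of a component consists of the model for what its root leaves behind, in which
  -- adjacency to the root is an extra colour, and of the colours of the root. A graph is then
  -- described by a list of such types.
  module Successor (d c : ℕ) (C : Cover d (suc c)) where
    private
      module C = Cover C

    L : ℕ
    L = diam (suc d)

    CT : Set
    CT = C.I × Vec Bool c

    _≟ᶜ_ : DecidableEquality CT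
    _≟ᶜ_ = Product.≡-dec C._≟_ (Vec.≡-dec Bool._≟_)

    HC : CT → Str c
    HC (i , b) = addRoot b (C.H i)

    finC : ∀ τ → Finite (HC τ)
    finC (i , b) = finite-addRoot b (C.fin i)

    types : List CT
    types = List.cartesianProduct C.indices (allVecs (true ∷ false ∷ []) c)

    open Types φ _≟ᶜ_ HC finC

    type-∈ : ∀ {i} b → i ∈ C.indices → (i , b) ∈ types
    type-∈ b i∈ = ∈-cartesianProduct⁺ i∈ (∈-allVecs (bools b))
      where
      bools : ∀ {m} (b : Vec Bool m) → VecAll.All (_∈ true ∷ false ∷ []) b
      bools []          = VecAll.[]
      bools (true ∷ b)  = here refl VecAll.∷ bools b
      bools (false ∷ b) = there (here refl) VecAll.∷ bools b

    -- In ball j δ, variable 1 is the centre and variable 0 the other vertex.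
    ball : ∀ {k} → ℕ → FOFormula (suc k) → FOFormula (suc (suc k))
    ball zero    δ = zero ≐ suc zero
    ball (suc j) δ = ball j δ ∨′
      (∃′ (ren (lift suc) (ball j δ) ∧′ edge zero (suc zero) ∧′ ren (λ x → suc (lift suc x)) δ))

    _↑ : ∀ {k} → FOFormula (suc k) → FOFormula (suc (suc k))
    _↑ = ren (lift suc)

    -- The field `sound` of a cover assumes no bound on the depth, so the formula itself must verify
    -- that the ball is an entire component.
    closedF : ∀ {k} → FOFormula (suc k) → FOFormula (suc k)
    closedF δ =
      ∀′ ∀′ (ren suc (ball L δ) ⇒′ edge (suc zero) zero ⇒′ ren (lift (λ x → suc (suc x))) δ ⇒′ ball L δ ↑)

    bit : ∀ {k} → Bool → FOFormula k → FOFormula k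
    bit true  φ = φ
    bit false φ = ¬′ φ

    -- Variables 0, 1 and 2 are the vertex in question, the root and the centre of the ball. The
    -- centre is arbitrary in its component and need not be the root.
    rootD : ∀ {k} → FOFormula (suc k) → FOFormula (suc (suc (suc k)))
    rootD δ = ball L δ ↑ ∧′ ¬′ (zero ≐ suc zero)

    rootCol : ∀ {k} → (Fin c → FOFormula (suc k)) → Fin (suc c) → FOFormula (suc (suc (suc k)))
    rootCol γ zero    = edge (suc zero) zero
    rootCol γ (suc j) = (γ j ↑) ↑

    Typed : ∀ {k} → FOFormula (suc k) → (Fin c → FOFormula (suc k)) → CT → FOFormula (suc k)
    Typed δ γ (i , b) = closedF δ ∧′
      (∃′ (ball L δ ∧′ (⋀ λ j → bit (lookup b j) (γ j ↑)) ∧′ C.χ (rootD δ) (rootCol γ) i))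

    Saturated? : ∀ taken τ → Dec (Saturated taken τ)
    Saturated? taken τ = threshold τ ℕ.≤? count _≟ᶜ_ τ taken

    Done : ∀ {k} → List CT → FOFormula (suc k) → (Fin c → FOFormula (suc k)) → FOFormula k
    Done taken δ γ = ∀′ (δ ⇒′ ⋁ (filter (Saturated? taken) types) (Typed δ γ))

    -- Removes components of the listed types one by one; every component
    -- that is left must have a type of which enough copies were taken.
    Peel : ∀ {k} → List CT → List CT → FOFormula (suc k) → (Fin c → FOFormula (suc k)) → FOFormula k
    Peel taken []       δ γ = Done taken δ γ
    Peel taken (τ ∷ τs) δ γ =
      ∃′ (δ ∧′ Typed δ γ τ ∧′ Peel (τ ∷ taken) τs (δ ↑ ∧′ ¬′ ball L δ) (λ j → γ j ↑))

    module _ {n} (G : Graph n) where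

      ↑-sat : ∀ {k} {ρ : Vec (Fin n) k} {u v} φ → FOSat G (u ∷ v ∷ ρ) (φ ↑) ⇔ FOSat G (u ∷ ρ) φ
      ↑-sat = ren-sat G λ where zero → refl ; (suc x) → refl

      module Domain {k} (ρ : Vec (Fin n) k) (δ : FOFormula (suc k)) (γ : Fin c → FOFormula (suc k)) where

        D : Fin n → Set
        D v = FOSat G (v ∷ ρ) δ

        col : Fin c → Fin n → Set
        col j v = FOSat G (v ∷ ρ) (γ j)

        K : Fin n → Fin n → Set
        K = Ball G D L

        ball-sat : ∀ j {u v} → FOSat G (u ∷ v ∷ ρ) (ball j δ) ⇔ Ball G D j v u
        ball-sat zero    = ⇔-id _
        ball-sat (suc j) = ball-sat j ⊎-⇔ ∃-⇔ λ w →
          (ball-sat j ⇔-∘ ↑-sat (ball j δ)) ×-⇔ (⇔-id _ ×-⇔ ren-sat G (λ { zero → refl ; (suc x) → refl }) δ)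

        K? : ∀ v u → Dec (K v u)
        K? v u = Dec.map (ball-sat L) (FOSat? G (u ∷ v ∷ ρ) (ball L δ))

        K⊆D : ∀ {v u} → D v → K v u → D u
        K⊆D dv k = Reach-D G dv (Ball⇒Reach G L k)

        closed-sat : ∀ {v} → FOSat G (v ∷ ρ) (closedF δ) ⇔ Closed G D (K v)
        closed-sat {v} = mk⇔
          (λ h {u} {w} k d e → to (ball-sat L) (to (↑-sat (ball L δ))
            (⇒-elim φ₃ φ₄ (⇒-elim φ₂ (φ₃ ⇒′ φ₄) (⇒-elim φ₁ (φ₂ ⇒′ φ₃ ⇒′ φ₄) (h u w)
              (from (ren-sat G (λ x → refl) (ball L δ)) (from (ball-sat L) k))) e)
              (from (ren-sat G (λ { zero → refl ; (suc x) → refl }) δ) d))))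
          (λ cl u w → ⇒-intro φ₁ (φ₂ ⇒′ φ₃ ⇒′ φ₄) λ k → ⇒-intro φ₂ (φ₃ ⇒′ φ₄) λ e → ⇒-intro φ₃ φ₄ λ d →
            from (↑-sat (ball L δ)) (from (ball-sat L) (cl (to (ball-sat L) (to (ren-sat G (λ x → refl) (ball L δ)) k))
              (to (ren-sat G (λ { zero → refl ; (suc x) → refl }) δ) d) e)))
          where
          φ₁ = ren suc (ball L δ)
          φ₂ = edge (suc zero) zero
          φ₃ = ren (lift (λ x → suc (suc x))) δ
          φ₄ = ball L δ ↑

        ball-component : ∀ {v} → D v → Closed G D (K v) → IsComponent G col D (K v) v
        ball-component {v} dv cl = record
          { K?      = K? v
          ; center  = Ball-center G L
          ; closed  = cl
          ; minimal = λ clS sv k → Reach-D G sv (Reach-closed G clS sv (Ball⇒Reach G L k))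
          }

        bit-sat : ∀ {x v} b j → FOSat G (x ∷ v ∷ ρ) (bit b (γ j ↑)) ⇔ (col j x ⇔ T b)
        bit-sat true j =
          mk⇔ (λ s → mk⇔ _ (λ _ → to (↑-sat (γ j)) s)) (λ e → from (↑-sat (γ j)) (from e tt))
        bit-sat false j =
          mk⇔ (λ ¬s → mk⇔ (λ s → ¬s (from (↑-sat (γ j)) s)) (λ ())) (λ e s → to e (to (↑-sat (γ j)) s))

        rest-sat : ∀ x v u → FOSat G (u ∷ x ∷ v ∷ ρ) (rootD δ) ⇔ (K v u × u ≢ x)
        rest-sat x v u = (ball-sat L ⇔-∘ ↑-sat (ball L δ)) ×-⇔ ⇔-id _

        rootCol-sat : ∀ x v j u → FOSat G (u ∷ x ∷ v ∷ ρ) (rootCol γ j) ⇔ cons (E G x) col j u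
        rootCol-sat x v zero    u = ⇔-id _
        rootCol-sat x v (suc j) u = ↑-sat (γ j) ⇔-∘ ↑-sat (γ j ↑)

        typed-sound : ∀ {v} → D v → ∀ τ → FOSat G (v ∷ ρ) (Typed δ γ τ) →
                      Σ (IsComponent G col D (K v) v) λ comp → sub G (IsComponent.K? comp) col ≈ HC τ
        typed-sound {v} dv (i , b) (cl , x , k , bs , s) =
          ball-component dv (to closed-sat cl) ,
          ≈-trans (≅⇒≈ (sub-addRoot G (K? v) col b (to (ball-sat L) k)
                      (λ j → to (bit-sat (lookup b j) j) (⋀-elim (λ j → bit (lookup b j) (γ j ↑)) bs j))))
            (addRoot-cong b (≈-trans
              (≈-sym (≅⇒≈ (sub-cong G (rest-sat x v) (rootCol-sat x v))))
              (C.sound G (x ∷ v ∷ ρ) (rootD δ) (rootCol γ) i s)))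

        module _ (td : TD G (suc d) D) where

          reach-ball : ∀ {v u} → D v → Reach G D v u → K v u
          reach-ball = TD⇒Ball G (suc d) td

          K-closed : ∀ {v} → D v → Closed G D (K v)
          K-closed dv k dw e = reach-ball dv (Ball⇒Reach G L k ◅◅ (e , dw) ◅ ε)

          typed-complete : ∀ {v} → D v → ∃ λ τ → τ ∈ types × FOSat G (v ∷ ρ) (Typed δ γ τ)
          typed-complete {v} dv with td v dv
          ... | x , r , td′ with C.complete G (x ∷ v ∷ ρ) (rootD δ) (rootCol γ)
            (TD-cong G d (λ u → ⇔-sym (rest-sat x v u) ⇔-∘
              (mk⇔ (reach-ball dv) (Ball⇒Reach G L) ×-⇔ ⇔-id _)) td′)
          ...   | i , i∈ , s = (i , b) , type-∈ b i∈ ,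
            from closed-sat (K-closed dv) , x , from (ball-sat L) (reach-ball dv r) ,
            ⋀-intro _ (λ j → from (bit-sat (lookup b j) j) (bits j)) , s
            where
            b : Vec Bool c
            b = Vec.tabulate λ j → isYes (FOSat? G (x ∷ ρ) (γ j))
            bits : ∀ j → col j x ⇔ T (lookup b j)
            bits j rewrite Vec.lookup∘tabulate (λ j → isYes (FOSat? G (x ∷ ρ) (γ j))) j =
              mk⇔ fromWitness toWitness

      -- The invariant is the union of what has been taken with what is left. Each peeling step
      -- moves one component across, replaced by its model; in the end `absorb-all` removes the
      -- remainder.
      peel-sound : ∀ {k} (ρ : Vec (Fin n) k) taken is δ γ → FOSat G ρ (Peel taken is δ γ) →
                   U taken ⊔ˢ struct G ρ δ γ ≈ U (reverseAcc taken is)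
      peel-sound ρ taken [] δ γ rest =
        absorb-all G col K taken comp (allFin n) (λ v → FOSat? G (v ∷ ρ) δ) id
        (λ _ dw _ → dw) (λ {v} _ → ∈-allFin v)
        where
        open Domain ρ δ γ
        comp : ∀ {v} → D v → Σ (IsComponent G col D (K v) v) λ comp → ∃ λ i →
               Saturated taken i × sub G (IsComponent.K? comp) col ≈ HC i
        comp {v} dv =
          let τ , τ∈ , s = ⋁-elim (filter (Saturated? taken) types) (Typed δ γ)
                             (⇒-elim δ (⋁ (filter (Saturated? taken) types) (Typed δ γ)) (rest v) dv)
              cx , eq = typed-sound dv τ s
          in cx , τ , proj₂ (∈-filter⁻ (Saturated? taken) {xs = types} τ∈) , eq
      peel-sound ρ taken (τ ∷ τs) δ γ (v , dv , typed , s) with Domain.typed-sound ρ δ γ dv τ typed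
      ... | cx , eq =
        ≈-trans (⊔-congˡ (U taken) (≈-trans (≅⇒≈ (sub-split G (λ v → FOSat? G (v ∷ ρ) δ) (IsComponent.K? cx) col
                    (K⊆D dv) (IsComponent.closed cx))) (⊔-congʳ G₁ eq)))
        (≈-trans (rotate (U taken) (HC τ) G₁)
        (≈-trans (≈-sym (≅⇒≈ (⊔-assoc (HC τ) (U taken) G₁)))
        (≈-trans (⊔-congˡ (U (τ ∷ taken)) (≈-sym (≅⇒≈ (sub-cong G
                     (λ u → ↑-sat δ ×-⇔ ¬-⇔ (ball-sat L)) (λ j u → ↑-sat (γ j))))))
          (peel-sound (v ∷ ρ) (τ ∷ taken) τs _ _ s))))
        where
        open Domain ρ δ γ
        G₁ = sub G (_∖_ {n} {c} G (λ v → FOSat? G (v ∷ ρ) δ) (IsComponent.K? cx)) col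

      count-shift : ∀ i τ taken xs →
        count _≟ᶜ_ i taken + count _≟ᶜ_ i (τ ∷ xs) ≡ count _≟ᶜ_ i (τ ∷ taken) + count _≟ᶜ_ i xs
      count-shift i τ taken xs with τ ≟ᶜ i
      ... | yes _ = ℕ.+-suc _ _
      ... | no _  = refl

      -- Taking a component of an unsaturated type uses up an element of caps.
      peel-complete : ∀ {k} (ρ : Vec (Fin n) k) taken δ γ m caps → length caps ≡ m →
                      (∀ {i} → i ∈ types → threshold i ≤ count _≟ᶜ_ i taken + count _≟ᶜ_ i caps) →
                      TD G (suc d) (λ v → FOSat G (v ∷ ρ) δ) →
                      ∃ λ is → is ∈ listsUpTo m types × FOSat G ρ (Peel taken is δ γ)
      peel-complete ρ taken δ γ m caps len enough td
        with Fin.any? (λ v → FOSat? G (v ∷ ρ) δ ×-dec ¬? (FOSat? G (v ∷ ρ) (⋁ (filter (Saturated? taken) types) (Typed δ γ))))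
      ... | no ¬bad =
        [] , []∈listsUpTo m , λ v → ⇒-intro δ (⋁ (filter (Saturated? taken) types) (Typed δ γ)) λ dv →
        decidable-stable (FOSat? G (v ∷ ρ) (⋁ (filter (Saturated? taken) types) (Typed δ γ))) λ ¬s → ¬bad (v , dv , ¬s)
      ... | yes (v , dv , ¬s) with Domain.typed-complete ρ δ γ td dv
      ...   | τ , τ∈ , typed with Saturated? taken τ
      ...     | yes sat = ⊥-elim (¬s (⋁-intro (Typed δ γ) (∈-filter⁺ (Saturated? taken) τ∈ sat) typed))
      ...     | no ¬sat = step m len
        where
        open Domain ρ δ γ
        -- The types taken do not reach the threshold of `τ`, but together with `caps` they do.
        τ∈caps : τ ∈ caps
        τ∈caps = count-∈ _≟ᶜ_ caps (ℕ.+-cancelˡ-≤ (count _≟ᶜ_ τ taken) _ _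
          (ℕ.≤-trans (ℕ.≤-reflexive (ℕ.+-comm _ 1)) (ℕ.≤-trans (ℕ.≰⇒> ¬sat) (enough τ∈))))
        δ′ : FOFormula _
        δ′ = δ ↑ ∧′ ¬′ ball L δ
        td′ : TD G (suc d) (λ u → FOSat G (u ∷ v ∷ ρ) δ′)
        td′ = TD-cong G (suc d) (λ u → ⇔-sym (↑-sat δ) ×-⇔ ¬-⇔ (⇔-sym (ball-sat L)))
          (TD-closed G (suc d) {S = λ u → D u × ¬ K v u} proj₁
            (λ (du , ¬k) dw e → dw , λ kw → ¬k (K-closed td dv kw du (E-sym G e))) td)
        step : ∀ m → length caps ≡ m → ∃ λ is → is ∈ listsUpTo m types × FOSat G ρ (Peel taken is δ γ)
        step zero len = ⊥-elim (nonempty-≢ τ∈caps len)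
          where
          nonempty-≢ : ∀ {xs : List CT} → τ ∈ xs → length xs ≢ 0
          nonempty-≢ (here _) ()
          nonempty-≢ (there _) ()
        step (suc m) len with peel-complete (v ∷ ρ) (τ ∷ taken) δ′ (λ j → γ j ↑) m (caps ─ τ∈caps)
          (ℕ.suc-injective (trans (sym (List.length-removeAt′ caps (Any.index τ∈caps))) len))
          (λ {i} i∈ → subst (threshold i ≤_) (trans (cong (count _≟ᶜ_ i taken +_) (count-─ _≟ᶜ_ caps τ∈caps i))
            (count-shift i τ taken _)) (enough i∈)) td′
        ... | is , is∈ , s = τ ∷ is , ∷∈listsUpTo m τ∈ is∈ , v , dv , typed , s

    -- A supply of `threshold τ` tokens for each type. Its length bounds how many components have to
    -- be peeled off, and thereby makes the list of indices finite.
    caps₀ : List CT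
    caps₀ = concatMap (λ τ → replicate (threshold τ) τ) types

    cover-suc : Cover (suc d) c
    cover-suc = record
      { I        = List CT
      ; _≟_      = List.≡-dec _≟ᶜ_
      ; indices  = listsUpTo (length caps₀) types
      ; H        = λ is → U (reverseAcc [] is)
      ; fin      = λ is → finite-U (reverseAcc [] is)
      ; χ        = λ δ γ is → Peel [] is δ γ
      ; sound    = λ G ρ δ γ is s → ≈-trans
          (≈-trans (≅⇒≈ (⊔-identityʳ (struct G ρ δ γ) emptyˢ λ ())) (≅⇒≈ (⊔-comm (struct G ρ δ γ) emptyˢ)))
          (peel-sound G ρ [] is δ γ s)
      ; complete = λ G ρ δ γ → peel-complete G ρ [] δ γ _ caps₀ refl (count-concatMap _≟ᶜ_ threshold)
      }

  -- A deleted root costs one level of depth and adds one colour, so `c` has to vary in the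
  -- recursion.
  cover : ∀ d c → Cover d c
  cover zero    c = cover-zero c
  cover (suc d) c = Successor.cover-suc d c (cover d (suc c))

-- Satisfaction is decidable in finite structures

update : ∀ {K : Set} → DecidableEquality K → K → Bool → (K → Bool) → K → Bool
update _≟_ k b f x = if does (x ≟ k) then b else f x

-- Represents all Boolean functions up to their values on the list. This is enough to quantify over
-- relations, because satisfaction and guardedness respect pointwise equality.
functions : ∀ {K : Set} → DecidableEquality K → List K → List (K → Bool)
functions _≟_ []       = (λ _ → false) ∷ []
functions _≟_ (k ∷ ks) = cartesianProductWith (update _≟_ k) (true ∷ false ∷ []) (functions _≟_ ks)

functions-complete : ∀ {K : Set} (_≟_ : DecidableEquality K) (R : K → Bool) ks →
                     ∃ λ f → f ∈ functions _≟_ ks × (∀ {x} → x ∈ ks → f x ≡ R x)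
functions-complete _≟_ R [] = _ , here refl , λ ()
functions-complete _≟_ R (k ∷ ks) with functions-complete _≟_ R ks
... | f , f∈ , eq = _ , ∈-cartesianProductWith⁺ (update _≟_ k) (bool (R k)) f∈ , agree
  where
  bool : ∀ b → b ∈ true ∷ false ∷ []
  bool true  = here refl
  bool false = there (here refl)
  agree : ∀ {x} → x ∈ k ∷ ks → update _≟_ k (R k) f x ≡ R x
  agree {x} x∈ with x ≟ k
  ... | yes refl = refl
  agree (here p)   | no n = ⊥-elim (n p)
  agree (there x∈) | no n = eq x∈

module _ {A : Set} {xs : List A} {P : A → Set} (complete : ∀ a → a ∈ xs) (P? : ∀ a → Dec (P a)) where

  any-dec : Dec (∃ P)
  any-dec =
    map′ (λ p → let a , _ , q = find p in a , q) (λ (a , p) → lose (complete a) p) (Any.any? P? xs)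

  all-dec : Dec (∀ a → P a)
  all-dec = map′ (λ ps a → All.lookup ps (complete a)) (λ h → All.universal h xs) (All.all? P? xs)

module _ {c} {M : Str c} (fin : Finite M) where
  open Str M
  open Finite fin
  open Semantics D adj

  private
    tuples : ∀ r → List (Vec V r)
    tuples = allVecs vertices

    tuples-complete : ∀ {r} (t : Vec V r) → t ∈ tuples r
    tuples-complete t = ∈-allVecs (VecAll.universal complete t)

    relations : ∀ r → List (Vec V r → Bool)
    relations r = functions (Vec.≡-dec _≟_) (tuples r)

    Guard? : ∀ {r} (R : Vec V r → Bool) → Dec (Guard R)
    Guard? R = map′ (λ h t p {u} {v} → h t p u v) (λ h t p u v → h t p {u} {v})
      (all-dec tuples-complete λ t → T? (R t) →-dec all-dec complete λ u → all-dec complete λ v →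
        VecAny.any? (u ≟_) t →-dec VecAny.any? (v ≟_) t →-dec ¬? (u ≟ v) →-dec adj? u v)

    extensional : ∀ {Γ k r} {R S : Vec V r → Bool} {σ : Rels V Γ} {ρ : Vec V k} → VecAll.All D ρ →
                  (∀ t → R t ≡ S t) → ∀ φ → Sat (R ∷ σ) ρ φ ⇔ Sat (S ∷ σ) ρ φ
    extensional {R = R} {S} {σ} {ρ} ds eq φ =
      subst (λ ρ′ → Sat (R ∷ σ) ρ φ ⇔ Sat (S ∷ σ) ρ′ φ) (Vec.map-id ρ)
        (≅-sat (≅-refl {M = M}) corr ρ ds φ)
      where
      corr : Corresponding (≅-refl {M = M}) (R ∷ σ) (S ∷ σ)
      corr (here refl) {t} _ = trans (eq t) (cong S (sym (Vec.map-id t)))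
      corr (there X)   {t} _ = cong (All.lookup σ X) (sym (Vec.map-id t))

    guard-ext : ∀ {r} {R S : Vec V r → Bool} → (∀ t → R t ≡ S t) → Guard R → Guard S
    guard-ext eq gd t p = gd t (subst T (sym (eq t)) p)

    code : ∀ {r} (R : Vec V r → Bool) → ∃ λ S → S ∈ relations r × (∀ t → S t ≡ R t)
    code {r} R = let S , S∈ , eq = functions-complete (Vec.≡-dec _≟_) R (tuples r) in
      S , S∈ , λ t → eq (tuples-complete t)

  Sat? : ∀ {Γ k} (σ : Rels V Γ) {ρ : Vec V k} → VecAll.All D ρ → ∀ φ → Dec (Sat σ ρ φ)
  Sat? σ ds (edge x y) = adj? _ _
  Sat? σ ds (x ≐ y)    = _ ≟ _
  Sat? σ ds (rel X xs) = T? _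
  Sat? σ ds (¬′ φ)     = ¬? (Sat? σ ds φ)
  Sat? σ ds (φ ∧′ ψ)   = Sat? σ ds φ ×-dec Sat? σ ds ψ
  Sat? σ ds (φ ∨′ ψ)   = Sat? σ ds φ ⊎-dec Sat? σ ds ψ
  Sat? σ ds (∀′ φ)     = all-dec complete λ a → case D? a of λ where
    (yes d) → map′ (λ s _ → s) (λ h → h d) (Sat? σ (d VecAll.∷ ds) φ)
    (no ¬d) → yes (⊥-elim ∘ ¬d)
  Sat? σ ds (∃′ φ)     = any-dec complete λ a → case D? a of λ where
    (yes d) → map′ (d ,_) proj₂ (Sat? σ (d VecAll.∷ ds) φ)
    (no ¬d) → no (¬d ∘ proj₁)
  Sat? σ {ρ} ds (∀² r ∙ φ) = map′
    (λ h R gd → let S , S∈ , eq = code R in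
      to (extensional ds eq φ) (All.lookup h S∈ (guard-ext (sym ∘ eq) gd)))
    (λ h → All.tabulate λ {S} _ → h S)
    (All.all? (λ S → Guard? S →-dec Sat? (S ∷ σ) ds φ) (relations r))
  Sat? σ {ρ} ds (∃² r ∙ φ) = map′
    (λ p → let S , _ , gds = find p in S , gds)
    (λ (R , gd , s) → let S , S∈ , eq = code R in
      lose S∈ (guard-ext (sym ∘ eq) gd , from (extensional ds eq φ) s))
    (Any.any? (λ S → Guard? S ×-dec Sat? (S ∷ σ) ds φ) (relations r))

-- A graph as a structure

whole : ∀ {n} → Graph n → Str 0
whole {n} G = sub G {λ _ → ⊤} (λ _ → yes tt) (λ ())

module _ {n} (G : Graph n) where
  open Semantics {Fin n} (λ _ → ⊤) (E G)

  edge-gaifman : ∀ {u v} → Gaifman (edgeRelation G) u v → E G u v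
  edge-gaifman (u≢v , (x ∷ y ∷ []) , e , VecAny.here refl , VecAny.here refl) = ⊥-elim (u≢v refl)
  edge-gaifman (u≢v , (x ∷ y ∷ []) , e , VecAny.here refl , VecAny.there (VecAny.here refl)) = e
  edge-gaifman (u≢v , (x ∷ y ∷ []) , e , VecAny.there (VecAny.here refl) , VecAny.here refl) = E-sym G e
  edge-gaifman (u≢v , (x ∷ y ∷ []) , e , VecAny.there (VecAny.here refl) , VecAny.there (VecAny.here refl)) =
    ⊥-elim (u≢v refl)

  Guarded⇒Guard : ∀ {r} {R : Relation n r} → Guarded G R → Guard R
  Guarded⇒Guard gd t p u∈ v∈ u≢v = edge-gaifman (gd (u≢v , t , p , u∈ , v∈))

  Guard⇒Guarded : ∀ {r} {R : Relation n r} → Guard R → Guarded G R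
  Guard⇒Guarded gd {u} {v} (u≢v , t , p , u∈ , v∈) =
    u≢v , u ∷ v ∷ [] , gd t p u∈ v∈ u≢v , VecAny.here refl , VecAny.there (VecAny.here refl)

  gso⇔ : ∀ {Γ k} (σ : Rels (Fin n) Γ) (ρ : Vec (Fin n) k) φ → GSOSat G σ ρ φ ⇔ Sat σ ρ φ
  gso⇔ σ ρ (edge x y) = ⇔-id _
  gso⇔ σ ρ (x ≐ y)    = ⇔-id _
  gso⇔ σ ρ (rel X xs) = ⇔-id _
  gso⇔ σ ρ (¬′ φ)     = ¬-⇔ (gso⇔ σ ρ φ)
  gso⇔ σ ρ (φ ∧′ ψ)   = gso⇔ σ ρ φ ×-⇔ gso⇔ σ ρ ψ
  gso⇔ σ ρ (φ ∨′ ψ)   = gso⇔ σ ρ φ ⊎-⇔ gso⇔ σ ρ ψ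
  gso⇔ σ ρ (∀′ φ)     =
    mk⇔ (λ h a _ → to (gso⇔ σ (a ∷ ρ) φ) (h a)) (λ h a → from (gso⇔ σ (a ∷ ρ) φ) (h a tt))
  gso⇔ σ ρ (∃′ φ)     =
    mk⇔ (λ (a , s) → a , tt , to (gso⇔ σ (a ∷ ρ) φ) s) (λ (a , _ , s) → a , from (gso⇔ σ (a ∷ ρ) φ) s)
  gso⇔ σ ρ (∀² r ∙ φ) = mk⇔ fwd bwd
    where
    fwd : GSOSat G σ ρ (∀² r ∙ φ) → Sat σ ρ (∀² r ∙ φ)
    fwd h R gd = to (gso⇔ (R ∷ σ) ρ φ) (h R (Guard⇒Guarded {R = R} gd))
    bwd : Sat σ ρ (∀² r ∙ φ) → GSOSat G σ ρ (∀² r ∙ φ)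
    bwd h R gd = from (gso⇔ (R ∷ σ) ρ φ) (h R (Guarded⇒Guard {R = R} gd))
  gso⇔ σ ρ (∃² r ∙ φ) = mk⇔ fwd bwd
    where
    fwd : GSOSat G σ ρ (∃² r ∙ φ) → Sat σ ρ (∃² r ∙ φ)
    fwd (R , gd , s) = R , Guarded⇒Guard {R = R} gd , to (gso⇔ (R ∷ σ) ρ φ) s
    bwd : Sat σ ρ (∃² r ∙ φ) → GSOSat G σ ρ (∃² r ∙ φ)
    bwd (R , gd , s) = R , Guard⇒Guarded {R = R} gd , from (gso⇔ (R ∷ σ) ρ φ) s

-- Tree depth bounds elimination depth

element-∈ : ∀ {n} (U : Subset n) i → element U i Subset.∈ U
element-∈ (inside  ∷ U) zero    = Vec.here
element-∈ (inside  ∷ U) (suc i) = Vec.there (element-∈ U i)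
element-∈ (outside ∷ U) i       = Vec.there (element-∈ U i)

element-surjective : ∀ {n} (U : Subset n) {u} → u Subset.∈ U → ∃ λ i → element U i ≡ u
element-surjective (inside  ∷ U) Vec.here       = zero , refl
element-surjective (inside  ∷ U) (Vec.there u∈) =
  let i , eq = element-surjective U u∈ in suc i , cong suc eq
element-surjective (outside ∷ U) (Vec.there u∈) = let i , eq = element-surjective U u∈ in i , cong suc eq

x∉p-x : ∀ {n} (p : Subset n) x → ¬ x Subset.∈ p - x
x∉p-x (s ∷ p) (suc x) (Vec.there x∈) = x∉p-x p x x∈

∈⊤- : ∀ {n} {x u : Fin n} → u Subset.∈ Subset.⊤ - x ⇔ u ≢ x
∈⊤- {x = x} = mk⇔ (λ { u∈ refl → x∉p-x Subset.⊤ x u∈ }) (Subset.x∈p∧x≢y⇒x∈p-y Subset.∈⊤)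

∈-tabulate : ∀ {n} {P : Fin n → Set} (P? : ∀ v → Dec (P v)) {v} →
  v Subset.∈ Vec.tabulate (does ∘ P?) ⇔ P v
∈-tabulate P? {v} = mk⇔
  (λ v∈ → invert (P? v) (trans (sym (Vec.lookup∘tabulate _ v)) (Vec.[]=⇒lookup v∈)))
  (λ p → Vec.lookup⇒[]= v _ (trans (Vec.lookup∘tabulate _ v) (Dec.dec-true (P? v) p)))
  where
  invert : ∀ {P : Set} (P? : Dec P) → does P? ≡ true → P
  invert (yes p) _ = p

∈component : ∀ {n} (G : Graph n) {v u} → u Subset.∈ component G v ⇔ Reachable G v u
∈component G {v} = ∈-tabulate (reachable? G v)

minimum-attained : ∀ {m} (f : Fin (suc m) → ℕ) → ∃ λ x → f x ≤ minimum f
minimum-attained f with go (f zero) (f ∘ suc)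
  where
  go : ∀ {m} z (g : Fin m → ℕ) → (z ≤ foldr _⊓_ z g) ⊎ ∃ λ x → g x ≤ foldr _⊓_ z g
  go {zero}  z g = inj₁ ℕ.≤-refl
  go {suc m} z g with ℕ.⊓-sel (g zero) (foldr _⊓_ z (g ∘ suc)) | go z (g ∘ suc)
  ... | inj₁ eq | _      = inj₂ (zero , ℕ.≤-reflexive (sym eq))
  ... | inj₂ eq | inj₁ p = inj₁ (ℕ.≤-trans p (ℕ.≤-reflexive (sym eq)))
  ... | inj₂ eq | inj₂ (x , p) = inj₂ (suc x , ℕ.≤-trans p (ℕ.≤-reflexive (sym eq)))
... | inj₁ p       = zero , p
... | inj₂ (x , p) = suc x , p

minimum-≤ : ∀ {m} (f : Fin (suc m) → ℕ) x → minimum f ≤ f x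
minimum-≤ f zero    = base (f zero) (f ∘ suc)
  where
  base : ∀ {m} z (g : Fin m → ℕ) → foldr _⊓_ z g ≤ z
  base {zero}  z g = ℕ.≤-refl
  base {suc m} z g = ℕ.≤-trans (ℕ.m⊓n≤n (g zero) _) (base z (g ∘ suc))
minimum-≤ f (suc x) = later (f zero) (f ∘ suc) x
  where
  later : ∀ {m} z (g : Fin m → ℕ) x → foldr _⊓_ z g ≤ g x
  later z g zero    = ℕ.m⊓n≤m (g zero) _
  later z g (suc x) = ℕ.≤-trans (ℕ.m⊓n≤n (g zero) _) (later z (g ∘ suc) x)

≤-maximum : ∀ {m} (f : Fin m → ℕ) x → f x ≤ maximum f
≤-maximum f zero    = ℕ.m≤m⊔n (f zero) _
≤-maximum f (suc x) = ℕ.≤-trans (≤-maximum (f ∘ suc) x) (ℕ.m≤n⊔m (f zero) _)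

maximum-≤ : ∀ {m k} (f : Fin m → ℕ) → (∀ x → f x ≤ k) → maximum f ≤ k
maximum-≤ {zero}  f h = z≤n
maximum-≤ {suc m} f h = ℕ.⊔-lub (h zero) (maximum-≤ (f ∘ suc) (h ∘ suc))

module _ {n m} {G : Graph n} {G′ : Graph m} (e : Fin m → Fin n) (e-inj : ∀ {i j} → e i ≡ e j → i ≡ j)
         (e-adj : ∀ {i j} → E G′ i j ⇔ E G (e i) (e j)) where

  Image : (Fin m → Set) → Fin n → Set
  Image D u = ∃ λ i → D i × e i ≡ u

  Reach-image : ∀ {D i j} → Reach G′ D i j → Reach G (Image D) (e i) (e j)
  Reach-image ε             = ε
  Reach-image ((a , d) ◅ p) = (to e-adj a , _ , d , refl) ◅ Reach-image p

  Reach-preimage : ∀ {D i u} → Reach G (Image D) (e i) u → ∃ λ j → Reach G′ D i j × e j ≡ u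
  Reach-preimage ε = _ , ε , refl
  Reach-preimage ((a , j , d , refl) ◅ p) =
    let k , r , eq = Reach-preimage p in k , (from e-adj a , d) ◅ r , eq

  TD-image : ∀ d {D} → TD G′ d D → TD G d (Image D)
  TD-image zero    td v (i , di , _) = td i di
  TD-image (suc d) {D} td _ (i , di , refl) with td i di
  ... | x , r , td′ = e x , Reach-image r , TD-cong G d
    (λ u → mk⇔
      (λ { (j , (r , j≢x) , refl) → Reach-image r , j≢x ∘ e-inj })
      (λ (r , u≢) → let j , r′ , eq = Reach-preimage r in j , (r′ , λ j≡x → u≢ (trans (sym eq) (cong e j≡x))) , eq))
    (TD-image d td′)

TD-induced : ∀ {n} (G : Graph n) (U : Subset n) d → TD (G [ U ]) d (λ _ → ⊤) → TD G d (Subset._∈ U)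
TD-induced G U d td = TD-cong G d
  (λ u → mk⇔ (λ { (i , _ , refl) → element-∈ U i }) (λ u∈ → let i , eq = element-surjective U u∈ in i , tt , eq))
  (TD-image (element U) (element-injective U) (⇔-id _) d td)

Reachable⇔ : ∀ {n} (G : Graph n) {u v} → Reachable G u v ⇔ Reach G (λ _ → ⊤) u v
Reachable⇔ G = mk⇔ (Star.map (_, tt)) (Star.map proj₁)

TD-empty : ∀ {n} (G : Graph n) d {D} → (∀ v → ¬ D v) → TD G d D
TD-empty G zero    ∅ = ∅
TD-empty G (suc d) ∅ v dv = ⊥-elim (∅ v dv)

-- Deleting a vertex lowers the bound, whereas passing to components does not. `TD` performs both
-- steps at once, so in the disconnected case the roots found for the components are reused for the
-- whole graph.
td⇒TD : ∀ {n} (G : Graph n) (ac : Acc _<_ n) d → treeDepth G ac ≤ d → TD G d (λ _ → ⊤)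
td⇒TD {zero} G _ d le = TD-empty G d λ ()
td⇒TD {suc zero} G _ (suc d) le zero _ = zero , ε , TD-empty G d λ { zero (_ , n) → n refl }
td⇒TD {suc (suc n)} G (acc rec) d le with connected? G
td⇒TD {suc (suc n)} G (acc rec) (suc d) (s≤s le) | yes conn with minimum-attained (λ x → treeDepth (G [ Subset.⊤ - x ]) (rec (deletion-< x)))
... | x , min = λ v _ → x , to (Reachable⇔ G) (conn v x) , TD-cong G d
  (λ u → mk⇔ (λ u∈ → to (Reachable⇔ G) (conn v u) , to ∈⊤- u∈) (λ (_ , u≢x) → from ∈⊤- u≢x))
  (TD-induced G _ d (td⇒TD (G [ Subset.⊤ - x ]) (rec (deletion-< x)) d (ℕ.≤-trans min le)))
td⇒TD {suc (suc n)} G (acc rec) d le | no ¬conn = whole-TD d λ v →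
  TD-induced G (component G v) d (td⇒TD (G [ component G v ]) (rec (component-< G ¬conn v)) d
    (ℕ.≤-trans (≤-maximum (λ v → treeDepth (G [ component G v ]) (rec (component-< G ¬conn v))) v) le))
  where
  whole-TD : ∀ d → (∀ v → TD G d (Subset._∈ component G v)) → TD G d (λ _ → ⊤)
  whole-TD zero    h v _ = h v v (from (∈component G) ε)
  whole-TD (suc d) h v _ with h v v (from (∈component G) ε)
  ... | x , r , td = x , Reach-mono G (λ _ → tt) r , TD-cong G d
    (λ u → mk⇔ (map₁ (Reach-mono G (λ _ → tt))) (map₁ (Reach-closed G cl (from (∈component G) ε)))) td
    where
    cl : Closed G (λ _ → ⊤) (Subset._∈ component G v)
    cl u∈ _ e = from (∈component G) (to (∈component G) u∈ ◅◅ e ◅ ε)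

-- Guarded second-order logic collapses on bounded tree depth

module Collapse (φ : SOFormula [] 0) (d : ℕ) where
  open Context φ
  open Cover (cover φ d 0)

  H? : ∀ i → Dec (H i ⊨ φ)
  H? i = Sat? (fin i) [] VecAll.[] φ

  always : FOFormula 1
  always = zero ≐ zero

  ψ : FOFormula 0
  ψ = ⋁ (filter H? indices) (χ always λ ())

  correct : ∀ {n} (G : Graph n) → td G ≤ d → GSOSat G [] [] φ ⇔ FOSat G [] ψ
  correct {n} G le = mk⇔ forward backward ⇔-∘ gso⇔ G [] [] φ
    where
    -- Whichever formula holds in `G`, its model agrees with `G` on `φ`; the choice of `i` is
    -- therefore immaterial.
    G⇔H : ∀ {i} → FOSat G [] (χ always (λ ()) i) → whole G ⊨ φ ⇔ H i ⊨ φ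
    G⇔H {i} s = ≈⇒⇔ (≈-trans (≅⇒≈ whole≅) (sound G [] always (λ ()) i s))
      where
      whole≅ : whole G ≅ struct G [] always (λ ())
      whole≅ = sub-cong G (λ v → mk⇔ (λ _ → refl) (λ _ → tt)) λ ()
    forward : whole G ⊨ φ → FOSat G [] ψ
    forward s with complete G [] always (λ ()) (TD-cong G d (λ v → mk⇔ (λ _ → refl) (λ _ → tt)) (td⇒TD G (<-wellFounded n) d le))
    ... | i , i∈ , si = ⋁-intro (χ always λ ()) (∈-filter⁺ H? i∈ (to (G⇔H si) s)) si
    backward : FOSat G [] ψ → whole G ⊨ φ
    backward s with ⋁-elim (filter H? indices) (χ always λ ()) s
    ... | i , i∈ , si = from (G⇔H si) (proj₂ (∈-filter⁻ H? {xs = indices} i∈))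

-- First-order logic as a fragment of guarded second-order logic

embed : ∀ {Γ k} → FOFormula k → SOFormula Γ k
embed (edge x y) = edge x y
embed (x ≐ y)    = x ≐ y
embed (¬′ φ)     = ¬′ embed φ
embed (φ ∧′ ψ)   = embed φ ∧′ embed ψ
embed (φ ∨′ ψ)   = embed φ ∨′ embed ψ
embed (∀′ φ)     = ∀′ embed φ
embed (∃′ φ)     = ∃′ embed φ

embed-sat : ∀ {n} (G : Graph n) {Γ k} {σ : All (Relation n) Γ} (ρ : Vec (Fin n) k) φ →
  FOSat G ρ φ ⇔ GSOSat G σ ρ (embed φ)
embed-sat G ρ (edge x y) = ⇔-id _
embed-sat G ρ (x ≐ y)    = ⇔-id _
embed-sat G ρ (¬′ φ)     = ¬-⇔ (embed-sat G ρ φ)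
embed-sat G ρ (φ ∧′ ψ)   = embed-sat G ρ φ ×-⇔ embed-sat G ρ ψ
embed-sat G ρ (φ ∨′ ψ)   = embed-sat G ρ φ ⊎-⇔ embed-sat G ρ ψ
embed-sat G ρ (∀′ φ)     = ∀-⇔ λ a → embed-sat G (a ∷ ρ) φ
embed-sat G ρ (∃′ φ)     = ∃-⇔ λ a → embed-sat G (a ∷ ρ) φ

bounded⇒collapse : ∀ {ℓ : Level} (C : GraphClass ℓ) → BoundedTreeDepth C → SameExpressivePower FO GSO C
bounded⇒collapse C (d , bound) =
  (λ φ → embed φ , λ G _ → embed-sat G [] φ) ,
  (λ φ → Collapse.ψ φ d , λ G GC → Collapse.correct φ d G (bound G GC))

-- Ramsey's theorem

-- P holds for all increasing k-tuples of elements of a list.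
Hom : ∀ {A : Set} k → (Vec A k → Set) → List A → Set
Hom zero    P xs       = P []
Hom (suc k) P []       = ⊤
Hom (suc k) P (x ∷ xs) = Hom k (λ v → P (x ∷ v)) xs × Hom (suc k) P xs

Hom-⊆ : ∀ {A : Set} k {P : Vec A k → Set} {xs ys} → ys ⊆ xs → Hom k P xs → Hom k P ys
Hom-⊆ zero    s h = h
Hom-⊆ (suc k) []         h = tt
Hom-⊆ (suc k) (y ∷ʳ s)   (_ , h)  = Hom-⊆ (suc k) s h
Hom-⊆ (suc k) (refl ∷ s) (h , h′) = Hom-⊆ k s h , Hom-⊆ (suc k) s h′

Mono : ∀ {A : Set} k → (Vec A k → Bool) → List A → Set
Mono k f xs = Hom k (T ∘ f) xs ⊎ Hom k (¬_ ∘ T ∘ f) xs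

Mono-⊆ : ∀ {A : Set} k {f : Vec A k → Bool} {xs ys} → ys ⊆ xs → Mono k f xs → Mono k f ys
Mono-⊆ k s = Sum.map (Hom-⊆ k s) (Hom-⊆ k s)

-- For tuples of length `suc k`, each chosen first element `x` requires Ramsey's theorem for the
-- `k`-tuples that follow it, which gives the nesting in `preNumber`. The factor 2 pays for the
-- majority among the colours of the first elements.
ramseyNumber : ℕ → ℕ → ℕ
preNumber : ℕ → ℕ → ℕ

ramseyNumber zero    M = M
ramseyNumber (suc k) M = preNumber k (2 * M)

preNumber k zero    = 0
preNumber k (suc p) = suc (ramseyNumber k (preNumber k p))

-- The colour of an increasing tuple depends on its first element only.
Pre : ∀ {A : Set} k → (Vec A (suc k) → Bool) → List A → Set
Pre k f []       = ⊤
Pre k f (x ∷ xs) = Mono k (λ v → f (x ∷ v)) xs × Pre k f xs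

pre-split : ∀ {A : Set} k (f : Vec A (suc k) → Bool) xs → Pre k f xs →
            ∃ λ ys → ∃ λ zs → ys ⊆ xs × zs ⊆ xs × Hom (suc k) (T ∘ f) ys × Hom (suc k) (¬_ ∘ T ∘ f) zs ×
            length xs ≤ length ys + length zs
pre-split k f [] _ = [] , [] , [] , [] , tt , tt , z≤n
pre-split k f (x ∷ xs) (m , pre) with pre-split k f xs pre
... | ys , zs , s , t , h , h′ , le = case m of λ where
  (inj₁ p) → x ∷ ys , zs , refl ∷ s , x ∷ʳ t , (Hom-⊆ k s p , h) , h′ , s≤s le
  (inj₂ q) → ys , x ∷ zs , x ∷ʳ s , refl ∷ t , h , (Hom-⊆ k t q , h′) ,
    ℕ.≤-trans (s≤s le) (ℕ.≤-reflexive (sym (ℕ.+-suc _ _)))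

ramsey : ∀ {A : Set} k M (f : Vec A k → Bool) xs → ramseyNumber k M ≤ length xs →
         ∃ λ ys → ys ⊆ xs × M ≤ length ys × Mono k f ys
prehomogeneous : ∀ {A : Set} k p (f : Vec A (suc k) → Bool) xs → preNumber k p ≤ length xs →
                 ∃ λ ys → ys ⊆ xs × p ≤ length ys × Pre k f ys

ramsey zero M f xs le with T? (f [])
... | yes p = xs , ⊆-refl , le , inj₁ p
... | no ¬p = xs , ⊆-refl , le , inj₂ ¬p
ramsey (suc k) M f xs le with prehomogeneous k (2 * M) f xs le
... | ys , s , le′ , pre with pre-split k f ys pre
...   | as , bs , sa , sb , ha , hb , le″ with halves M (ℕ.≤-trans le′ le″)
...     | inj₁ q = as , ⊆-trans sa s , q , inj₁ ha
...     | inj₂ q = bs , ⊆-trans sb s , q , inj₂ hb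

prehomogeneous k zero f xs le = [] , []-⊆ xs , z≤n , tt
prehomogeneous k (suc p) f (x ∷ xs) (s≤s le) with ramsey k (preNumber k p) (λ v → f (x ∷ v)) xs le
... | zs , s , le′ , m with prehomogeneous k p f zs le′
...   | ys , t , le″ , pre = x ∷ ys , refl ∷ ⊆-trans t s , s≤s le″ , Mono-⊆ k t m , pre

-- Several two-colourings are made homogeneous in turn, which replaces a colouring with many
-- colours.
ramseyNumbers : ℕ → ℕ → ℕ → ℕ
ramseyNumbers k zero    M = M
ramseyNumbers k (suc p) M = ramseyNumber k (ramseyNumbers k p M)

ramseys : ∀ {A : Set} k M (fs : List (Vec A k → Bool)) xs → ramseyNumbers k (length fs) M ≤ length xs →
          ∃ λ ys → ys ⊆ xs × M ≤ length ys × All (λ f → Mono k f ys) fs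
ramseys k M [] xs le = xs , ⊆-refl , le , []
ramseys k M (f ∷ fs) xs le with ramsey k _ f xs le
... | ys , s , le′ , m with ramseys k M fs ys le′
...   | zs , t , le″ , ms = zs , ⊆-trans t s , le″ , Mono-⊆ k t m ∷ ms

Hom₂⇒AllPairs : ∀ {A : Set} {P : Vec A 2 → Set} xs → Hom 2 P xs → AllPairs (λ x y → P (x ∷ y ∷ [])) xs
Hom₂⇒AllPairs [] _ = []
Hom₂⇒AllPairs {A} (x ∷ xs) (h , h′) = all _ h ∷ Hom₂⇒AllPairs xs h′
  where
  all : ∀ {Q : Vec A 1 → Set} ys → Hom 1 Q ys → All (λ y → Q (y ∷ [])) ys
  all []       _       = []
  all (y ∷ ys) (q , h) = q ∷ all ys h

-- Disjoint intervals from increasing lists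

pairUp : ∀ {A : Set} → List A → List (A × A)
pairUp (x ∷ y ∷ xs) = (x , y) ∷ pairUp xs
pairUp _            = []

pairUp-length : ∀ {A : Set} h (xs : List A) → h + h ≤ length xs → h ≤ length (pairUp xs)
pairUp-length zero    xs           le = z≤n
pairUp-length (suc h) (x ∷ [])     (s≤s le) rewrite ℕ.+-suc h h = case le of λ ()
pairUp-length (suc h) (x ∷ y ∷ xs) (s≤s le) rewrite ℕ.+-suc h h = s≤s (pairUp-length h xs (ℕ.≤-pred le))

pairUp-∈ : ∀ {A : Set} (xs : List A) {x y} → (x , y) ∈ pairUp xs → x ∈ xs × y ∈ xs
pairUp-∈ (x ∷ y ∷ xs) (here refl) = here refl , there (here refl)
pairUp-∈ (x ∷ y ∷ xs) (there p)   = let a , b = pairUp-∈ xs p in there (there a) , there (there b)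

pairUp-< : ∀ {A : Set} {_≺_ : A → A → Set} (xs : List A) → AllPairs _≺_ xs → ∀ {x y} →
  (x , y) ∈ pairUp xs → x ≺ y
pairUp-< (x ∷ y ∷ xs) ((p ∷ _) ∷ _) (here refl) = p
pairUp-< (x ∷ y ∷ xs) (_ ∷ _ ∷ ps) (there q)    = pairUp-< xs ps q

pairUp-AllPairs : ∀ {A : Set} {_≺_ : A → A → Set} (xs : List A) → AllPairs _≺_ xs →
                  AllPairs (λ (_ , y) (x , _) → y ≺ x) (pairUp xs)
pairUp-AllPairs []           _ = []
pairUp-AllPairs (x ∷ [])     _ = []
pairUp-AllPairs (x ∷ y ∷ xs) (_ ∷ p ∷ ps) =
  All.tabulate (λ q → All.lookup p (proj₁ (pairUp-∈ xs q))) ∷ pairUp-AllPairs xs ps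

pairUp-Hom₂ : ∀ {A : Set} {P : Vec A 2 → Set} xs → Hom 2 P xs → ∀ {x y} → (x , y) ∈ pairUp xs →
  P (x ∷ y ∷ [])
pairUp-Hom₂ (x ∷ y ∷ xs) ((p , _) , _) (here refl) = p
pairUp-Hom₂ (x ∷ y ∷ xs) (_ , _ , h)   (there q)   = pairUp-Hom₂ xs h q

pairUp-Hom₄ : ∀ {A : Set} {P : Vec A 4 → Set} as bs → Hom 4 P (as ++ bs) → ∀ {i j k l} →
              (i , j) ∈ pairUp as → (k , l) ∈ pairUp bs → P (i ∷ j ∷ k ∷ l ∷ [])
pairUp-Hom₄ (i ∷ j ∷ as) bs ((h , _) , _) (here refl) q =
  pairUp-Hom₂ bs (Hom-⊆ 2 (Sublist.++⁺ˡ as ⊆-refl) h) q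
pairUp-Hom₄ (i ∷ j ∷ as) bs (_ , _ , h) (there p) q = pairUp-Hom₄ as bs h p q

AllPairs-⊆ : ∀ {A : Set} {R : A → A → Set} {xs ys} → xs ⊆ ys → AllPairs R ys → AllPairs R xs
AllPairs-⊆ []         []       = []
AllPairs-⊆ (_ ∷ʳ s)   (_ ∷ ps) = AllPairs-⊆ s ps
AllPairs-⊆ (refl ∷ s) (p ∷ ps) = Sublist.All-resp-⊆ s p ∷ AllPairs-⊆ s ps

-- Induced paths

nth : ∀ {A : Set} → ℕ → List A → Maybe A
nth _       []       = nothing
nth zero    (x ∷ xs) = just x
nth (suc a) (x ∷ xs) = nth a xs

∈⇒nth : ∀ {A : Set} {x : A} {xs} → x ∈ xs → ∃ λ a → a < length xs × nth a xs ≡ just x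
∈⇒nth (here refl) = 0 , s≤s z≤n , refl
∈⇒nth (there p)   = let a , lt , eq = ∈⇒nth p in suc a , s≤s lt , eq

nth⇒∈ : ∀ {A : Set} {x : A} a xs → nth a xs ≡ just x → x ∈ xs
nth⇒∈ zero    (x ∷ xs) refl = here refl
nth⇒∈ (suc a) (x ∷ xs) eq   = there (nth⇒∈ a xs eq)

-- There is a colouring for every pair of positions below `s`. If one of them is always true, `4h`
-- indices yield two groups of `h` disjoint intervals, and Ramsey's theorem thins each group out to
-- `s` independent vertices. If all are always false, `s + 2` indices bound `s + 1` consecutive
-- intervals, and an induced path through these has at least `s` edges.
pathNumber : ℕ → ℕ
pathNumber s =
  ramseyNumbers 4 (length (cartesianProduct (upTo s) (upTo s))) ((h + h) + (h + h) + (s + 2))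
  where h = ramseyNumber 2 s

separate : ∀ {A : Set} {P Q : A → Set} {xs} → All (λ x → P x ⊎ Q x) xs → (∃ P) ⊎ All Q xs
separate [] = inj₂ []
separate (inj₁ p ∷ _) = inj₁ (_ , p)
separate (inj₂ q ∷ pqs) = Sum.map₂ (q ∷_) (separate pqs)

module Induced {n} (G : Graph n) where

  Far : Fin n → Fin n → Set
  Far x z = ¬ E G x z × x ≢ z

  -- IPath u w xs: the list xs is an induced path from u to w.
  data IPath : Fin n → Fin n → List (Fin n) → Set where
    single : ∀ {u} → IPath u u (u ∷ [])
    extend : ∀ {x u w us} → E G x u → All (Far x) us → IPath u w (u ∷ us) → IPath x w (x ∷ u ∷ us)

  start∈ : ∀ {u w xs} → IPath u w xs → u ∈ xs
  start∈ single         = here refl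
  start∈ (extend _ _ _) = here refl

  -- The tail is examined first, so `x` is attached at the last vertex of the path that it meets or
  -- is adjacent to. Everything beyond this vertex is far from `x`, which keeps the shortcut
  -- induced.
  prepend-or-far : ∀ x {u w xs} → IPath u w xs →
                   All (Far x) xs ⊎ ∃ λ ys → IPath x w ys × (∀ {z} → z ∈ ys → z ≡ x ⊎ z ∈ xs)
  prepend-or-far x {u} single with x Fin.≟ u | E? G x u
  ... | yes refl | _     = inj₂ (_ , single , inj₂)
  ... | no _     | yes e =
    inj₂ (_ , extend e [] single , λ { (here eq) → inj₁ eq ; (there z∈) → inj₂ z∈ })
  ... | no x≢u   | no ¬e = inj₁ ((¬e , x≢u) ∷ [])
  prepend-or-far x {u} p@(extend e far q) with prepend-or-far x q
  ... | inj₂ (ys , r , sub) = inj₂ (ys , r , Sum.map₂ there ∘ sub)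
  ... | inj₁ fars with x Fin.≟ u | E? G x u
  ...   | yes refl | _     = inj₂ (_ , p , inj₂)
  ...   | no _     | yes e =
    inj₂ (_ , extend e fars p , λ { (here eq) → inj₁ eq ; (there z∈) → inj₂ z∈ })
  ...   | no x≢u   | no ¬e = inj₁ ((¬e , x≢u) ∷ fars)

  prepend : ∀ {x u w xs} → E G x u → IPath u w xs →
    ∃ λ ys → IPath x w ys × (∀ {z} → z ∈ ys → z ≡ x ⊎ z ∈ xs)
  prepend {x} e p with prepend-or-far x p
  ... | inj₂ r    = r
  ... | inj₁ fars = ⊥-elim (proj₁ (All.lookup fars (start∈ p)) e)

  join : ∀ {u v w xs ys} → IPath u v xs → IPath v w ys →
         ∃ λ zs → IPath u w zs × (∀ {z} → z ∈ zs → z ∈ xs ⊎ z ∈ ys)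
  join single q = _ , q , inj₂
  join (extend e _ p) q with join p q
  ... | zs , r , sub with prepend e r
  ...   | zs′ , r′ , sub′ = zs′ , r′ , λ z∈ → case sub′ z∈ of λ where
    (inj₁ refl) → inj₁ (here refl)
    (inj₂ z∈′)  → Sum.map₁ there (sub z∈′)

  -- The theorem of Galvin, Rival and Sands on graphs with a long path, combined with Ramsey's
  -- theorem to make both sides of the biclique independent. It takes the form of a refutation: `p`
  -- enumerates the path, and the hypotheses exclude every outcome of size `s`.
  module Unavoidable (N : ℕ) (p : ℕ → Fin n) (walk : ∀ {m} → suc m < N → E G (p m) (p (suc m)))
                     (p-inj : ∀ {i j} → i < N → j < N → p i ≡ p j → i ≡ j)
                     (s : ℕ) (short : ∀ {u w xs} → IPath u w xs → length xs < s)
                     (noClique : ∀ {xs} → AllPairs (E G) xs → length xs < s)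
                     (noBiclique : ∀ {xs ys} → Unique xs → Unique ys →
                                   AllPairs (λ x y → ¬ E G x y) xs → AllPairs (λ x y → ¬ E G x y) ys →
                                   (∀ {x y} → x ∈ xs → y ∈ ys → E G x y) → s ≤ length xs → s ≤ length ys → ⊥) where

    Segment : ℕ → ℕ → Fin n → Set
    Segment i j z = ∃ λ m → i ≤ m × m ≤ j × z ≡ p m

    seg : ∀ i k → k + i < N →
      ∃ λ xs → IPath (p i) (p (k + i)) xs × (∀ {z} → z ∈ xs → Segment i (k + i) z)
    seg i zero    lt = _ , single , λ { (here refl) → i , ℕ.≤-refl , ℕ.≤-refl , refl }
    seg i (suc k) lt with seg (suc i) k (subst (_< N) (sym (ℕ.+-suc k i)) lt)
    ... | xs , q , in-seg with prepend (walk (ℕ.≤-trans (s≤s (s≤s (ℕ.m≤n+m i k))) lt)) q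
    ...   | ys , r , sub =
      ys , subst (λ m → IPath (p i) (p m) ys) (ℕ.+-suc k i) r , λ z∈ → case sub z∈ of λ where
      (inj₁ refl) → i , ℕ.≤-refl , ℕ.m≤n+m i (suc k) , refl
      (inj₂ z∈′)  → let m , lo , hi , eq = in-seg z∈′ in m , ℕ.<⇒≤ lo , subst (m ≤_) (ℕ.+-suc k i) hi , eq

    seg′ : ∀ i j → i ≤ j → j < N → ∃ λ xs → IPath (p i) (p j) xs × (∀ {z} → z ∈ xs → Segment i j z)
    seg′ i j le lt = subst (λ m → ∃ λ xs → IPath (p i) (p m) xs × (∀ {z} → z ∈ xs → Segment i m z))
      (ℕ.m∸n+n≡m le) (seg i (j ∸ i) (subst (_< N) (sym (ℕ.m∸n+n≡m le)) lt))

    -- Total in both indices, because the Ramsey colourings must be defined on all tuples of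
    -- numbers.
    q : ℕ → ℕ → List (Fin n)
    q i j with i ℕ.≤? j | j ℕ.<? N
    ... | yes le | yes lt = proj₁ (seg′ i j le lt)
    ... | _      | _      = []

    q-path : ∀ {i j} → i ≤ j → j < N → IPath (p i) (p j) (q i j)
    q-path {i} {j} le lt with i ℕ.≤? j | j ℕ.<? N
    ... | yes le | yes lt = proj₁ (proj₂ (seg′ i j le lt))
    ... | no ¬le | _      = ⊥-elim (¬le le)
    ... | yes _  | no ¬lt = ⊥-elim (¬lt lt)

    q-segment : ∀ {i j z} → z ∈ q i j → Segment i j z
    q-segment {i} {j} with i ℕ.≤? j | j ℕ.<? N
    ... | yes le | yes lt = proj₂ (proj₂ (seg′ i j le lt))
    ... | yes _  | no _   = λ ()
    ... | no _   | _      = λ ()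

    adjacent? : Maybe (Fin n) → Maybe (Fin n) → Bool
    adjacent? (just u) (just v) = adjacent G u v
    adjacent? _        _        = false

    -- q i j is an induced path from p i to p j among p i, …, p j.  The
    -- colours of i < j < k < l record the edges from q i j to q k l.
    test : ℕ × ℕ → Vec ℕ 4 → Bool
    test (a , b) (i ∷ j ∷ k ∷ l ∷ []) = adjacent? (nth a (q i j)) (nth b (q k l))

    -- Intervals with adjacent a-th and b-th vertices give a biclique.
    module Joined (a b : ℕ) where

      -- The default `p i` lies in the segment of the interval as well, so vertices chosen from
      -- disjoint intervals are distinct in every case.
      x y : ℕ × ℕ → Fin n
      x (i , j) = fromMaybe (p i) (nth a (q i j))
      y (i , j) = fromMaybe (p i) (nth b (q i j))

      pick-segment : ∀ a {i j} → i ≤ j → Segment i j (fromMaybe (p i) (nth a (q i j)))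
      pick-segment a {i} {j} le with nth a (q i j) in eq
      ... | just z  = q-segment {i} {j} (nth⇒∈ a (q i j) eq)
      ... | nothing = i , ℕ.≤-refl , le , refl

      adjacent⇒E : ∀ {i j k l} → T (test (a , b) (i ∷ j ∷ k ∷ l ∷ [])) → E G (x (i , j)) (y (k , l))
      adjacent⇒E {i} {j} {k} {l} t with nth a (q i j) | nth b (q k l)
      ... | just u | just v = t

      unique : ∀ a ms → AllPairs _<_ ms → All (_< N) ms →
               Unique (List.map (λ (i , j) → fromMaybe (p i) (nth a (q i j))) (pairUp ms))
      unique a ms sorted below = AllPairs.map⁺ (go (pairUp ms) (pairUp-AllPairs ms sorted) id)
        where
        go : ∀ ps → AllPairs (λ (_ , j) (k , _) → j < k) ps → (∀ {r} → r ∈ ps → r ∈ pairUp ms) →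
             AllPairs (λ r r′ → fromMaybe (p (proj₁ r)) (nth a (q (proj₁ r) (proj₂ r))) ≢
                                fromMaybe (p (proj₁ r′)) (nth a (q (proj₁ r′) (proj₂ r′)))) ps
        go [] _ _ = []
        go ((i , j) ∷ ps) (lt ∷ lts) sub = All.tabulate distinct ∷ go ps lts (sub ∘ there)
          where
          distinct : ∀ {r} → r ∈ ps →
            fromMaybe (p i) (nth a (q i j)) ≢ fromMaybe (p (proj₁ r)) (nth a (q (proj₁ r) (proj₂ r)))
          distinct {k , l} r∈ eq with pick-segment a (ℕ.<⇒≤ (pairUp-< ms sorted (sub (here refl))))
                                    | pick-segment a (ℕ.<⇒≤ (pairUp-< ms sorted (sub (there r∈))))
          ... | m , _ , m≤j , eqm | m′ , k≤m′ , m′≤l , eqm′ = ℕ.<⇒≢ m<m′ (p-inj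
            (ℕ.<-trans m<m′ m′<N) m′<N (trans (sym eqm) (trans eq eqm′)))
            where
            m<m′ : m < m′
            m<m′ = ℕ.≤-<-trans m≤j (ℕ.<-≤-trans (All.lookup lt r∈) k≤m′)
            m′<N : m′ < N
            m′<N = ℕ.≤-<-trans m′≤l (All.lookup below (proj₂ (pairUp-∈ ms (sub (there r∈)))))

      h : ℕ
      h = ramseyNumber 2 s

      edgeTest : Vec (Fin n) 2 → Bool
      edgeTest (u ∷ v ∷ []) = adjacent G u v

      independent : ∀ xs → h ≤ length xs →
        ∃ λ ys → ys ⊆ xs × s ≤ length ys × AllPairs (λ x y → ¬ E G x y) ys
      independent xs le with ramsey 2 s edgeTest xs le
      ... | ys , sub , le′ , inj₁ hom = ⊥-elim (ℕ.<⇒≱ (noClique (Hom₂⇒AllPairs ys hom)) le′)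
      ... | ys , sub , le′ , inj₂ hom = ys , sub , le′ , Hom₂⇒AllPairs ys hom

      -- Intervals from the first half of the indices precede those from the second half, so every
      -- vertex `x` of the former is joined to every vertex `y` of the latter. As cliques are
      -- excluded, `independent` applies to either side.
      absurd : ∀ ms → (h + h) + (h + h) ≤ length ms → AllPairs _<_ ms → All (_< N) ms →
        Hom 4 (T ∘ test (a , b)) ms → ⊥
      absurd ms le sorted below hom
        with independent (List.map x (pairUp as)) (subst (h ≤_) (sym (List.length-map x (pairUp as))) (pairUp-length h as as-le))
           | independent (List.map y (pairUp bs)) (subst (h ≤_) (sym (List.length-map y (pairUp bs))) (pairUp-length h bs bs-le))
        where
        as = take (h + h) ms
        bs = drop (h + h) ms
        as-le : h + h ≤ length as
        as-le =
          ℕ.≤-reflexive (sym (trans (List.length-take (h + h) ms) (ℕ.m≤n⇒m⊓n≡m (ℕ.m+n≤o⇒m≤o _ le))))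
        bs-le : h + h ≤ length bs
        bs-le = subst (h + h ≤_) (sym (List.length-drop (h + h) ms))
          (ℕ.≤-trans (ℕ.≤-reflexive (sym (ℕ.m+n∸m≡n (h + h) (h + h)))) (ℕ.∸-monoˡ-≤ (h + h) le))
      ... | xs , sx , lx , ix | ys , sy , ly , iy =
        noBiclique (unique⊆ sx (unique a as (AllPairs.take⁺ (h + h) sorted) (All.take⁺ (h + h) below)))
                   (unique⊆ sy (unique b bs (AllPairs.drop⁺ (h + h) sorted) (All.drop⁺ (h + h) below)))
                   ix iy cross lx ly
        where
        as = take (h + h) ms
        bs = drop (h + h) ms
        unique⊆ : ∀ {us vs : List (Fin n)} → us ⊆ vs → Unique vs → Unique us
        unique⊆ = AllPairs-⊆
        cross : ∀ {u v} → u ∈ xs → v ∈ ys → E G u v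
        cross u∈ v∈ with ∈-map⁻ x (Sublist.Any-resp-⊆ sx u∈) | ∈-map⁻ y (Sublist.Any-resp-⊆ sy v∈)
        ... | (i , j) , ij∈ , refl | (k , l) , kl∈ , refl =
          adjacent⇒E {i} {j} {k} {l} (pairUp-Hom₄ as bs (subst (Hom 4 _) (sym (List.take++drop≡id (h + h) ms)) hom) ij∈ kl∈)

    -- Without edges between non-consecutive intervals, an induced path
    -- from the first interval to the last must visit all of them.
    module Separated (ms : List ℕ) (sorted : AllPairs _<_ ms) (below : All (_< N) ms)
                     (homs : ∀ {a b} → a < s → b < s → Hom 4 (¬_ ∘ T ∘ test (a , b)) ms) where

      Block : List ℕ → ℕ → Fin n → Set
      Block (i ∷ j ∷ ms) zero    z = z ∈ q i j
      Block (i ∷ j ∷ ms) (suc b) z = Block (j ∷ ms) b z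
      Block _            _       z = ⊥

      Homs : List ℕ → Set
      Homs ms = ∀ {a b} → a < s → b < s → Hom 4 (¬_ ∘ T ∘ test (a , b)) ms

      apart₂ : ∀ {P : Vec ℕ 2 → Set} ms {b z} → AllPairs _<_ ms → All (_< N) ms → Block ms b z →
        Hom 2 P ms →
               ∃ λ k → ∃ λ l → P (k ∷ l ∷ []) × z ∈ q k l × k < l × l < N
      apart₂ (k ∷ l ∷ ms) {zero} ((lt ∷ _) ∷ _) (_ ∷ lN ∷ _) z∈ ((pkl , _) , _) =
        k , l , pkl , z∈ , lt , lN
      apart₂ (k ∷ l ∷ ms) {suc b} (_ ∷ so) (_ ∷ be) bl (_ , h) = apart₂ (l ∷ ms) so be bl h

      short-q : ∀ {i j} → i < j → j < N → length (q i j) < s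
      short-q lt jN = short (q-path (ℕ.<⇒≤ lt) jN)

      -- Consecutive blocks share an index; `suc b < b′` is what makes all four end points distinct.
      -- The paths inside blocks are induced, hence shorter than `s`, so the positions of `z` and
      -- `z′` are covered by the colourings.
      apart : ∀ ms {b b′ z z′} → AllPairs _<_ ms → All (_< N) ms → Homs ms →
              Block ms b z → Block ms b′ z′ → suc b < b′ → ¬ E G z z′
      apart (i ∷ j ∷ k ∷ ms) {zero} {suc (suc b′)} ((ij ∷ _) ∷ _ ∷ so) (_ ∷ jN ∷ be) hs z∈ bl _ e with ∈⇒nth z∈
      -- The position of `z′` is known only after its interval has been found, so the statements for
      -- all positions `b` are first collected into one predicate.
      ... | a , a< , eqa with apart₂ {λ v → ∀ b → b < s → ¬ T (test (a , b) (i ∷ j ∷ v))} (k ∷ ms) so be bl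
                               (collect (k ∷ ms) λ b b<s → proj₁ (proj₁ (hs (ℕ.<-trans a< (short-q ij jN)) b<s)))
        where
        collect : ∀ {P : ℕ → Vec ℕ 2 → Set} ms → (∀ b → b < s → Hom 2 (P b) ms) →
          Hom 2 (λ v → ∀ b → b < s → P b v) ms
        collect₁ : ∀ {P : ℕ → Vec ℕ 1 → Set} ms → (∀ b → b < s → Hom 1 (P b) ms) →
          Hom 1 (λ v → ∀ b → b < s → P b v) ms
        collect₁ []       h = tt
        collect₁ (m ∷ ms) h = (λ b lt → proj₁ (h b lt)) , collect₁ ms (λ b lt → proj₂ (h b lt))
        collect []       h = tt
        collect (m ∷ ms) h = collect₁ ms (λ b lt → proj₁ (h b lt)) , collect ms (λ b lt → proj₂ (h b lt))
      ...   | k′ , l , none , z′∈ , kl , lN with ∈⇒nth z′∈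
      ...     | b , b< , eqb = none b (ℕ.<-trans b< (short-q kl lN))
        (subst₂ (λ x y → T (adjacent? x y)) (sym eqa) (sym eqb) e)
      apart (i ∷ j ∷ ms) {zero} {suc zero} so be hs z∈ bl (s≤s ())
      apart (i ∷ j ∷ ms) {suc b} {suc b′} (_ ∷ so) (_ ∷ be) hs bl bl′ (s≤s lt) =
        apart (j ∷ ms) so be (λ a< b< → proj₂ (hs a< b<)) bl bl′ lt

      last : ℕ → List ℕ → ℕ
      last i []       = i
      last i (j ∷ ms) = last j ms

      connect : ∀ i j ms → AllPairs _<_ (i ∷ j ∷ ms) → All (_< N) (i ∷ j ∷ ms) →
                ∃ λ xs → IPath (p i) (p (last j ms)) xs × (∀ {z} → z ∈ xs → ∃ λ b → Block (i ∷ j ∷ ms) b z)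
      connect i j [] ((lt ∷ _) ∷ _) (_ ∷ jN ∷ _) = _ , q-path (ℕ.<⇒≤ lt) jN , λ z∈ → 0 , z∈
      connect i j (k ∷ ms) ((lt ∷ _) ∷ so) (_ ∷ be@(jN ∷ _)) with connect j k ms so be
      ... | xs , path , blocks with join (q-path (ℕ.<⇒≤ lt) jN) path
      ...   | zs , path′ , sub = zs , path′ , λ z∈ → case sub z∈ of λ where
        (inj₁ z∈q)  → 0 , z∈q
        (inj₂ z∈xs) → let b , bl = blocks z∈xs in suc b , bl

      end∈ : ∀ {u w xs} → IPath u w xs → w ∈ xs
      end∈ single         = here refl
      end∈ (extend _ _ r) = there (end∈ r)

      last-block : ∀ i j ms → AllPairs _<_ (i ∷ j ∷ ms) → All (_< N) (i ∷ j ∷ ms) →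
        Block (i ∷ j ∷ ms) (length ms) (p (last j ms))
      last-block i j [] ((lt ∷ _) ∷ _) (_ ∷ jN ∷ _) = end∈ (q-path (ℕ.<⇒≤ lt) jN)
      last-block i j (k ∷ ms) (_ ∷ so) (_ ∷ be) = last-block j k ms so be

      last-< : ∀ {i} j ms → AllPairs _<_ (i ∷ j ∷ ms) → i < last j ms
      last-< j []       ((lt ∷ _) ∷ _) = lt
      last-< j (k ∷ ms) ((_ ∷ lts) ∷ _ ∷ so) = last-< k ms (lts ∷ so)

      last-N : ∀ j ms → All (_< N) (j ∷ ms) → last j ms < N
      last-N j []       (lt ∷ _) = lt
      last-N j (k ∷ ms) (_ ∷ be) = last-N k ms be

      -- By `apart` an edge leads at most one block ahead, so reaching block `t` from block `b`
      -- takes at least `t - b` edges; `length (u ∷ us)` is the number of edges.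
      long : ∀ {x w u us b t} → IPath x w (x ∷ u ∷ us) →
        (∀ {z} → z ∈ x ∷ u ∷ us → ∃ λ b → Block ms b z) →
             Block ms b x → Block ms t w → t ≤ b + length (u ∷ us)
      long {b = b} (extend e _ single) blocks bx tw =
        ℕ.≤-trans (ℕ.≮⇒≥ λ lt → apart ms sorted below homs bx tw lt e) (ℕ.≤-reflexive (ℕ.+-comm 1 b))
      long {us = v ∷ vs} {b} {t} (extend e _ r@(extend _ _ _)) blocks bx tw =
        let b′ , bu = blocks (there (here refl)) in
        ℕ.≤-trans (long r (blocks ∘ there) bu tw)
          (ℕ.≤-trans (ℕ.+-monoˡ-≤ (suc (length vs)) (ℕ.≮⇒≥ λ lt → apart ms sorted below homs bx bu lt e))
            (ℕ.≤-reflexive (sym (ℕ.+-suc b (suc (length vs))))))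

    separated-absurd : ∀ ms → s + 2 ≤ length ms → (sorted : AllPairs _<_ ms) → All (_< N) ms →
                       (∀ {a b} → a < s → b < s → Hom 4 (¬_ ∘ T ∘ test (a , b)) ms) → ⊥
    separated-absurd [] le _ _ _ = case ℕ.≤-trans (ℕ.m≤n+m 2 s) le of λ ()
    separated-absurd (i ∷ []) le _ _ _ = case ℕ.≤-trans (ℕ.m≤n+m 2 s) le of λ { (s≤s ()) }
    separated-absurd (i ∷ j ∷ ms) le sorted below homs = go (connect i j ms sorted below)
      where
      open Separated (i ∷ j ∷ ms) sorted below homs
      s≤ : s ≤ length ms
      s≤ = ℕ.≤-pred (ℕ.≤-pred (ℕ.≤-trans (ℕ.≤-reflexive (ℕ.+-comm 2 s)) le))
      i<last = last-< j ms sorted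
      lastN = last-N j ms (All.tail below)
      go : (∃ λ xs → IPath (p i) (p (last j ms)) xs × (∀ {z} → z ∈ xs → ∃ λ b → Block (i ∷ j ∷ ms) b z)) → ⊥
      go (xs , path , blocks) = start path blocks refl
        where
        start : ∀ {u w xs} → IPath u w xs → (∀ {z} → z ∈ xs → ∃ λ b → Block (i ∷ j ∷ ms) b z) →
                (u , w) ≡ (p i , p (last j ms)) → ⊥
        start single _ eq = ℕ.<⇒≢ i<last (p-inj (ℕ.<-trans i<last lastN) lastN
          (trans (sym (cong proj₁ eq)) (cong proj₂ eq)))
        start path@(extend {us = us} _ _ _) blocks refl = ℕ.<⇒≱ (short path)
          (ℕ.≤-trans s≤ (ℕ.≤-trans (long {b = 0} path blocks
            (start∈ (q-path (ℕ.<⇒≤ (All.head (AllPairs.head sorted))) (All.head (All.tail below))))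
            (last-block i j ms sorted below)) (ℕ.n≤1+n _)))

    absurd : pathNumber s ≤ N → ⊥
    absurd le with ramseys 4 M tests (upTo N) (subst₂ _≤_ (cong (λ m → ramseyNumbers 4 m M) (sym (List.length-map test grid)))
                                                         (sym (List.length-upTo N)) le)
      where
      h = ramseyNumber 2 s
      M = (h + h) + (h + h) + (s + 2)
      grid = cartesianProduct (upTo s) (upTo s)
      tests = List.map test grid
    ... | ms , sub , le′ , monos = [ joined , separated ] (separate (All.map⁻ monos))
      where
      h = ramseyNumber 2 s
      sorted : AllPairs _<_ ms
      sorted = AllPairs-⊆ sub (AllPairs.applyUpTo⁺₁ id N λ i<j _ → i<j)
      below : All (_< N) ms
      below = Sublist.All-resp-⊆ sub (All.applyUpTo⁺₁ id N id)
      joined : (∃ λ ab → Hom 4 (T ∘ test ab) ms) → ⊥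
      joined ((a , b) , hom) = Joined.absurd a b ms (ℕ.m+n≤o⇒m≤o _ le′) sorted below hom
      separated : All (λ ab → Hom 4 (¬_ ∘ T ∘ test ab) ms) (cartesianProduct (upTo s) (upTo s)) → ⊥
      separated homs = separated-absurd ms (ℕ.m+n≤o⇒n≤o ((h + h) + (h + h)) le′) sorted below λ a<s b<s →
        All.lookup homs (∈-cartesianProduct⁺ (∈-upTo⁺ a<s) (∈-upTo⁺ b<s))

-- Large tree depth forces long paths

IsPath : ∀ {n} → Graph n → List (Fin n) → Set
IsPath G xs = Linked (E G) xs × Unique xs

module _ {n} (G : Graph n) (U : Subset n) where

  IsPath-element : ∀ {xs} → IsPath (G [ U ]) xs → IsPath G (List.map (element U) xs)
  IsPath-element (l , u) = Linked.map⁺ l , Unique.map⁺ (element-injective U) u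

  Reachable-induced : (∀ {u v} → u Subset.∈ U → E G u v → v Subset.∈ U) →
                      ∀ {i u} → Reachable G (element U i) u → ∃ λ j → element U j ≡ u × Reachable (G [ U ]) i j
  Reachable-induced cl {i} ε = i , refl , ε
  Reachable-induced cl {i} (e ◅ p) with element-surjective U (cl (element-∈ U i) e)
  ... | j , refl = let k , eq , r = Reachable-induced cl p in k , eq , e ◅ r

approach : ∀ {n} (G : Graph n) y {i} → Reachable G (element (Subset.⊤ - y) i) y →
           ∃ λ j → Reachable (G [ Subset.⊤ - y ]) i j × E G (element (Subset.⊤ - y) j) y
approach {n} G y {i} p = go i p refl
  where
  U = Subset.⊤ - y
  go : ∀ i {u} → Reachable G u y → u ≡ element U i →
    ∃ λ j → Reachable (G [ U ]) i j × E G (element U j) y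
  go i ε eq = ⊥-elim (to ∈⊤- (element-∈ U i) (sym eq))
  go i (_◅_ {j = z} e p) refl with z Fin.≟ y
  ... | yes refl = i , ε , e
  ... | no z≢y with element-surjective U (from ∈⊤- z≢y)
  ...   | k , refl = let j , r , e′ = go k p refl in j , e ◅ r , e′

-- The argument of depth-first search: after the deletion of `y` each component contains a neighbour
-- of `y`, and a path that starts at this neighbour can be extended by `y`, so the bound drops by
-- one. Only paths from one vertex per component are restricted because this is what the recursion
-- passes on.
treeDepth-≤ : ∀ {n} (G : Graph n) (ac : Acc _<_ n) k →
              (∀ v → ∃ λ y → Reachable G v y × (∀ xs → IsPath G (y ∷ xs) → length (y ∷ xs) ≤ k)) → treeDepth G ac ≤ k
treeDepth-≤ {zero}     G _ k h = z≤n
treeDepth-≤ {suc zero} G _ k h = proj₂ (proj₂ (h zero)) [] ([-] , [] ∷ [])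
treeDepth-≤ {suc (suc n)} G (acc rec) k h with connected? G
treeDepth-≤ {suc (suc n)} G (acc rec) k h | yes conn with h zero
treeDepth-≤ {suc (suc n)} G (acc rec) zero    h | yes conn | y , _ , bound =
  case bound [] ([-] , [] ∷ []) of λ ()
treeDepth-≤ {suc (suc n)} G (acc rec) (suc k) h | yes conn | y , _ , bound = s≤s (ℕ.≤-trans
  (minimum-≤ (λ x → treeDepth (G [ Subset.⊤ - x ]) (rec (deletion-< x))) y)
  (treeDepth-≤ (G [ U ]) (rec (deletion-< y)) k λ i →
    let j , r , e = approach G y {i} (conn _ _) in j , r , λ xs p →
      let l , u = IsPath-element G U p in
      ℕ.≤-pred (ℕ.≤-trans (ℕ.≤-reflexive (cong (λ l → suc (suc l)) (sym (List.length-map (element U) xs))))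
        (bound (List.map (element U) (j ∷ xs))
          (E-sym G e ∷ l , All.map⁺ (All.universal (λ i eq → to ∈⊤- (element-∈ U i) (sym eq)) (j ∷ xs)) ∷ u)))))
  where U = Subset.⊤ - y
treeDepth-≤ {suc (suc n)} G (acc rec) k h | no ¬conn = maximum-≤ _ λ v →
  treeDepth-≤ (G [ component G v ]) (rec (component-< G ¬conn v)) k (below v)
  where
  below : ∀ v i → ∃ λ y → Reachable (G [ component G v ]) i y ×
          (∀ xs → IsPath (G [ component G v ]) (y ∷ xs) → length (y ∷ xs) ≤ k)
  below v i with h v
  ... | y , r , bound with Reachable-induced G (component G v)
    (λ u∈ e → from (∈component G) (to (∈component G) u∈ ◅◅ e ◅ ε))
    (Reachable-sym G (to (∈component G) (element-∈ (component G v) i)) ◅◅ r)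
  ...   | j , refl , r′ = j , r′ , λ xs p →
    subst (_≤ k) (cong suc (List.length-map (element (component G v)) xs)) (bound _ (IsPath-element G (component G v) p))

-- Back-and-forth systems

rank : ∀ {k} → FOFormula k → ℕ
rank (edge x y) = 0
rank (x ≐ y)    = 0
rank (¬′ φ)     = rank φ
rank (φ ∧′ ψ)   = rank φ ⊔ rank ψ
rank (φ ∨′ ψ)   = rank φ ⊔ rank ψ
rank (∀′ φ)     = suc (rank φ)
rank (∃′ φ)     = suc (rank φ)

record BackForth {n m} (G : Graph n) (H : Graph m) : Set₁ where
  field
    Z     : ℕ → ∀ {k} → Vec (Fin n) k → Vec (Fin m) k → Set
    edges : ∀ {q k} {ρ : Vec _ k} {τ} → Z q ρ τ → ∀ x y →
      E G (lookup ρ x) (lookup ρ y) ⇔ E H (lookup τ x) (lookup τ y)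
    equal : ∀ {q k} {ρ : Vec _ k} {τ} → Z q ρ τ → ∀ x y →
      lookup ρ x ≡ lookup ρ y ⇔ lookup τ x ≡ lookup τ y
    forth : ∀ {q k} {ρ : Vec _ k} {τ} → Z (suc q) ρ τ → ∀ a → ∃ λ b → Z q (a ∷ ρ) (b ∷ τ)
    back  : ∀ {q k} {ρ : Vec _ k} {τ} → Z (suc q) ρ τ → ∀ b → ∃ λ a → Z q (a ∷ ρ) (b ∷ τ)

  preserved : ∀ {q k} {ρ : Vec _ k} {τ} φ → rank φ ≤ q → Z q ρ τ → FOSat G ρ φ ⇔ FOSat H τ φ
  preserved (edge x y) le z = edges z x y
  preserved (x ≐ y)    le z = equal z x y
  preserved (¬′ φ)     le z = ¬-⇔ (preserved φ le z)
  preserved (φ ∧′ ψ)   le z =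
    preserved φ (ℕ.m⊔n≤o⇒m≤o _ _ le) z ×-⇔ preserved ψ (ℕ.m⊔n≤o⇒n≤o (rank φ) _ le) z
  preserved (φ ∨′ ψ)   le z =
    preserved φ (ℕ.m⊔n≤o⇒m≤o _ _ le) z ⊎-⇔ preserved ψ (ℕ.m⊔n≤o⇒n≤o (rank φ) _ le) z
  preserved (∀′ φ) (s≤s le) z = mk⇔
    (λ h b → let a , z′ = back z b in to (preserved φ le z′) (h a))
    (λ h a → let b , z′ = forth z a in from (preserved φ le z′) (h b))
  preserved (∃′ φ) (s≤s le) z = mk⇔
    (λ (a , s) → let b , z′ = forth z a in b , to (preserved φ le z′) s)
    (λ (b , s) → let a , z′ = back z b in a , from (preserved φ le z′) s)

-- Graphs in which adjacency of distinct vertices depends on their classes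

fresh : ∀ {n k Q} (g : Fin Q → Fin n) → (∀ {i j} → g i ≡ g j → i ≡ j) → (ρ : Vec (Fin n) k) → k < Q →
        ∃ λ i → ∀ x → lookup ρ x ≢ g i
fresh {k = k} {Q} g g-inj ρ k<Q with Fin.any? (λ i → Fin.all? λ x → ¬? (lookup ρ x Fin.≟ g i))
... | yes r = r
... | no ¬fresh = collide (Fin.pigeonhole k<Q (proj₁ ∘ used))
  where
  used : ∀ i → ∃ λ x → lookup ρ x ≡ g i
  used i with Fin.any? (λ x → lookup ρ x Fin.≟ g i)
  ... | yes r = r
  ... | no n  = ⊥-elim (¬fresh (i , λ x eq → n (x , eq)))
  collide : (∃ λ i → ∃ λ j → i Fin.< j × proj₁ (used i) ≡ proj₁ (used j)) → _
  collide (i , j , i<j , eq) = ⊥-elim (Fin.<⇒≢ i<j (g-inj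
    (trans (sym (proj₂ (used i))) (trans (cong (lookup ρ) eq) (proj₂ (used j))))))

record Classified {n} (R : Bool → Bool → Set) (G : Graph n) : Set where
  field
    class : Fin n → Bool
    edge⇔ : ∀ u v → E G u v ⇔ (u ≢ v × R (class u) (class v))

-- Fewer than `Q` pebbles cannot fill such a class, so the reply to a new vertex can always be a
-- fresh vertex of the same class.
Large : ∀ {n m} → ℕ → (Fin n → Bool) → (Fin m → Bool) → Set
Large Q cl cl′ = ∀ v → ∃ λ (g : Fin Q → _) → (∀ {i j} → g i ≡ g j → i ≡ j) × (∀ i → cl (g i) ≡ cl′ v)

module _ {n m} {G : Graph n} {H : Graph m} {R} (cG : Classified R G) (cH : Classified R H) where
  private
    module G = Classified cG
    module H = Classified cH

  record Similar {k} (ρ : Vec (Fin n) k) (τ : Vec (Fin m) k) : Set where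
    field
      same-≡     : ∀ x y → lookup ρ x ≡ lookup ρ y ⇔ lookup τ x ≡ lookup τ y
      same-class : ∀ x → G.class (lookup ρ x) ≡ H.class (lookup τ x)

extend-similar : ∀ {n m} {G : Graph n} {H : Graph m} {R} (cG : Classified R G) (cH : Classified R H) {Q} →
  Large Q (Classified.class cH) (Classified.class cG) →
  ∀ {k} {ρ : Vec _ k} {τ} → k < Q → Similar cG cH ρ τ → ∀ a → ∃ λ b → Similar cG cH (a ∷ ρ) (b ∷ τ)
extend-similar cG cH large {ρ = ρ} {τ} k<Q s a with Fin.any? (λ x → lookup ρ x Fin.≟ a)
... | yes (x , refl) = lookup τ x , record
  { same-≡ = λ where
      zero    zero    → mk⇔ (λ _ → refl) (λ _ → refl)
      zero    (suc z) → same-≡ x z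
      (suc y) zero    → same-≡ y x
      (suc y) (suc z) → same-≡ y z
  ; same-class = λ where zero → same-class x ; (suc y) → same-class y
  }
  where open Similar s
... | no old with large a
...   | g , g-inj , cl with fresh g g-inj τ k<Q
...     | i , new = g i , record
  { same-≡ = λ where
      zero    zero    → mk⇔ (λ _ → refl) (λ _ → refl)
      zero    (suc z) → mk⇔ (λ eq → ⊥-elim (old (z , sym eq))) (λ eq → ⊥-elim (new z (sym eq)))
      (suc y) zero    → mk⇔ (λ eq → ⊥-elim (old (y , eq))) (λ eq → ⊥-elim (new y eq))
      (suc y) (suc z) → same-≡ y z
  ; same-class = λ where zero → sym (cl i) ; (suc y) → same-class y
  }
  where open Similar s

similar-sym : ∀ {n m} {G : Graph n} {H : Graph m} {R} {cG : Classified R G} {cH : Classified R H} {k} {ρ : Vec _ k} {τ} →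
              Similar cG cH ρ τ → Similar cH cG τ ρ
similar-sym s = record { same-≡ = λ x y → ⇔-sym (same-≡ x y) ; same-class = λ x → sym (same-class x) }
  where open Similar s

classified-equivalent : ∀ {n m} {G : Graph n} {H : Graph m} {R} (cG : Classified R G) (cH : Classified R H) Q →
  Large Q (Classified.class cH) (Classified.class cG) → Large Q (Classified.class cG) (Classified.class cH) →
  ∀ φ → rank φ ≤ Q → FOSat G [] φ ⇔ FOSat H [] φ
classified-equivalent {G = G} {H} {R} cG cH Q lH lG φ le = BackForth.preserved system φ le
  (ℕ.≤-reflexive (ℕ.+-identityʳ Q) , record { same-≡ = λ () ; same-class = λ () })
  where
  module G = Classified cG
  module H = Classified cH
  less : ∀ {q k} → suc q + k ≤ Q → k < Q
  less {q} le = ℕ.≤-trans (s≤s (ℕ.m≤n+m _ q)) le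
  next : ∀ {q k} → suc q + k ≤ Q → q + suc k ≤ Q
  next {q} {k} = subst (_≤ Q) (sym (ℕ.+-suc q k))
  system : BackForth G H
  system = record
    { Z = λ q {k} ρ τ → q + k ≤ Q × Similar cG cH ρ τ
    ; edges = λ {_} {_} {ρ} {τ} (_ , s) x y → let open Similar s in
        ⇔-sym (H.edge⇔ (lookup τ x) (lookup τ y)) ⇔-∘
        ((¬-⇔ (same-≡ x y) ×-⇔ mk⇔ (subst₂ R (same-class x) (same-class y)) (subst₂ R (sym (same-class x)) (sym (same-class y))))
        ⇔-∘ G.edge⇔ (lookup ρ x) (lookup ρ y))
    ; equal = λ (_ , s) → Similar.same-≡ s
    ; forth = λ (le , s) a → let b , s′ = extend-similar cG cH lH (less le) s a in b , next le , s′
    ; back  =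
        λ (le , s) b → let a , s′ = extend-similar cH cG lG (less le) (similar-sym s) b in a , next le , similar-sym s′
    }

-- Positions on two paths

-- With q rounds left, distances below w q are remembered exactly.

w : ℕ → ℕ
w zero    = 2
w (suc q) = w q + w q

-- Even with no round left, the distances 0 and 1 must be recognised, since they decide equality and
-- adjacency.
w≥2 : ∀ q → 2 ≤ w q
w≥2 zero    = ℕ.≤-refl
w≥2 (suc q) = ℕ.≤-trans (w≥2 q) (ℕ.m≤m+n _ _)

-- A pair holds one position on either path. Equal differences of any size count as near, so the
-- cases overlap and no bound on `e` has to be maintained.
data Sim (q : ℕ) : ℕ × ℕ → ℕ × ℕ → Set where
  near≤ : ∀ {a a′ b b′} e → b ≡ a + e → b′ ≡ a′ + e → Sim q (a , a′) (b , b′)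
  near≥ : ∀ {a a′ b b′} e → a ≡ b + e → a′ ≡ b′ + e → Sim q (a , a′) (b , b′)
  far<  : ∀ {a a′ b b′} → a + w q ≤ b → a′ + w q ≤ b′ → Sim q (a , a′) (b , b′)
  far>  : ∀ {a a′ b b′} → b + w q ≤ a → b′ + w q ≤ a′ → Sim q (a , a′) (b , b′)

Sim-sym : ∀ {q x y} → Sim q x y → Sim q y x
Sim-sym (near≤ e p q) = near≥ e p q
Sim-sym (near≥ e p q) = near≤ e p q
Sim-sym (far< p q)    = far> p q
Sim-sym (far> p q)    = far< p q

flip : ℕ × ℕ → ℕ × ℕ
flip (a , b) = b , a

Sim-flip : ∀ {q x y} → Sim q x y → Sim q (flip x) (flip y)
Sim-flip (near≤ e p q) = near≤ e q p
Sim-flip (near≥ e p q) = near≥ e q p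
Sim-flip (far< p q)    = far< q p
Sim-flip (far> p q)    = far> q p

Sim-refl : ∀ {q x} → Sim q x x
Sim-refl = near≤ 0 (sym (ℕ.+-identityʳ _)) (sym (ℕ.+-identityʳ _))

w-step : ∀ q x {y} → x + w (suc q) ≤ y → x + w q ≤ y
w-step q x = ℕ.≤-trans (ℕ.+-monoʳ-≤ x (ℕ.m≤m+n (w q) (w q)))

Sim-weaken : ∀ {q x y} → Sim (suc q) x y → Sim q x y
Sim-weaken (near≤ e p q) = near≤ e p q
Sim-weaken (near≥ e p q) = near≥ e p q
Sim-weaken {q₀} (far< p q) = far< (w-step q₀ _ p) (w-step q₀ _ q)
Sim-weaken {q₀} (far> p q) = far> (w-step q₀ _ p) (w-step q₀ _ q)

w-absurd : ∀ q {x y} → x + w q ≤ y → y ≤ x → ⊥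
w-absurd q {x} p r = ℕ.<⇒≱ (ℕ.m<m+n x (ℕ.≤-trans (s≤s z≤n) (w≥2 q))) (ℕ.≤-trans p r)

Sim-mono : ∀ {q a a′ b b′} → Sim q (a , a′) (b , b′) → a ≤ b → a′ ≤ b′
Sim-mono (near≤ e refl refl) le = ℕ.m≤m+n _ e
Sim-mono {b = b} {b′} (near≥ e refl refl) le =
  ℕ.≤-reflexive (trans (cong (b′ +_) (ℕ.n≤0⇒n≡0 (ℕ.+-cancelˡ-≤ b e 0 (ℕ.≤-trans le (ℕ.≤-reflexive (sym (ℕ.+-identityʳ b))))))) (ℕ.+-identityʳ b′))
Sim-mono (far< p q) le = ℕ.≤-trans (ℕ.m≤m+n _ _) q
Sim-mono {q} (far> p _) le = ⊥-elim (w-absurd q p le)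

Pairs : Set
Pairs = List (ℕ × ℕ)

AllSim : ℕ → Pairs → Set
AllSim q ps = ∀ {x y} → x ∈ ps → y ∈ ps → Sim q x y

best : ∀ {A : Set} {P : A → Set} {_≼_ : A → A → Set} → (∀ x → Dec (P x)) → (∀ x y → x ≼ y ⊎ y ≼ x) →
       (∀ {x y z} → x ≼ y → y ≼ z → x ≼ z) → ∀ xs →
       (∀ {y} → y ∈ xs → ¬ P y) ⊎ ∃ λ l → l ∈ xs × P l × (∀ {y} → y ∈ xs → P y → y ≼ l)
best P? total trans [] = inj₁ λ ()
best {_≼_ = _≼_} P? total trans (x ∷ xs) with P? x | best {_≼_ = _≼_} P? total trans xs
... | no ¬p | inj₁ none = inj₁ λ { (here refl) → ¬p ; (there y∈) → none y∈ }
... | no ¬p | inj₂ (l , l∈ , pl , max) =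
  inj₂ (l , there l∈ , pl , λ { (here refl) p → ⊥-elim (¬p p) ; (there y∈) p → max y∈ p })
... | yes p | inj₁ none =
  inj₂ (x , here refl , p , λ { (here refl) _ → [ id , id ] (total x x) ; (there y∈) q → ⊥-elim (none y∈ q) })
... | yes p | inj₂ (l , l∈ , pl , max) with total x l
...   | inj₁ x≼l = inj₂ (l , there l∈ , pl , λ { (here refl) _ → x≼l ; (there y∈) q → max y∈ q })
...   | inj₂ l≼x =
  inj₂ (x , here refl , p , λ { (here refl) _ → [ id , id ] (total x x) ; (there y∈) q → trans (max y∈ q) l≼x })

-- The nearest pebbles `l` and `r` around the new position `a` decide. Within distance `w q` of one
-- of them, `a′` copies the exact offset from it; otherwise `a′` is put `w q` after `l′`. It then
-- stays `w q` away from `r′`, because `w` doubles with each round.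
module Between {q} {ps : Pairs} (sim : AllSim (suc q) ps) {a l l′ r r′ : ℕ} (l∈ : (l , l′) ∈ ps) (r∈ : (r , r′) ∈ ps)
               (l≤a : l ≤ a) (a<r : a < r)
               (max : ∀ {y} → y ∈ ps → proj₁ y ≤ a → proj₁ y ≤ l) (min : ∀ {y} → y ∈ ps → a < proj₁ y → r ≤ proj₁ y) where

  private
    W = w q

    +-≤ : ∀ x {y e} → y ≡ x + e → x ≤ y
    +-≤ x refl = ℕ.m≤m+n x _

    double : ∀ x {y} → x + w (suc q) ≤ y → (x + W) + W ≤ y
    double x = ℕ.≤-trans (ℕ.≤-reflexive (ℕ.+-assoc x W W))

    l<r : l ≤ r
    l<r = ℕ.≤-trans l≤a (ℕ.<⇒≤ a<r)

    Found : Set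
    Found = ∃ λ a′ → ∀ {y} → y ∈ ps → Sim q y (a , a′)

    below-or-above : ∀ p → p ≤ a ⊎ a < p
    below-or-above p = case p ℕ.≤? a of λ { (yes le) → inj₁ le ; (no n) → inj₂ (ℕ.≰⇒> n) }

    near-l : ∀ e → a ≡ l + e → e < W → Found
    near-l e refl e<W = l′ + e , λ {y} y∈ → case below-or-above (proj₁ y) of λ where
        (inj₁ le) → below y∈ (max y∈ le)
        (inj₂ lt) → above y∈ lt
      where
      below : ∀ {y} → y ∈ ps → proj₁ y ≤ l → Sim q y (l + e , l′ + e)
      below y∈ p≤l with sim y∈ l∈
      ... | near≤ f refl refl = near≤ (f + e) (ℕ.+-assoc _ f e) (ℕ.+-assoc _ f e)
      ... | near≥ f refl refl with ℕ.n≤0⇒n≡0 (ℕ.+-cancelˡ-≤ l f 0 (ℕ.≤-trans p≤l (ℕ.≤-reflexive (sym (ℕ.+-identityʳ l)))))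
      ...   | refl = near≤ e (cong (_+ e) (sym (ℕ.+-identityʳ l))) (cong (_+ e) (sym (ℕ.+-identityʳ l′)))
      below {p , p′} y∈ p≤l | far< u v =
        far< (ℕ.≤-trans (w-step q p u) (ℕ.m≤m+n l e)) (ℕ.≤-trans (w-step q p′ v) (ℕ.m≤m+n l′ e))
      below y∈ p≤l | far> u v = ⊥-elim (w-absurd (suc q) u p≤l)
      above : ∀ {y} → y ∈ ps → l + e < proj₁ y → Sim q y (l + e , l′ + e)
      above {p , p′} y∈ lt with sim l∈ y∈
      ... | near≤ f refl refl = near≥ (f ∸ e) (shift l) (shift l′)
        where
        e≤f : e ≤ f
        e≤f = ℕ.+-cancelˡ-≤ l e f (ℕ.<⇒≤ lt)
        shift : ∀ x → x + f ≡ x + e + (f ∸ e)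
        shift x = trans (cong (x +_) (sym (ℕ.m+[n∸m]≡n e≤f))) (sym (ℕ.+-assoc x e (f ∸ e)))
      ... | near≥ f eq _ = ⊥-elim (ℕ.<⇒≱ lt (ℕ.≤-trans (+-≤ p eq) (ℕ.m≤m+n l e)))
      ... | far< u v = far> (push l u) (push l′ v)
        where
        push : ∀ x {y} → x + w (suc q) ≤ y → x + e + W ≤ y
        push x u = ℕ.≤-trans (ℕ.+-monoˡ-≤ W (ℕ.+-monoʳ-≤ x (ℕ.<⇒≤ e<W))) (double x u)
      ... | far> u v = ⊥-elim (w-absurd (suc q) u (ℕ.≤-trans (ℕ.m≤m+n l e) (ℕ.<⇒≤ lt)))

    near-r : ∀ e a′ → r ≡ a + e → r′ ≡ a′ + e → e < W → Found
    near-r e a′ r≡ r′≡ e<W = a′ , λ {y} y∈ → case below-or-above (proj₁ y) of λ where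
        (inj₁ le) → below y∈ le
        (inj₂ lt) → above y∈ (min y∈ lt)
      where
      above : ∀ {y} → y ∈ ps → r ≤ proj₁ y → Sim q y (a , a′)
      above {p , p′} y∈ r≤p with sim r∈ y∈
      ... | near≤ f refl refl =
        near≥ (e + f) (trans (cong (_+ f) r≡) (ℕ.+-assoc a e f)) (trans (cong (_+ f) r′≡) (ℕ.+-assoc a′ e f))
      ... | near≥ f refl refl with ℕ.n≤0⇒n≡0 (ℕ.+-cancelˡ-≤ p f 0 (ℕ.≤-trans r≤p (ℕ.≤-reflexive (sym (ℕ.+-identityʳ p)))))
      ...   | refl = near≥ e (trans (sym (ℕ.+-identityʳ p)) r≡) (trans (sym (ℕ.+-identityʳ p′)) r′≡)
      above {p , p′} y∈ r≤p | far< u v = far>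
        (ℕ.≤-trans (ℕ.+-monoˡ-≤ W (+-≤ a r≡)) (w-step q r u)) (ℕ.≤-trans (ℕ.+-monoˡ-≤ W (+-≤ a′ r′≡)) (w-step q r′ v))
      above y∈ r≤p | far> u v = ⊥-elim (w-absurd (suc q) u r≤p)
      below : ∀ {y} → y ∈ ps → proj₁ y ≤ a → Sim q y (a , a′)
      below {p , p′} y∈ p≤a with sim y∈ r∈
      ... | near≤ f eq eq′ =
        near≤ (f ∸ e) (unshift a (trans (sym r≡) eq)) (unshift a′ (trans (sym r′≡) eq′))
        where
        e≤f : e ≤ f
        e≤f = ℕ.+-cancelˡ-≤ p e f (ℕ.≤-trans (ℕ.+-monoˡ-≤ e p≤a) (ℕ.≤-reflexive (trans (sym r≡) eq)))
        unshift : ∀ x {y} → x + e ≡ y + f → x ≡ y + (f ∸ e)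
        unshift x {y} eq =
          ℕ.+-cancelʳ-≡ e x _ (trans eq (trans (cong (y +_) (sym (ℕ.m∸n+n≡m e≤f))) (sym (ℕ.+-assoc y (f ∸ e) e))))
      ... | near≥ f eq _ = ⊥-elim (ℕ.<⇒≱ a<r (ℕ.≤-trans (+-≤ r eq) p≤a))
      ... | far< u v = far< (pull p u r≡) (pull p′ v r′≡)
        where
        pull : ∀ x {y z} → x + w (suc q) ≤ y → y ≡ z + e → x + W ≤ z
        pull x {z = z} u refl =
          ℕ.+-cancelʳ-≤ W (x + W) z (ℕ.≤-trans (double x u) (ℕ.+-monoʳ-≤ z (ℕ.<⇒≤ e<W)))
      ... | far> u v = ⊥-elim (w-absurd (suc q) u (ℕ.≤-trans p≤a (ℕ.<⇒≤ a<r)))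

    middle : l + W ≤ a → a + W ≤ r → Found
    middle l≪a a≪r = l′ + W , λ {y} y∈ → case below-or-above (proj₁ y) of λ where
        (inj₁ le) → let p≤l = max y∈ le in
          far< (ℕ.≤-trans (ℕ.+-monoˡ-≤ W p≤l) l≪a) (ℕ.+-monoˡ-≤ W (Sim-mono (sim y∈ l∈) p≤l))
        (inj₂ lt) → let r≤p = min y∈ lt in
          far> (ℕ.≤-trans a≪r r≤p) (ℕ.≤-trans gap (Sim-mono (sim r∈ y∈) r≤p))
      where
      gap : l′ + W + W ≤ r′
      gap with sim l∈ r∈
      ... | near≤ f refl refl =
        ℕ.≤-trans (ℕ.≤-reflexive (ℕ.+-assoc l′ W W)) (ℕ.+-monoʳ-≤ l′ (ℕ.+-cancelˡ-≤ l (W + W) f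
        (ℕ.≤-trans (ℕ.≤-reflexive (sym (ℕ.+-assoc l W W))) (ℕ.≤-trans (ℕ.+-monoˡ-≤ W l≪a) a≪r))))
      ... | near≥ f eq _ = ⊥-elim (ℕ.<⇒≱ a<r (ℕ.≤-trans (+-≤ r eq) l≤a))
      ... | far< u v = double l′ v
      ... | far> u v = ⊥-elim (w-absurd (suc q) u l<r)

    left-of-r : ∀ e → r ≡ a + e → e < W → ∃ λ a′ → r′ ≡ a′ + e
    left-of-r e r≡ e<W = r′ ∸ e , sym (ℕ.m∸n+n≡m e≤r′)
      where
      e≤r′ : e ≤ r′
      e≤r′ with sim l∈ r∈
      ... | near≤ f eq refl =
        ℕ.≤-trans (ℕ.+-cancelˡ-≤ l e f (ℕ.≤-trans (ℕ.+-monoˡ-≤ e l≤a) (ℕ.≤-reflexive (trans (sym r≡) eq)))) (ℕ.m≤n+m f l′)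
      ... | near≥ f eq _ = ⊥-elim (ℕ.<⇒≱ a<r (ℕ.≤-trans (+-≤ r eq) l≤a))
      ... | far< u v = ℕ.≤-trans (ℕ.<⇒≤ e<W) (ℕ.≤-trans (ℕ.m≤n+m W l′) (w-step q l′ v))
      ... | far> u v = ⊥-elim (w-absurd (suc q) u l<r)

  found : ∃ λ a′ → ∀ {y} → y ∈ ps → Sim q y (a , a′)
  found with a ℕ.<? l + W | r ℕ.<? a + W
  ... | yes lt | _ =
    near-l (a ∸ l) (sym (ℕ.m+[n∸m]≡n l≤a)) (ℕ.+-cancelˡ-< l _ _ (subst (_< l + W) (sym (ℕ.m+[n∸m]≡n l≤a)) lt))
  ... | no _ | yes lt =
    let e≡ = sym (ℕ.m+[n∸m]≡n (ℕ.<⇒≤ a<r))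
        e<W = ℕ.+-cancelˡ-< a _ _ (subst (_< a + W) e≡ lt)
        a′ , r′≡ = left-of-r (r ∸ a) e≡ e<W
    in near-r (r ∸ a) a′ e≡ r′≡ e<W
  ... | no p | no q = middle (ℕ.≮⇒≥ p) (ℕ.≮⇒≥ q)

AllSim-extend : ∀ {q} {ps : Pairs} → AllSim (suc q) ps → ∀ {a x y} → x ∈ ps → y ∈ ps → proj₁ x ≤ a →
  a < proj₁ y →
                ∃ λ a′ → AllSim q ((a , a′) ∷ ps)
AllSim-extend {q} {ps} sim {a} x∈ y∈ x≤a a<y
  with best {_≼_ = λ u v → proj₁ u ≤ proj₁ v} (λ z → proj₁ z ℕ.≤? a) (λ u v → ℕ.≤-total _ _) ℕ.≤-trans ps
     | best {_≼_ = λ u v → proj₁ v ≤ proj₁ u} (λ z → a ℕ.<? proj₁ z) (λ u v → ℕ.≤-total _ _) (λ p q → ℕ.≤-trans q p) ps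
... | inj₁ none | _ = ⊥-elim (none x∈ x≤a)
... | inj₂ _ | inj₁ none = ⊥-elim (none y∈ a<y)
... | inj₂ (l , l∈ , l≤a , max) | inj₂ (r , r∈ , a<r , min) = a′ , λ where
    (here refl) (here refl) → Sim-refl
    (here refl) (there v∈)  → Sim-sym (new v∈)
    (there u∈)  (here refl) → new u∈
    (there u∈)  (there v∈)  → Sim-weaken (sim u∈ v∈)
  where
  f = Between.found sim l∈ r∈ l≤a a<r max min
  a′ = proj₁ f
  new : ∀ {y} → y ∈ ps → Sim q y (a , a′)
  new = proj₂ f

AllSim-flip : ∀ {q ps} → AllSim q ps → AllSim q (List.map flip ps)
AllSim-flip sim x∈ y∈ with ∈-map⁻ flip x∈ | ∈-map⁻ flip y∈
... | _ , u∈ , refl | _ , v∈ , refl = Sim-flip (sim u∈ v∈)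

record PathOrder {n} (G : Graph n) (L : ℕ) : Set where
  field
    pos     : Fin n → ℕ
    pos-inj : ∀ {u v} → pos u ≡ pos v → u ≡ v
    pos-<   : ∀ v → pos v < L
    pos-sur : ∀ {i} → i < L → ∃ λ v → pos v ≡ i
    edge⇔   : ∀ u v → E G u v ⇔ (pos v ≡ suc (pos u) ⊎ pos u ≡ suc (pos v))

module _ {n m} {G : Graph n} {H : Graph m} {L M} (pG : PathOrder G L) (pH : PathOrder H M) where
  private
    module G = PathOrder pG
    module H = PathOrder pH

  -- The sentinels at both ends make the position of a pebble relative to
  -- the end points part of the similarity type.
  positions : ∀ {k} → Vec (Fin n) k → Vec (Fin m) k → Pairs
  positions []      []      = (0 , 0) ∷ (suc L , suc M) ∷ []
  positions (u ∷ ρ) (v ∷ τ) = (suc (G.pos u) , suc (H.pos v)) ∷ positions ρ τ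

  first∈ : ∀ {k} (ρ : Vec _ k) τ → (0 , 0) ∈ positions ρ τ
  first∈ []      []      = here refl
  first∈ (_ ∷ ρ) (_ ∷ τ) = there (first∈ ρ τ)

  last∈ : ∀ {k} (ρ : Vec _ k) τ → (suc L , suc M) ∈ positions ρ τ
  last∈ []      []      = there (here refl)
  last∈ (_ ∷ ρ) (_ ∷ τ) = there (last∈ ρ τ)

  pebble∈ : ∀ {k} (ρ : Vec _ k) τ x →
    (suc (G.pos (lookup ρ x)) , suc (H.pos (lookup τ x))) ∈ positions ρ τ
  pebble∈ (_ ∷ ρ) (_ ∷ τ) zero    = here refl
  pebble∈ (_ ∷ ρ) (_ ∷ τ) (suc x) = there (pebble∈ ρ τ x)

  -- Similarity to the sentinels forces `a′` strictly between 0 and `suc M`, so it is the shifted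
  -- position of an actual vertex.
  forth-step : ∀ {q k} (ρ : Vec _ k) τ → AllSim (suc q) (positions ρ τ) → ∀ a →
               ∃ λ b → AllSim q (positions (a ∷ ρ) (b ∷ τ))
  forth-step {q} ρ τ sim a with AllSim-extend sim (first∈ ρ τ) (last∈ ρ τ) z≤n (s≤s (G.pos-< a))
  ... | a′ , sim′ with between (sim′ (there (first∈ ρ τ)) (here refl)) (sim′ (here refl) (there (last∈ ρ τ)))
    where
    between : Sim q (0 , 0) (suc (G.pos a) , a′) → Sim q (suc (G.pos a) , a′) (suc L , suc M) →
      ∃ λ i → a′ ≡ suc i × i < M
    between s t with positive s | bounded t
      where
      positive : Sim q (0 , 0) (suc (G.pos a) , a′) → ∃ λ i → a′ ≡ suc i
      positive (near≤ _ refl refl) = _ , refl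
      positive (far< _ v) = predecessor (ℕ.≤-trans (w≥2 q) v)
        where
        predecessor : ∀ {x} → 2 ≤ x → ∃ λ i → x ≡ suc i
        predecessor (s≤s _) = _ , refl
      bounded : Sim q (suc (G.pos a) , a′) (suc L , suc M) → a′ ≤ M
      bounded (near≤ zero eq _) =
        ⊥-elim (ℕ.<⇒≢ (G.pos-< a) (sym (trans (ℕ.suc-injective eq) (ℕ.+-identityʳ _))))
      bounded (near≤ (suc e) _ eq) =
        ℕ.≤-pred (ℕ.≤-trans (s≤s (ℕ.m≤m+n a′ e)) (ℕ.≤-reflexive (sym (trans eq (ℕ.+-suc a′ e)))))
      bounded (near≥ e eq _) =
        ⊥-elim (ℕ.<⇒≱ (G.pos-< a) (ℕ.≤-trans (ℕ.m≤m+n L e) (ℕ.≤-reflexive (sym (ℕ.suc-injective eq)))))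
      bounded (far< _ v) = ℕ.≤-pred (ℕ.≤-trans (ℕ.≤-reflexive (sym (ℕ.+-comm a′ 1)))
        (ℕ.≤-trans (ℕ.+-monoʳ-≤ a′ (ℕ.≤-trans (s≤s z≤n) (w≥2 q))) v))
      bounded (far> u _) = ⊥-elim (w-absurd q u (s≤s (ℕ.<⇒≤ (G.pos-< a))))
    ... | i , refl | le = i , refl , le
  ...   | i , refl , i<M with H.pos-sur i<M
  ...     | b , refl = b , sim′

  edge-step : ∀ {q u v u′ v′} → Sim q (suc (G.pos u) , suc (H.pos u′)) (suc (G.pos v) , suc (H.pos v′)) →
              E G u v → E H u′ v′
  edge-step {q} {u} {v} {u′} {v′} s e = from (H.edge⇔ u′ v′) (transfer s (to (G.edge⇔ u v) e))
    where
    transfer : ∀ {a a′ b b′} → Sim q (suc a , suc a′) (suc b , suc b′) → b ≡ suc a ⊎ a ≡ suc b →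
      b′ ≡ suc a′ ⊎ a′ ≡ suc b′
    one : ∀ {a b e} → suc b ≡ suc a + e → b ≡ suc a → e ≡ 1
    one {a} eq refl = sym (ℕ.+-cancelˡ-≡ a 1 _ (trans (ℕ.+-comm a 1) (ℕ.suc-injective eq)))
    step : ∀ {a b e} → suc b ≡ suc a + e → e ≡ 1 → b ≡ suc a
    step {a} eq refl = trans (ℕ.suc-injective eq) (ℕ.+-comm a 1)
    contra : ∀ {a b e} → suc a ≡ suc b + e → b ≡ suc a → ⊥
    contra {a} {b} {e} eq refl =
      ℕ.<⇒≱ (ℕ.n<1+n (suc a)) (ℕ.≤-trans (ℕ.m≤m+n (suc (suc a)) e) (ℕ.≤-reflexive (sym eq)))
    tooFar : ∀ {a b} → suc a + w q ≤ suc b → b ≡ suc a → ⊥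
    tooFar {a} le refl =
      ℕ.<⇒≱ (ℕ.+-monoʳ-< (suc a) (w≥2 q)) (ℕ.≤-trans le (ℕ.≤-reflexive (ℕ.+-comm 1 (suc a))))
    tooFar> : ∀ {a b} → suc b + w q ≤ suc a → b ≡ suc a → ⊥
    tooFar> le refl = w-absurd q le (s≤s (ℕ.n≤1+n _))
    transfer (near≤ e p p′) (inj₁ eq) = inj₁ (step p′ (one p eq))
    transfer (near≤ e p p′) (inj₂ eq) = ⊥-elim (contra p eq)
    transfer (near≥ e p p′) (inj₁ eq) = ⊥-elim (contra p eq)
    transfer (near≥ e p p′) (inj₂ eq) = inj₂ (step p′ (one p eq))
    transfer (far< p _) (inj₁ eq) = ⊥-elim (tooFar p eq)
    transfer (far< p _) (inj₂ eq) = ⊥-elim (tooFar> p eq)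
    transfer (far> p _) (inj₁ eq) = ⊥-elim (tooFar> p eq)
    transfer (far> p _) (inj₂ eq) = ⊥-elim (tooFar p eq)

  equal-step : ∀ {q u v u′ v′} →
    Sim q (suc (G.pos u) , suc (H.pos u′)) (suc (G.pos v) , suc (H.pos v′)) →
               u ≡ v → u′ ≡ v′
  equal-step s refl =
    H.pos-inj (ℕ.suc-injective (ℕ.≤-antisym (Sim-mono s ℕ.≤-refl) (Sim-mono (Sim-sym s) ℕ.≤-refl)))

positions-flip : ∀ {n m} {G : Graph n} {H : Graph m} {L M} (pG : PathOrder G L) (pH : PathOrder H M) {k} (ρ : Vec _ k) τ →
                 List.map flip (positions pG pH ρ τ) ≡ positions pH pG τ ρ
positions-flip pG pH []      []      = refl
positions-flip pG pH (_ ∷ ρ) (_ ∷ τ) = cong (_ ∷_) (positions-flip pG pH ρ τ)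

path-equivalent : ∀ {n m} {G : Graph n} {H : Graph m} {L M} → PathOrder G L → PathOrder H M → ∀ q →
  w q ≤ L → w q ≤ M →
                  ∀ φ → rank φ ≤ q → FOSat G [] φ ⇔ FOSat H [] φ
path-equivalent {G = G} {H} {L} {M} pG pH q wL wM φ le = BackForth.preserved system φ le start
  where
  flipped : ∀ {q k} (ρ : Vec _ k) τ → AllSim q (positions pG pH ρ τ) → AllSim q (positions pH pG τ ρ)
  flipped ρ τ sim = subst (AllSim _) (positions-flip pG pH ρ τ) (AllSim-flip sim)
  unflipped : ∀ {q k} (ρ : Vec _ k) τ → AllSim q (positions pH pG τ ρ) → AllSim q (positions pG pH ρ τ)
  unflipped ρ τ sim = subst (AllSim _) (positions-flip pH pG τ ρ) (AllSim-flip sim)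
  start : AllSim q (positions pG pH [] [])
  start (here refl) (here refl) = Sim-refl
  start (here refl) (there (here refl)) = far< (ℕ.m≤n⇒m≤1+n wL) (ℕ.m≤n⇒m≤1+n wM)
  start (there (here refl)) (here refl) = far> (ℕ.m≤n⇒m≤1+n wL) (ℕ.m≤n⇒m≤1+n wM)
  start (there (here refl)) (there (here refl)) = Sim-refl
  system : BackForth G H
  system = record
    { Z = λ q ρ τ → AllSim q (positions pG pH ρ τ)
    ; edges = λ {_} {_} {ρ} {τ} sim x y → mk⇔
        (edge-step pG pH (sim (pebble∈ pG pH ρ τ x) (pebble∈ pG pH ρ τ y)))
        (edge-step pH pG (flipped ρ τ sim (pebble∈ pH pG τ ρ x) (pebble∈ pH pG τ ρ y)))
    ; equal = λ {_} {_} {ρ} {τ} sim x y → mk⇔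
        (equal-step pG pH (sim (pebble∈ pG pH ρ τ x) (pebble∈ pG pH ρ τ y)))
        (equal-step pH pG (flipped ρ τ sim (pebble∈ pH pG τ ρ x) (pebble∈ pH pG τ ρ y)))
    ; forth = λ {_} {_} {ρ} {τ} sim a → forth-step pG pH ρ τ sim a
    ; back  = λ {_} {_} {ρ} {τ} sim b → let a , sim′ = forth-step pH pG τ ρ (flipped ρ τ sim) b in
        a , unflipped (a ∷ ρ) (b ∷ τ) sim′
    }

-- The sentence that a graph has a perfect matching

related : ∀ {k} → Fin k → Fin k → SOFormula (2 ∷ []) k
related x y = rel (here refl) (x ∷ y ∷ [])

-- Guardedness confines the matching to edges without a conjunct to this effect. It permits loops,
-- however, which the last conjunct excludes.
perfectMatching : SOFormula [] 0
perfectMatching = ∃² 2 ∙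
  (∀′ ∃′ related (suc zero) zero) ∧′
  (∀′ ∀′ ∀′ (¬′ (related (suc (suc zero)) (suc zero) ∧′ related (suc (suc zero)) zero) ∨′ suc zero ≐ zero)) ∧′
  (∀′ ∀′ (¬′ related (suc zero) zero ∨′ related zero (suc zero))) ∧′
  (∀′ ¬′ related zero zero)

module _ {n} (G : Graph n) where

  matching⇒involution : GSOSat G [] [] perfectMatching →
                        ∃ λ (f : Fin n → Fin n) → (∀ v → f (f v) ≡ v) × (∀ v → f v ≢ v)
  matching⇒involution (R , _ , total , functional , symmetric , irreflexive) = f , invol , fixfree
    where
    f : Fin n → Fin n
    f v = proj₁ (total v)
    resolve : ∀ {A B : Set} → ¬ A ⊎ B → A → B
    resolve (inj₁ n) a = ⊥-elim (n a)
    resolve (inj₂ b) _ = b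
    invol : ∀ v → f (f v) ≡ v
    invol v = resolve (functional (f v) (f (f v)) v)
      (proj₂ (total (f v)) , resolve (symmetric v (f v)) (proj₂ (total v)))
    fixfree : ∀ v → f v ≢ v
    fixfree v eq = irreflexive v (subst (λ x → T (R (v ∷ x ∷ []))) eq (proj₂ (total v)))

  involution⇒matching : (f : Fin n → Fin n) → (∀ v → f (f v) ≡ v) → (∀ v → E G v (f v)) →
    GSOSat G [] [] perfectMatching
  involution⇒matching f invol adj = R , guarded ,
    (λ v → f v , toT refl) ,
    (λ u v w → implies (T? _ ×-dec T? _) λ (p , q) → trans (sym (fromT {u} {v} p)) (fromT q)) ,
    (λ u v → implies (T? _) λ p → toT (trans (cong f (sym (fromT {u} {v} p))) (invol u))) ,
    λ v p → E-irrefl G (sym (fromT p)) (adj v)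
    where
    R : Relation n 2
    R (u ∷ v ∷ []) = does (f u Fin.≟ v)
    toT : ∀ {u v} → f u ≡ v → T (R (u ∷ v ∷ []))
    toT {u} {v} eq = subst T (sym (Dec.dec-true (f u Fin.≟ v) eq)) tt
    fromT : ∀ {u v} → T (R (u ∷ v ∷ [])) → f u ≡ v
    fromT {u} {v} p with f u Fin.≟ v
    ... | yes eq = eq
    implies : ∀ {A B : Set} → Dec A → (A → B) → ¬ A ⊎ B
    implies (yes a) h = inj₂ (h a)
    implies (no ¬a) h = inj₁ ¬a
    guarded : Guarded G R
    guarded = Guard⇒Guarded G {R = R} guard
      where
      guard : ∀ t → T (R t) → ∀ {u v} → u Vec.∈ t → v Vec.∈ t → u ≢ v → E G u v
      guard (x ∷ y ∷ []) p (VecAny.here refl) (VecAny.here refl) u≢v = ⊥-elim (u≢v refl)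
      guard (x ∷ y ∷ []) p (VecAny.here refl) (VecAny.there (VecAny.here refl)) u≢v =
        subst (E G x) (fromT p) (adj x)
      guard (x ∷ y ∷ []) p (VecAny.there (VecAny.here refl)) (VecAny.here refl) u≢v =
        E-sym G (subst (E G x) (fromT p) (adj x))
      guard (x ∷ y ∷ []) p (VecAny.there (VecAny.here refl)) (VecAny.there (VecAny.here refl)) u≢v =
        ⊥-elim (u≢v refl)

-- Involutions without fixed points

─-⊆ : ∀ {A : Set} {x y : A} {xs} (p : x ∈ xs) → y ∈ xs ─ p → y ∈ xs
─-⊆ (here refl) y∈         = there y∈
─-⊆ (there p)   (here eq)  = here eq
─-⊆ (there p)   (there y∈) = there (─-⊆ p y∈)

∈-─ : ∀ {A : Set} {x y : A} {xs} (p : x ∈ xs) → y ∈ xs → y ≢ x → y ∈ xs ─ p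
∈-─ (here refl) (here eq)  neq = ⊥-elim (neq eq)
∈-─ (here refl) (there y∈) neq = y∈
∈-─ (there p)   (here eq)  neq = here eq
∈-─ (there p)   (there y∈) neq = there (∈-─ p y∈ neq)

─-All : ∀ {A : Set} {P : A → Set} {x : A} {xs} (p : x ∈ xs) → All P xs → All P (xs ─ p)
─-All p ps = All.tabulate λ y∈ → All.lookup ps (─-⊆ p y∈)

─-unique : ∀ {A : Set} {x : A} {xs} (p : x ∈ xs) → Unique xs → Unique (xs ─ p)
─-unique (here refl) (_ ∷ u)  = u
─-unique (there p)   (ne ∷ u) = ─-All p ne ∷ ─-unique p u

─-≢ : ∀ {A : Set} {x y : A} {xs} (p : x ∈ xs) → Unique xs → y ∈ xs ─ p → y ≢ x
─-≢ (here refl) (ne ∷ _) y∈          eq   = All.lookup ne y∈ (sym eq)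
─-≢ (there p)   (ne ∷ _) (here refl) refl = All.lookup ne p refl
─-≢ (there p)   (_ ∷ u)  (there y∈)  eq   = ─-≢ p u y∈ eq

Even : ℕ → Set
Even m = ∃ λ k → m ≡ k + k

-- The first element is removed together with its image, which differs from it. The bound `m` drives
-- the recursion, as `xs ─ p` is not a subterm.
involution-even : ∀ {A : Set} (f : A → A) → (∀ v → f (f v) ≡ v) → (∀ v → f v ≢ v) → ∀ m (xs : List A) →
  length xs ≤ m →
                  Unique xs → (∀ {v} → v ∈ xs → f v ∈ xs) → Even (length xs)
involution-even f invol fixfree m [] le u closed = 0 , refl
involution-even f invol fixfree (suc m) (x ∷ xs) (s≤s le) (ne ∷ u) closed = step (closed (here refl))
  where
  f-inj : ∀ {y z} → f y ≡ f z → y ≡ z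
  f-inj {y} {z} eq = trans (sym (invol y)) (trans (cong f eq) (invol z))
  step : f x ∈ x ∷ xs → Even (length (x ∷ xs))
  step (here eq) = ⊥-elim (fixfree x eq)
  step (there p) with involution-even f invol fixfree m (xs ─ p)
      (ℕ.≤-trans (ℕ.n≤1+n _) (ℕ.≤-trans (ℕ.≤-reflexive (sym (List.length-removeAt′ xs (Any.index p)))) le)) (─-unique p u) closed′
    where
    closed′ : ∀ {v} → v ∈ xs ─ p → f v ∈ xs ─ p
    closed′ {v} v∈ with closed (there (─-⊆ p v∈))
    ... | here eq = ⊥-elim (─-≢ p u v∈ (f-inj (trans eq (sym (invol x)))))
    ... | there q = ∈-─ p q λ eq → All.lookup ne (─-⊆ p v∈) (sym (f-inj eq))
  ... | k , eq =
    suc k , cong suc (trans (List.length-removeAt′ xs (Any.index p)) (trans (cong suc eq) (sym (ℕ.+-suc k k))))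

even≢odd : ∀ k l → k + k ≢ suc (l + l)
even≢odd (suc k) (suc l) eq = even≢odd k l (ℕ.suc-injective (ℕ.suc-injective
  (trans (cong suc (sym (ℕ.+-suc k k))) (trans eq (cong (λ m → suc (suc m)) (ℕ.+-suc l l))))))
even≢odd (suc k) zero eq = case trans (sym (ℕ.+-suc k k)) (ℕ.suc-injective eq) of λ ()

odd⇒¬matching : ∀ {n} (G : Graph n) xs → Unique xs → (∀ v → v ∈ xs) → ∀ k → length xs ≡ suc (k + k) →
                ¬ GSOSat G [] [] perfectMatching
odd⇒¬matching G xs u covers k len s with matching⇒involution G s
... | f , invol , fixfree with involution-even f invol fixfree (length xs) xs ℕ.≤-refl u (λ {v} _ → covers (f v))
...   | l , eq = even≢odd l k (trans (sym eq) len)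

-- Lists of pairs of adjacent vertices

data Match {n} (G : Graph n) : List (Fin n) → Set where
  []   : Match G []
  pair : ∀ {x y xs} → E G x y → Match G xs → Match G (x ∷ y ∷ xs)

linked-match : ∀ {n} {G : Graph n} k xs → length xs ≡ k + k → Linked (E G) xs → Match G xs
linked-match zero    []           _  _ = []
linked-match (suc k) (x ∷ [])     eq _ rewrite ℕ.+-suc k k = case eq of λ ()
linked-match (suc k) (x ∷ y ∷ xs) eq (e ∷ l) = pair e (linked-match k xs
  (ℕ.suc-injective (trans (ℕ.suc-injective eq) (ℕ.+-suc k k))) (Linked.tail l))

module _ {n} {G : Graph n} where

  partner : ∀ {xs} → Match G xs → Fin n → Fin n
  partner [] v = v
  partner (pair {x} {y} _ m) v with v Fin.≟ x | v Fin.≟ y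
  ... | yes _ | _     = y
  ... | no _  | yes _ = x
  ... | no _  | no _  = partner m v

  partner-∈ : ∀ {xs} (m : Match G xs) {v} → v ∈ xs → partner m v ∈ xs
  partner-∈ (pair {x} {y} _ m) {v} v∈ with v Fin.≟ x | v Fin.≟ y
  ... | yes _ | _     = there (here refl)
  ... | no _  | yes _ = here refl
  partner-∈ (pair _ m) (here eq)          | no p | no _ = ⊥-elim (p eq)
  partner-∈ (pair _ m) (there (here eq))  | no _ | no q = ⊥-elim (q eq)
  partner-∈ (pair _ m) (there (there v∈)) | no _ | no _ = there (there (partner-∈ m v∈))

  partner-E : ∀ {xs} (m : Match G xs) {v} → v ∈ xs → E G v (partner m v)
  partner-E (pair {x} {y} e m) {v} v∈ with v Fin.≟ x | v Fin.≟ y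
  ... | yes refl | _     = e
  ... | no _  | yes refl = E-sym G e
  partner-E (pair _ m) (here eq)          | no p | no _ = ⊥-elim (p eq)
  partner-E (pair _ m) (there (here eq))  | no _ | no q = ⊥-elim (q eq)
  partner-E (pair _ m) (there (there v∈)) | no _ | no _ = partner-E m v∈

  partner-x : ∀ {x y xs} {e : E G x y} (m : Match G xs) → partner (pair e m) x ≡ y
  partner-x {x} {y} m with x Fin.≟ x | x Fin.≟ y
  ... | yes _ | _ = refl
  ... | no n  | _ = ⊥-elim (n refl)

  partner-y : ∀ {x y xs} {e : E G x y} (m : Match G xs) → partner (pair e m) y ≡ x
  partner-y {x} {y} m with y Fin.≟ x | y Fin.≟ y
  ... | yes y≡x | _    = y≡x
  ... | no _  | yes _  = refl
  ... | no _  | no n   = ⊥-elim (n refl)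

  partner-other : ∀ {x y xs} {e : E G x y} (m : Match G xs) {v} → v ≢ x → v ≢ y →
    partner (pair e m) v ≡ partner m v
  partner-other {x} {y} m {v} p q with v Fin.≟ x | v Fin.≟ y
  ... | yes eq | _      = ⊥-elim (p eq)
  ... | no _   | yes eq = ⊥-elim (q eq)
  ... | no _   | no _   = refl

  partner-involutive : ∀ {xs} (m : Match G xs) → Unique xs → ∀ {v} → v ∈ xs → partner m (partner m v) ≡ v
  partner-involutive m₀@(pair {x} {y} e m) ((_ ∷ x∉) ∷ (y∉ ∷ u)) v∈ = go v∈
    where
    go : ∀ {v} → v ∈ _ → partner m₀ (partner m₀ v) ≡ v
    go (here refl)         = trans (cong (partner m₀) (partner-x {e = e} m)) (partner-y {e = e} m)
    go (there (here refl)) = trans (cong (partner m₀) (partner-y {e = e} m)) (partner-x {e = e} m)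
    go {v} (there (there v∈)) =
      trans (cong (partner m₀) (other v∈)) (trans (other (partner-∈ m v∈)) (partner-involutive m u v∈))
      where
      other : ∀ {v} → v ∈ _ → partner m₀ v ≡ partner m v
      other v∈ =
        partner-other {e = e} m (λ eq → All.lookup x∉ v∈ (sym eq)) (λ eq → All.lookup y∉ v∈ (sym eq))

  match⇒matching : ∀ {xs} → Match G xs → Unique xs → (∀ v → v ∈ xs) → GSOSat G [] [] perfectMatching
  match⇒matching m u covers =
    involution⇒matching G (partner m) (λ v → partner-involutive m u (covers v)) (λ v → partner-E m (covers v))

-- The subgraph induced by a list of vertices

_∈?_ : ∀ {n} (v : Fin n) xs → Dec (v ∈ xs)
_∈?_ = DecMembership._∈?_ Fin._≟_

fromList : ∀ {n} → List (Fin n) → Subset n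
fromList zs = Vec.tabulate λ v → does (v ∈? zs)

∈fromList : ∀ {n} {zs : List (Fin n)} {v} → v Subset.∈ fromList zs ⇔ v ∈ zs
∈fromList {zs = zs} = ∈-tabulate (_∈? zs)

module Pull {n} (G : Graph n) (zs : List (Fin n)) where

  U : Subset n
  U = fromList zs

  H : Graph ∣ U ∣
  H = G [ U ]

  e : Fin ∣ U ∣ → Fin n
  e = element U

  pull : ∀ ws → (∀ {x} → x ∈ ws → x ∈ zs) → ∃ λ ws′ → List.map e ws′ ≡ ws
  pull []       sub = [] , refl
  pull (w ∷ ws) sub with element-surjective U (from ∈fromList (sub (here refl))) | pull ws (sub ∘ there)
  ... | i , eq | ws′ , eqs = i ∷ ws′ , cong₂ _∷_ eq eqs

  e-∈ : ∀ v → e v ∈ zs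
  e-∈ v = to ∈fromList (element-∈ U v)

  map-∈ : ∀ {ws v} → e v ∈ List.map e ws → v ∈ ws
  map-∈ {v = v} v∈ with ∈-map⁻ e v∈
  ... | x , x∈ , eq = subst (_∈ _) (sym (element-injective U eq)) x∈

  match-pull : ∀ ws → Match G (List.map e ws) → Match H ws
  match-pull []           []         = []
  match-pull (x ∷ y ∷ ws) (pair p m) = pair p (match-pull ws m)

-- Induced subgraphs that differ in a perfect matching but not in φ

record Twins {n} (G : Graph n) (φ : FOFormula 0) : Set where
  field
    A B        : List (Fin n)
    A-unique   : Unique A
    B-unique   : Unique B
    k          : ℕ
    A-odd      : length A ≡ suc (k + k)
    B-match    : Match G B
    B-nonempty : ∃ (_∈ B)
    equivalent : FOSat (G [ fromList A ]) [] φ ⇔ FOSat (G [ fromList B ]) [] φ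

twins-absurd : ∀ {ℓ} (C : GraphClass ℓ) → ClosedUnderInducedSubgraphs C → ∀ φ →
               (∀ {n} (G : Graph n) → C n G → GSOSat G [] [] perfectMatching ⇔ FOSat G [] φ) →
               ∀ {n} (G : Graph n) → C n G → ¬ Twins G φ
twins-absurd C closed φ defines G CG tw = no-matching
  (from (defines _ (closed G (fromList A) (fromList-nonempty A-nonempty) CG)) (from equivalent
    (to (defines _ (closed G (fromList B) (fromList-nonempty B-nonempty) CG)) has-matching)))
  where
  open Twins tw
  fromList-nonempty : ∀ {xs} → ∃ (_∈ xs) → Subset.Nonempty (fromList xs)
  fromList-nonempty (x , x∈) = x , from ∈fromList x∈
  A-nonempty : ∃ (_∈ A)
  A-nonempty = inhabited A A-odd
    where
    inhabited : ∀ xs → length xs ≡ suc (k + k) → ∃ (_∈ xs)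
    inhabited (x ∷ xs) _ = x , here refl
  pulled : ∀ zs → ∃ λ ws → List.map (element (fromList zs)) ws ≡ zs
  pulled zs = Pull.pull G zs zs id
  covers : ∀ zs v → v ∈ proj₁ (pulled zs)
  covers zs v = Pull.map-∈ G zs (subst (_ ∈_) (sym (proj₂ (pulled zs))) (Pull.e-∈ G zs v))
  unique : ∀ {zs} → Unique zs → Unique (proj₁ (pulled zs))
  unique {zs} u = Unique.map⁻ (subst Unique (sym (proj₂ (pulled zs))) u)
  no-matching : ¬ GSOSat (G [ fromList A ]) [] [] perfectMatching
  no-matching = odd⇒¬matching _ _ (unique A-unique) (covers A) k
    (trans (sym (List.length-map _ (proj₁ (pulled A)))) (trans (cong length (proj₂ (pulled A))) A-odd))
  has-matching : GSOSat (G [ fromList B ]) [] [] perfectMatching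
  has-matching =
    match⇒matching (Pull.match-pull G B _ (subst (Match G) (sym (proj₂ (pulled B))) B-match))
    (unique B-unique) (covers B)

length-take-≤ : ∀ {A : Set} k (xs : List A) → k ≤ length xs → length (take k xs) ≡ k
length-take-≤ k xs le = trans (List.length-take k xs) (ℕ.m≤n⇒m⊓n≡m le)

take-nonempty : ∀ {A : Set} k (xs : List A) → 1 ≤ k → k ≤ length xs → ∃ (_∈ take k xs)
take-nonempty (suc k) (x ∷ xs) _ _ = x , here refl

-- Positions along an induced path

module _ {n} (G : Graph n) where

  -- `IPath` without its end points, as a predicate on lists that is inherited by prefixes and by
  -- pull-backs to induced subgraphs.
  PathLike : List (Fin n) → Set
  PathLike (x ∷ u ∷ us) = E G x u × All (Induced.Far G x) us × PathLike (u ∷ us)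
  PathLike _            = ⊤

  IPath⇒PathLike : ∀ {u w xs} → Induced.IPath G u w xs → PathLike xs
  IPath⇒PathLike Induced.single           = tt
  IPath⇒PathLike (Induced.extend e far p) = e , far , IPath⇒PathLike p

  PathLike-take : ∀ k xs → PathLike xs → PathLike (take k xs)
  PathLike-take zero          xs           _             = tt
  PathLike-take (suc k)       []           _             = tt
  PathLike-take (suc zero)    (x ∷ xs)     _             = tt
  PathLike-take (suc (suc k)) (x ∷ [])     _             = tt
  PathLike-take (suc (suc k)) (x ∷ u ∷ us) (e , far , p) =
    e , All.take⁺ k far , PathLike-take (suc k) (u ∷ us) p

  PathLike⇒Linked : ∀ xs → PathLike xs → Linked (E G) xs
  PathLike⇒Linked []           _           = []
  PathLike⇒Linked (x ∷ [])     _           = [-]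
  PathLike⇒Linked (x ∷ u ∷ us) (e , _ , p) = e ∷ PathLike⇒Linked (u ∷ us) p

  PathLike⇒Unique : ∀ xs → PathLike xs → Unique xs
  PathLike⇒Unique []           _             = []
  PathLike⇒Unique (x ∷ [])     _             = [] ∷ []
  PathLike⇒Unique (x ∷ u ∷ us) (e , far , p) =
    ((λ { refl → E-irrefl G refl e }) ∷ All.map proj₂ far) ∷ PathLike⇒Unique (u ∷ us) p

  Consecutive : ℕ → ℕ → Set
  Consecutive i j = j ≡ suc i ⊎ i ≡ suc j

  PathLike-nth : ∀ xs → PathLike xs → ∀ i j {u v} → nth i xs ≡ just u → nth j xs ≡ just v →
    E G u v ⇔ Consecutive i j
  PathLike-nth (x ∷ xs) p zero zero refl refl =
    mk⇔ (λ e → ⊥-elim (E-irrefl G refl e)) λ { (inj₁ ()) ; (inj₂ ()) }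
  PathLike-nth (x ∷ u ∷ us) (e , _ , _) zero (suc zero) refl refl = mk⇔ (λ _ → inj₁ refl) (λ _ → e)
  PathLike-nth (x ∷ u ∷ us) (e , _ , _) (suc zero) zero refl refl =
    mk⇔ (λ _ → inj₂ refl) (λ _ → E-sym G e)
  PathLike-nth (x ∷ u ∷ us) (_ , far , _) zero (suc (suc j)) refl eq = mk⇔
    (λ e → ⊥-elim (proj₁ (All.lookup far (nth⇒∈ j us eq)) e)) λ { (inj₁ ()) ; (inj₂ ()) }
  PathLike-nth (x ∷ u ∷ us) (_ , far , _) (suc (suc i)) zero eq refl = mk⇔
    (λ e → ⊥-elim (proj₁ (All.lookup far (nth⇒∈ i us eq)) (E-sym G e))) λ { (inj₁ ()) ; (inj₂ ()) }
  PathLike-nth (x ∷ u ∷ us) (_ , _ , p) (suc i) (suc j) equ eqv = mk⇔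
    (Sum.map (cong suc) (cong suc) ∘ to (PathLike-nth (u ∷ us) p i j equ eqv))
    (from (PathLike-nth (u ∷ us) p i j equ eqv) ∘ Sum.map ℕ.suc-injective ℕ.suc-injective)

  nth-< : ∀ {A : Set} (xs : List A) {i} → i < length xs → ∃ λ x → nth i xs ≡ just x
  nth-< (x ∷ xs) {zero}  _        = x , refl
  nth-< (x ∷ xs) {suc i} (s≤s lt) = nth-< xs lt

  nth-unique : ∀ {A : Set} {x : A} xs → Unique xs → ∀ i j → nth i xs ≡ just x → nth j xs ≡ just x → i ≡ j
  nth-unique (x ∷ xs) _        zero    zero    _    _  = refl
  nth-unique (x ∷ xs) (ne ∷ _) zero    (suc j) refl eq = ⊥-elim (All.lookup ne (nth⇒∈ j xs eq) refl)
  nth-unique (x ∷ xs) (ne ∷ _) (suc i) zero    eq refl = ⊥-elim (All.lookup ne (nth⇒∈ i xs eq) refl)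
  nth-unique (x ∷ xs) (_ ∷ u)  (suc i) (suc j) p    q  = cong suc (nth-unique xs u i j p q)

  pathOrder : ∀ xs → PathLike xs → (∀ v → v ∈ xs) → PathOrder G (length xs)
  pathOrder xs p covers = record
    { pos     = pos
    ; pos-inj =
        λ {u} {v} eq → just-injective (trans (sym (nth-pos u)) (trans (cong (λ i → nth i xs) eq) (nth-pos v)))
    ; pos-<   = λ v → proj₁ (proj₂ (∈⇒nth (covers v)))
    ; pos-sur =
        λ {i} lt → let v , eq = nth-< xs lt in v , nth-unique xs (PathLike⇒Unique xs p) (pos v) i (nth-pos v) eq
    ; edge⇔   = λ u v → PathLike-nth xs p (pos u) (pos v) (nth-pos u) (nth-pos v)
    }
    where
    pos : Fin n → ℕ
    pos v = proj₁ (∈⇒nth (covers v))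
    nth-pos : ∀ v → nth (pos v) xs ≡ just v
    nth-pos v = proj₂ (proj₂ (∈⇒nth (covers v)))

module _ {n} (G : Graph n) (zs : List (Fin n)) where
  open Pull G zs

  pathlike-pull : ∀ ws → PathLike G (List.map e ws) → PathLike H ws
  pathlike-pull []           _             = tt
  pathlike-pull (x ∷ [])     _             = tt
  pathlike-pull (x ∷ u ∷ us) (a , far , p) =
    a , All.map (λ (¬a , neq) → ¬a , neq ∘ cong e) (All.map⁻ far) , pathlike-pull (u ∷ us) p

  pathOrder-pull : PathLike G zs → PathOrder H (length zs)
  pathOrder-pull p with pull zs id
  ... | ws , eq = subst (PathOrder H) (trans (sym (List.length-map e ws)) (cong length eq))
    (pathOrder H ws (pathlike-pull ws (subst (PathLike G) (sym eq) p))
      (λ v → map-∈ (subst (e v ∈_) (sym eq) (e-∈ v))))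

path-twins : ∀ {n} (G : Graph n) φ xs → PathLike G xs → let h = w (rank φ) in suc (h + h) ≤ length xs →
  Twins G φ
path-twins G φ xs p le = record
  { A = A ; B = B
  ; A-unique = PathLike⇒Unique G A pA
  ; B-unique = PathLike⇒Unique G B pB
  ; k = h
  ; A-odd = lenA
  ; B-match = linked-match h B lenB (PathLike⇒Linked G B pB)
  ; B-nonempty =
      take-nonempty (h + h) xs (ℕ.≤-trans (s≤s z≤n) (ℕ.≤-trans (w≥2 (rank φ)) (ℕ.m≤m+n h h))) le′
  ; equivalent = path-equivalent (pathOrder-pull G A pA) (pathOrder-pull G B pB) (rank φ)
      (ℕ.≤-trans (ℕ.m≤m+n h h) (ℕ.≤-trans (ℕ.n≤1+n _) (ℕ.≤-reflexive (sym lenA))))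
      (ℕ.≤-trans (ℕ.m≤m+n h h) (ℕ.≤-reflexive (sym lenB))) φ ℕ.≤-refl
  }
  where
  h = w (rank φ)
  le′ : h + h ≤ length xs
  le′ = ℕ.≤-trans (ℕ.n≤1+n _) le
  A = take (suc (h + h)) xs
  B = take (h + h) xs
  pA = PathLike-take G (suc (h + h)) xs p
  pB = PathLike-take G (h + h) xs p
  lenA = length-take-≤ (suc (h + h)) xs le
  lenB = length-take-≤ (h + h) xs le′

-- Cliques and complete bipartite graphs

lookup-injective : ∀ {A : Set} {xs : List A} → Unique xs → ∀ {i j} →
  List.lookup xs i ≡ List.lookup xs j → i ≡ j
lookup-injective (_ ∷ _)  {zero}  {zero}  _  = refl
lookup-injective (ne ∷ _) {zero}  {suc j} eq = ⊥-elim (All.lookup ne (∈-lookup j) eq)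
lookup-injective (ne ∷ _) {suc i} {zero}  eq = ⊥-elim (All.lookup ne (∈-lookup i) (sym eq))
lookup-injective (_ ∷ u)  {suc i} {suc j} eq = cong suc (lookup-injective u eq)

enumerate : ∀ {A : Set} {xs : List A} → Unique xs → ∀ {Q} → Q ≤ length xs →
            ∃ λ (g : Fin Q → A) → (∀ {i j} → g i ≡ g j → i ≡ j) × (∀ i → g i ∈ xs)
enumerate {xs = xs} u le = (λ i → List.lookup xs (Fin.inject≤ i le)) ,
  (λ eq → Fin.inject≤-injective le le _ _ (lookup-injective u eq)) , λ i → ∈-lookup (Fin.inject≤ i le)

AllPairs-lookup : ∀ {A : Set} {R : A → A → Set} {xs x y} → AllPairs R xs → x ∈ xs → y ∈ xs →
  x ≡ y ⊎ R x y ⊎ R y x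
AllPairs-lookup (p ∷ _)  (here refl) (here refl) = inj₁ refl
AllPairs-lookup (p ∷ _)  (here refl) (there y∈)  = inj₂ (inj₁ (All.lookup p y∈))
AllPairs-lookup (p ∷ _)  (there x∈)  (here refl) = inj₂ (inj₂ (All.lookup p x∈))
AllPairs-lookup (_ ∷ ps) (there x∈)  (there y∈)  = AllPairs-lookup ps x∈ y∈

Clique : ∀ {n} → Graph n → List (Fin n) → Set
Clique G = AllPairs (E G)

clique-unique : ∀ {n} (G : Graph n) {xs} → Clique G xs → Unique xs
clique-unique G = AllPairs.map λ e eq → E-irrefl G eq e

module _ {n} (G : Graph n) (zs : List (Fin n)) (cl : Clique G zs) where
  open Pull G zs

  private
    pulled = pull zs id
    ws = proj₁ pulled
    covers : ∀ v → v ∈ ws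
    covers v = map-∈ (subst (e v ∈_) (sym (proj₂ pulled)) (e-∈ v))

  clique-classified : Classified (λ _ _ → ⊤) H
  clique-classified = record
    { class = λ _ → true
    ; edge⇔ = λ u v → mk⇔ (λ a → (λ eq → E-irrefl H eq a) , tt) λ (u≢v , _) →
        case AllPairs-lookup (AllPairs.map⁻ (subst (Clique G) (sym (proj₂ pulled)) cl)) (covers u) (covers v) of λ where
          (inj₁ eq)       → ⊥-elim (u≢v eq)
          (inj₂ (inj₁ a)) → a
          (inj₂ (inj₂ a)) → E-sym H {v} {u} a
    }

  clique-large : ∀ {m Q} → Q ≤ length zs →
    Large {m = m} Q (Classified.class clique-classified) (λ _ → true)
  clique-large le v =
    let g , g-inj , _ = enumerate (Unique.map⁻ (subst Unique (sym (proj₂ pulled)) (clique-unique G cl)))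
                          (ℕ.≤-trans le (ℕ.≤-reflexive (trans (cong length (sym (proj₂ pulled))) (List.length-map e ws))))
    in g , g-inj , λ _ → refl

-- Cliques and bicliques need only `rank φ` vertices per class; this lets them share the constant
-- `w (rank φ)` with paths.
q≤w : ∀ q → q ≤ w q
q≤w zero    = z≤n
q≤w (suc q) = ℕ.≤-trans (ℕ.≤-reflexive (ℕ.+-comm 1 q)) (ℕ.+-mono-≤ (q≤w q) (ℕ.≤-trans (s≤s z≤n) (w≥2 q)))

clique-twins : ∀ {n} (G : Graph n) φ xs → Clique G xs → let h = w (rank φ) in suc (h + h) ≤ length xs →
  Twins G φ
clique-twins G φ xs cl le = record
  { A = A ; B = B
  ; A-unique = clique-unique G cA
  ; B-unique = clique-unique G cB
  ; k = h
  ; A-odd = lenA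
  ; B-match = linked-match h B lenB (Linked.AllPairs⇒Linked cB)
  ; B-nonempty =
      take-nonempty (h + h) xs (ℕ.≤-trans (s≤s z≤n) (ℕ.≤-trans (w≥2 (rank φ)) (ℕ.m≤m+n h h))) le′
  ; equivalent = classified-equivalent (clique-classified G A cA) (clique-classified G B cB) (rank φ)
      (clique-large G B cB (ℕ.≤-trans q≤2h (ℕ.≤-reflexive (sym lenB))))
      (clique-large G A cA (ℕ.≤-trans q≤2h (ℕ.≤-trans (ℕ.n≤1+n _) (ℕ.≤-reflexive (sym lenA))))) φ ℕ.≤-refl
  }
  where
  h = w (rank φ)
  q≤2h : rank φ ≤ h + h
  q≤2h = ℕ.≤-trans (q≤w (rank φ)) (ℕ.m≤m+n h h)
  le′ : h + h ≤ length xs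
  le′ = ℕ.≤-trans (ℕ.n≤1+n _) le
  A = take (suc (h + h)) xs
  B = take (h + h) xs
  cA = AllPairs.take⁺ (suc (h + h)) cl
  cB = AllPairs.take⁺ (h + h) cl
  lenA = length-take-≤ (suc (h + h)) xs le
  lenB = length-take-≤ (h + h) xs le′

record Biclique {n} (G : Graph n) (xs ys : List (Fin n)) : Set where
  field
    xs-unique : Unique xs
    ys-unique : Unique ys
    xs-indep  : AllPairs (λ x y → ¬ E G x y) xs
    ys-indep  : AllPairs (λ x y → ¬ E G x y) ys
    cross     : ∀ {x y} → x ∈ xs → y ∈ ys → E G x y

indep-lookup : ∀ {n} (G : Graph n) {xs} →
  AllPairs (λ x y → ¬ E G x y) xs → ∀ {x y} → x ∈ xs → y ∈ xs → ¬ E G x y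
indep-lookup G ind x∈ y∈ e with AllPairs-lookup ind x∈ y∈
... | inj₁ eq       = E-irrefl G eq e
... | inj₂ (inj₁ n) = n e
... | inj₂ (inj₂ n) = n (E-sym G e)

biclique-take : ∀ {n} {G : Graph n} {xs ys} i j → Biclique G xs ys → Biclique G (take i xs) (take j ys)
biclique-take i j b = record
  { xs-unique = Unique.take⁺ i xs-unique
  ; ys-unique = Unique.take⁺ j ys-unique
  ; xs-indep  = AllPairs.take⁺ i xs-indep
  ; ys-indep  = AllPairs.take⁺ j ys-indep
  ; cross     = λ x∈ y∈ → cross (take-⊆ i _ x∈) (take-⊆ j _ y∈)
  }
  where
  open Biclique b
  take-⊆ : ∀ {A : Set} k (xs : List A) {x} → x ∈ take k xs → x ∈ xs
  take-⊆ (suc k) (x ∷ xs) (here eq)  = here eq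
  take-⊆ (suc k) (x ∷ xs) (there x∈) = there (take-⊆ k xs x∈)

-- The order of `zs` is left open, so the concatenation used for the odd twin and the interleaving
-- used for the matched one are treated alike.
module Bipartite {n} (G : Graph n) (zs xs ys : List (Fin n)) (b : Biclique G xs ys)
                 (xs⊆ : ∀ {x} → x ∈ xs → x ∈ zs) (ys⊆ : ∀ {x} → x ∈ ys → x ∈ zs)
                 (zs⊆ : ∀ {x} → x ∈ zs → x ∈ xs ⊎ x ∈ ys) where
  open Pull G zs
  open Biclique b

  class : Fin ∣ U ∣ → Bool
  class v = does (e v ∈? xs)

  class-true : ∀ {v} → e v ∈ xs → class v ≡ true
  class-true {v} = Dec.dec-true (e v ∈? xs)

  class-false : ∀ {v} → e v ∈ ys → class v ≡ false
  class-false {v} y∈ = Dec.dec-false (e v ∈? xs) λ x∈ → E-irrefl G refl (cross x∈ y∈)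

  classified : Classified _≢_ H
  classified = record { class = class ; edge⇔ = edges }
    where
    edges : ∀ u v → E H u v ⇔ (u ≢ v × class u ≢ class v)
    edges u v with zs⊆ (e-∈ u) | zs⊆ (e-∈ v)
    ... | inj₁ u∈ | inj₁ v∈ = mk⇔ (λ a → ⊥-elim (indep-lookup G xs-indep u∈ v∈ a))
      (λ (_ , n) → ⊥-elim (n (trans (class-true u∈) (sym (class-true v∈)))))
    ... | inj₂ u∈ | inj₂ v∈ = mk⇔ (λ a → ⊥-elim (indep-lookup G ys-indep u∈ v∈ a))
      (λ (_ , n) → ⊥-elim (n (trans (class-false u∈) (sym (class-false v∈)))))
    ... | inj₁ u∈ | inj₂ v∈ = mk⇔ (λ a → (λ eq → E-irrefl H eq a) ,
        λ eq → case trans (sym (class-true u∈)) (trans eq (class-false v∈)) of λ ()) (λ _ → cross u∈ v∈)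
    ... | inj₂ u∈ | inj₁ v∈ = mk⇔ (λ a → (λ eq → E-irrefl H eq a) ,
        λ eq → case trans (sym (class-false u∈)) (trans eq (class-true v∈)) of λ ()) (λ _ → E-sym G (cross v∈ u∈))

  members : ∀ {ws c Q} → (∀ {x} → x ∈ ws → x ∈ zs) → Unique ws → Q ≤ length ws →
    (∀ {v} → e v ∈ ws → class v ≡ c) →
            ∃ λ (g : Fin Q → Fin ∣ U ∣) → (∀ {i j} → g i ≡ g j → i ≡ j) × (∀ i → class (g i) ≡ c)
  members {ws} sub u le cls with pull ws sub
  ... | ws′ , eq with enumerate (Unique.map⁻ (subst Unique (sym eq) u))
                        (ℕ.≤-trans le (ℕ.≤-reflexive (trans (cong length (sym eq)) (List.length-map e ws′))))
  ...   | g , g-inj , g∈ = g , g-inj , λ i → cls (subst (e (g i) ∈_) eq (∈-map⁺ e (g∈ i)))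

  large : ∀ {m Q} (cl : Fin m → Bool) → Q ≤ length xs → Q ≤ length ys → Large Q class cl
  large cl lx ly v with cl v
  ... | true  = members xs⊆ xs-unique lx class-true
  ... | false = members ys⊆ ys-unique ly class-false

-- Puts the partners of the matching next to each other, as `Match` expects.
interleave : ∀ {A : Set} → List A → List A → List A
interleave (x ∷ xs) (y ∷ ys) = x ∷ y ∷ interleave xs ys
interleave _        _        = []

∈-interleave⁻ : ∀ {A : Set} (xs ys : List A) {x} → x ∈ interleave xs ys → x ∈ xs ⊎ x ∈ ys
∈-interleave⁻ (x ∷ xs) (y ∷ ys) (here eq)          = inj₁ (here eq)
∈-interleave⁻ (x ∷ xs) (y ∷ ys) (there (here eq))  = inj₂ (here eq)
∈-interleave⁻ (x ∷ xs) (y ∷ ys) (there (there x∈)) = Sum.map there there (∈-interleave⁻ xs ys x∈)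

∈-interleaveˡ : ∀ {A : Set} (xs ys : List A) → length xs ≡ length ys → ∀ {x} → x ∈ xs →
  x ∈ interleave xs ys
∈-interleaveˡ (x ∷ xs) (y ∷ ys) len (here eq)  = here eq
∈-interleaveˡ (x ∷ xs) (y ∷ ys) len (there x∈) =
  there (there (∈-interleaveˡ xs ys (ℕ.suc-injective len) x∈))

∈-interleaveʳ : ∀ {A : Set} (xs ys : List A) → length xs ≡ length ys → ∀ {y} → y ∈ ys →
  y ∈ interleave xs ys
∈-interleaveʳ (x ∷ xs) (y ∷ ys) len (here eq)  = there (here eq)
∈-interleaveʳ (x ∷ xs) (y ∷ ys) len (there y∈) =
  there (there (∈-interleaveʳ xs ys (ℕ.suc-injective len) y∈))

interleave-unique : ∀ {A : Set} {xs ys : List A} → Unique xs → Unique ys →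
  (∀ {x y} → x ∈ xs → y ∈ ys → x ≢ y) →
                    Unique (interleave xs ys)
interleave-unique {xs = []} _ _ _ = []
interleave-unique {xs = _ ∷ _} {[]} _ _ _ = []
interleave-unique {xs = x ∷ xs} {y ∷ ys} (nx ∷ ux) (ny ∷ uy) disjoint =
  (disjoint (here refl) (here refl) ∷ All.tabulate (fresh-x ∘ ∈-interleave⁻ xs ys)) ∷
  All.tabulate (fresh-y ∘ ∈-interleave⁻ xs ys) ∷
  interleave-unique ux uy (λ p q → disjoint (there p) (there q))
  where
  fresh-x : ∀ {z} → z ∈ xs ⊎ z ∈ ys → x ≢ z
  fresh-x = [ All.lookup nx , disjoint (here refl) ∘ there ]
  fresh-y : ∀ {z} → z ∈ xs ⊎ z ∈ ys → y ≢ z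
  fresh-y = [ (λ z∈ eq → disjoint (there z∈) (here refl) (sym eq)) , All.lookup ny ]

interleave-match : ∀ {n} {G : Graph n} xs ys → (∀ {x y} → x ∈ xs → y ∈ ys → E G x y) →
  Match G (interleave xs ys)
interleave-match []       ys       cross = []
interleave-match (x ∷ xs) []       cross = []
interleave-match (x ∷ xs) (y ∷ ys) cross =
  pair (cross (here refl) (here refl)) (interleave-match xs ys λ p q → cross (there p) (there q))

biclique-twins : ∀ {n} (G : Graph n) φ xs ys → Biclique G xs ys → let h = w (rank φ) in
                 suc h ≤ length xs → suc h ≤ length ys → Twins G φ
biclique-twins G φ xs ys b lx ly = record
  { A = X ++ Y⁺ ; B = interleave X Y
  ; A-unique = Unique.++⁺ A.xs-unique A.ys-unique λ (x∈ , y∈) → E-irrefl G refl (A.cross x∈ y∈)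
  ; B-unique = interleave-unique B.xs-unique B.ys-unique λ x∈ y∈ eq → E-irrefl G eq (B.cross x∈ y∈)
  ; k = h
  ; A-odd = trans (List.length-++ X) (trans (cong₂ _+_ lenX lenY⁺) (ℕ.+-suc h h))
  ; B-match = interleave-match X Y B.cross
  ; B-nonempty = let x , x∈ = take-nonempty h xs (ℕ.≤-trans (s≤s z≤n) (w≥2 (rank φ))) (ℕ.<⇒≤ lx) in
      x , ∈-interleaveˡ X Y len x∈
  ; equivalent = classified-equivalent SA.classified SB.classified (rank φ)
      (SB.large _ (ℕ.≤-trans q≤h (ℕ.≤-reflexive (sym lenX))) (ℕ.≤-trans q≤h (ℕ.≤-reflexive (sym lenY))))
      (SA.large _ (ℕ.≤-trans q≤h (ℕ.≤-reflexive (sym lenX))) (ℕ.≤-trans q≤h (ℕ.≤-trans (ℕ.n≤1+n h) (ℕ.≤-reflexive (sym lenY⁺)))))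
      φ ℕ.≤-refl
  }
  where
  h = w (rank φ)
  q≤h : rank φ ≤ h
  q≤h = q≤w (rank φ)
  X = take h xs
  Y = take h ys
  Y⁺ = take (suc h) ys
  lenX = length-take-≤ h xs (ℕ.<⇒≤ lx)
  lenY = length-take-≤ h ys (ℕ.<⇒≤ ly)
  lenY⁺ = length-take-≤ (suc h) ys ly
  len : length X ≡ length Y
  len = trans lenX (sym lenY)
  bA = biclique-take h (suc h) b
  bB = biclique-take h h b
  module A = Biclique bA
  module B = Biclique bB
  module SA = Bipartite G (X ++ Y⁺) X Y⁺ bA ∈-++⁺ˡ (∈-++⁺ʳ X) (∈-++⁻ X)
  module SB = Bipartite G (interleave X Y) X Y bB (∈-interleaveˡ X Y len) (∈-interleaveʳ X Y len) (∈-interleave⁻ X Y)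

-- Unbounded tree depth

twins⇒path-< : ∀ {n} (G : Graph n) φ → ¬ Twins G φ → let h = w (rank φ) in
               ∀ x xs → IsPath G (x ∷ xs) → length (x ∷ xs) < pathNumber (suc (h + h))
twins⇒path-< {n} G φ none x xs (linked , unique) = ℕ.≰⇒> absurd
  where
  h = w (rank φ)
  -- Large enough for all three cases: paths and cliques need `2h + 1` vertices, bicliques `h + 1`
  -- on each side.
  s = suc (h + h)
  vs = x ∷ xs
  N = length vs
  p : ℕ → Fin n
  p i = fromMaybe x (nth i vs)
  p-nth : ∀ {i} → i < N → nth i vs ≡ just (p i)
  p-nth {i} lt with nth-< G vs lt
  ... | y , eq rewrite eq = refl
  linked-nth : ∀ ys → Linked (E G) ys → ∀ i {u v} → nth i ys ≡ just u → nth (suc i) ys ≡ just v → E G u v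
  linked-nth (_ ∷ _ ∷ _) (e ∷ _) zero    refl refl = e
  linked-nth (_ ∷ ys)    l       (suc i) p    q    = linked-nth ys (Linked.tail l) i p q
  walk : ∀ {m} → suc m < N → E G (p m) (p (suc m))
  walk {m} lt = linked-nth vs linked m (p-nth (ℕ.<-trans (ℕ.n<1+n m) lt)) (p-nth lt)
  p-inj : ∀ {i j} → i < N → j < N → p i ≡ p j → i ≡ j
  p-inj {i} {j} li lj eq = nth-unique G vs unique i j (p-nth li) (trans (p-nth lj) (cong just (sym eq)))
  h<s : suc h ≤ s
  h<s = s≤s (ℕ.m≤m+n h h)
  absurd : ¬ pathNumber s ≤ N
  absurd = Induced.Unavoidable.absurd G N p walk p-inj s
    (λ {u} {v} {zs} path → ℕ.≰⇒> λ le → none (path-twins G φ zs (IPath⇒PathLike G path) le))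
    (λ {zs} cl → ℕ.≰⇒> λ le → none (clique-twins G φ zs cl le))
    (λ {us} {vs} uu uv iu iv cross lu lv → none (biclique-twins G φ us vs
      (record { xs-unique = uu ; ys-unique = uv ; xs-indep = iu ; ys-indep = iv ; cross = cross })
      (ℕ.≤-trans h<s lu) (ℕ.≤-trans h<s lv)))

collapse⇒bounded : ∀ {ℓ : Level} (C : GraphClass ℓ) → ClosedUnderInducedSubgraphs C →
                   SameExpressivePower FO GSO C → BoundedTreeDepth C
collapse⇒bounded C closed (_ , gso≦fo) = pathNumber (suc (h + h)) , λ {n} G GC →
  -- All paths are short, so each vertex can be chosen as the starting point for its own component.
  treeDepth-≤ G (<-wellFounded n) _ λ v → v , ε , λ xs path →
    ℕ.<⇒≤ (twins⇒path-< G φ (twins-absurd C closed φ (λ G GC → defines G GC) G GC) v xs path)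
  where
  φ : FOFormula 0
  φ = proj₁ (gso≦fo perfectMatching)
  defines : ∀ {n} (G : Graph n) → C n G → GSOSat G [] [] perfectMatching ⇔ FOSat G [] φ
  defines = proj₂ (gso≦fo perfectMatching)
  h = w (rank φ)

theorem3 : ∀ {ℓ : Level} (C : GraphClass ℓ) → ClosedUnderInducedSubgraphs C →
    SameExpressivePower FO GSO C ⇔ BoundedTreeDepth C
theorem3 C closed = mk⇔ (collapse⇒bounded C closed) (bounded⇒collapse C)
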